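{- Let $n$ be a positive integer with $n\equiv 1\pmod 4$, and let $M=(n-1)/2$ or $M=n-1$. Then \[ \sum_{k=0}^{M}[6k+1]\frac{(q;q^2)_k^3(q;q^4)_k}{(q^2;q^2)_k(q^4;q^4)_k^3}q^{k^2+k} \equiv[n]q^{(1-n)/4}\frac{(q^2;q^4)_{(n-1)/4}}{(q^4;q^4)_{(n-1)/4}}\bigg\{1-[n]^2\sum_{j=1}^{(n-1)/4}\frac{q^{4j}}{[4j]^2}\bigg\}\pmod{[n]\Phi_n(q)^3}. \]
   Context: For a complex number $x$ and integer $n\ge 0$, $(x;q)_n=\prod_{j=0}^{n-1}(1-xq^j)$ (with $(x;q)_0=1$). $[r]=(1-q^r)/(1-q)$ denotes the $q$-integer, and $\Phi_n(q)$ is the $n$-th cyclotomic polynomial in $q$. A congruence $A(q)\equiv B(q)\pmod{P(q)}$ between rational functions in $q$ whose denominators are coprime to the polynomial $P(q)$ means that $A(q)-B(q)$ is a rational function whose numerator is divisible by $P(q)$ and whose denominator is coprime to $P(q)$. -}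

module Defs where

open import Data.Nat as ℕ using (ℕ; zero; suc)
open import Data.Nat.Divisibility using (_∣_; _∣?_)
open import Data.Integer as ℤ using (ℤ; +_; 0ℤ; 1ℤ)
open import Data.List using (List; []; _∷_; map; replicate; _++_)
open import Data.Product using (Σ; ∃; _×_; _,_)
open import Relation.Binary.PropositionalEquality using (_≡_; _≢_)
open import Relation.Nullary using (yes; no)

-- Polynomials in q with integer coefficients, as coefficient lists
-- (constant term first).  Equality is coefficientwise (trailing zeros
-- are irrelevant).

Poly : Set
Poly = List ℤ

coeff : Poly → ℕ → ℤ
coeff []      _       = 0ℤ
coeff (a ∷ p) zero    = a
coeff (a ∷ p) (suc i) = coeff p i

infix 4 _≈P_
_≈P_ : Poly → Poly → Set
p ≈P r = ∀ i → coeff p i ≡ coeff r i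

infixl 6 _+P_ _-P_
infixl 7 _*P_
infixr 8 _^P_

_+P_ : Poly → Poly → Poly
[]      +P r       = r
(a ∷ p) +P []      = a ∷ p
(a ∷ p) +P (b ∷ r) = (a ℤ.+ b) ∷ (p +P r)

negP : Poly → Poly
negP = map (λ a → ℤ.- a)

_-P_ : Poly → Poly → Poly
p -P r = p +P negP r

scaleP : ℤ → Poly → Poly
scaleP a = map (a ℤ.*_)

_*P_ : Poly → Poly → Poly
[]      *P r = []
(a ∷ p) *P r = scaleP a r +P (0ℤ ∷ (p *P r))

constP : ℤ → Poly
constP c = c ∷ []

oneP : Poly
oneP = constP 1ℤ

qpow : ℕ → Poly
qpow k = replicate k 0ℤ ++ (1ℤ ∷ [])

_^P_ : Poly → ℕ → Poly
p ^P zero  = oneP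
p ^P suc k = p *P (p ^P k)

-- divisibility and coprimality in ℤ[q] (coprimality = no common
-- nonconstant factor, i.e. a nonzero integer lies in the ideal (D, P))
_∣P_ : Poly → Poly → Set
P ∣P N = ∃ λ K → N ≈P P *P K

CoprimeP : Poly → Poly → Set
CoprimeP D P = Σ Poly λ U → Σ Poly λ V → Σ ℤ λ c →
  (c ≢ 0ℤ) × (U *P D +P V *P P ≈P constP c)

poch : Poly → Poly → ℕ → Poly
poch x b zero    = oneP
poch x b (suc k) = poch x b k *P (oneP -P x *P (b ^P k))

qint : ℕ → Poly
qint zero    = []
qint (suc r) = qint r +P qpow r

prodDiv : (ℕ → Poly) → ℕ → Poly
prodDiv f n = go n
  where
  go : ℕ → Poly
  go zero    = oneP
  go (suc d) with suc d ∣? n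
  ... | yes _ = go d *P f (suc d)
  ... | no  _ = go d

-- A family Φ is the family of cyclotomic polynomials iff
-- q^n - 1 = ∏_{d ∣ n} Φ_d for all n ≥ 1 (this determines Φ uniquely).
IsCyclotomic : (ℕ → Poly) → Set
IsCyclotomic Φ = ∀ n → 1 ℕ.≤ n → prodDiv Φ n ≈P qpow n -P oneP

record RatFun : Set where
  constructor _/ᵣ_
  field
    num : Poly
    den : Poly
open RatFun public

fromPoly : Poly → RatFun
fromPoly p = p /ᵣ oneP

infixl 6 _+R_ _-R_
infixl 7 _*R_ _÷R_

_+R_ : RatFun → RatFun → RatFun
(a /ᵣ b) +R (c /ᵣ d) = (a *P d +P c *P b) /ᵣ (b *P d)

_-R_ : RatFun → RatFun → RatFun
(a /ᵣ b) -R (c /ᵣ d) = (a *P d -P c *P b) /ᵣ (b *P d)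

_*R_ : RatFun → RatFun → RatFun
(a /ᵣ b) *R (c /ᵣ d) = (a *P c) /ᵣ (b *P d)

_÷R_ : RatFun → RatFun → RatFun
(a /ᵣ b) ÷R (c /ᵣ d) = (a *P d) /ᵣ (b *P c)

sumR : ℕ → (ℕ → RatFun) → RatFun
sumR zero    f = fromPoly []
sumR (suc n) f = sumR n f +R f n

-- A ≡ B (mod P): A - B = N / D with P ∣ N and D coprime to P
CongR : RatFun → RatFun → Poly → Set
CongR A B P = Σ Poly λ N → Σ Poly λ D →
  (P ∣P N) × CoprimeP D P ×
  ((num A *P den B -P num B *P den A) *P D ≈P N *P (den A *P den B))

q : Poly
q = qpow 1

lhsTerm : ℕ → RatFun
lhsTerm k =
  (fromPoly (qint (6 ℕ.* k ℕ.+ 1) *P (poch q (q ^P 2) k ^P 3) *P poch q (q ^P 4) k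
              *P qpow (k ℕ.* k ℕ.+ k))
   ÷R fromPoly (poch (q ^P 2) (q ^P 2) k *P (poch (q ^P 4) (q ^P 4) k ^P 3)))

LHS : ℕ → RatFun
LHS M = sumR (suc M) lhsTerm

-- m = (n-1)/4;  q^{(1-n)/4} = 1 / q^m
RHS : ℕ → ℕ → RatFun
RHS n m =
  fromPoly (qint n)
  *R (fromPoly oneP ÷R fromPoly (qpow m))
  *R (fromPoly (poch (q ^P 2) (q ^P 4) m) ÷R fromPoly (poch (q ^P 4) (q ^P 4) m))
  *R (fromPoly oneP -R
        fromPoly (qint n ^P 2)
        *R sumR m (λ i → fromPoly (qpow (4 ℕ.* suc i)) ÷R fromPoly (qint (4 ℕ.* suc i) ^P 2)))

-- Multiplied by 1 − q, the left-hand side is the value at a = q, b = q, d = q of the confluent case f → ∞ of Rahman's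
-- quadratic series in base q². This series terminates and is summable when a = q^(1 − n) (with sum 0), when
-- b = q^(1 ± n), or when d = q^(1 − n); each sum follows from a contiguous relation certified in the WZ manner.
-- The series is a rational function of a, b + q² / b and d without poles modulo Φ n at these parameters, and the three
-- substitutions move the parameters by multiples of 1 − qⁿ, (1 − qⁿ)² and 1 − qⁿ. Hence the alternating sum of its
-- values at the eight corners is divisible by (1 − qⁿ)⁴. Four corners vanish, and the three other known corners give the
-- right-hand side modulo (Φ n)⁴.
-- For a divisor 1 < e < n of n, the sum splits into blocks of length e whose terms are proportional, modulo Φ e, to those
-- of the first block, and that block is congruent to a terminating series whose sum contains the factor 1 − q^(e j).
-- Both sides are therefore divisible by Φ e, and the congruences for the pairwise coprime moduli combine.
module Submission where

open import Defs
open import Algebra.Bundles using (CommutativeRing)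
open import Level using (0ℓ; _⊔_)
open import Data.Bool using (Bool; true; false)
open import Data.Integer as ℤ using (ℤ; +_; -[1+_]; _⊖_; 0ℤ; 1ℤ; ∣_∣)
import Data.Integer.Divisibility.Signed as ℤ
import Data.Integer.Properties as ℤ
open import Data.Integer.Solver using (module +-*-Solver)
open import Data.List using ([]; _∷_)
open import Data.Nat as ℕ using (ℕ; zero; suc; _≤_; _<_; s≤s; z≤n)
import Data.Nat.Divisibility as ℕ
import Data.Nat.DivMod as ℕ
import Data.Nat.Properties as ℕ
open import Data.Nat.Tactic.RingSolver using (solve-∀)
open import Data.Product using (∃; _×_; _,_; proj₁; proj₂)
open import Data.Sum using (_⊎_; inj₁; inj₂)
open import Data.Unit using (⊤; tt)
open import Data.Vec using (Vec; []; _∷_)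
open import Function using (_∘_)
open import Relation.Nullary using (¬_; yes; no; contradiction)
import Relation.Binary.PropositionalEquality as ≡
open ≡ using (_≡_; _≢_)

-- The parameter b enters only through σ = b + q² / b. Moving b from q to q^(1 + n) turns q² / b
-- into q^(1 - n) and changes σ by q^(1 - n) (1 - qⁿ)²; this symmetry is why three substitutions
-- reach order 1 + 2 + 1 = 4. The sum over j on the right-hand side is the first-order term in (1 -
-- qⁿ)² of the quotient of two closed forms, those for d = q^(1 - n) with b = q and with b = q^(1 +
-- n); the factor before the brace is the closed form for b = q^(1 + n), d = q.
--
-- Divisibility is measured in the subring of ℚ(q) of fractions whose denominator is coprime to one
-- Φ e. For e = n the denominators of all terms are units there. For a proper divisor e they are
-- not: every block of e indices ends with a factor (1 - q^e)⁴ in the denominator. The numerator of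
-- the same block contains (1 - q^e)⁴ as well, so that the terms at the block boundaries are
-- integral, and this has to be known before a congruence for one block can be multiplied by the
-- term in front of it.

-- Ring identities with integer coefficients

module IntegerSolver {c ℓ} (R : CommutativeRing c ℓ) where
  open import Algebra.Solver.Ring.AlmostCommutativeRing
  open import Data.Maybe using (Maybe; just; nothing)
  open CommutativeRing R
  open import Algebra.Properties.Ring ring
  open import Algebra.Properties.AbelianGroup +-abelianGroup
  open import Algebra.Properties.Semiring.Mult.TCOptimised semiring
    using (×-homo-+; ×1-homo-*) renaming (_×_ to _×′_)
  open import Relation.Binary.Reasoning.Setoid setoid

  -- The optimised multiple makes `1 ×′ 1#` reduce to `1#`, so that the constant `con (+ 1)` of the
  -- solver agrees with the `1#` of a goal by computation.
  fromℤ : ℤ → Carrier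
  fromℤ (+ n)    = n ×′ 1#
  fromℤ -[1+ n ] = - (suc n ×′ 1#)

  private
    ×-suc : ∀ n → suc n ×′ 1# ≈ 1# + n ×′ 1#
    ×-suc n = ×-homo-+ 1# 1 n

    fromℤ-neg : ∀ i → fromℤ (ℤ.- i) ≈ - fromℤ i
    fromℤ-neg (+ zero)  = sym -0#≈0#
    fromℤ-neg (+ suc n) = refl
    fromℤ-neg -[1+ n ]  = sym (-‿involutive _)

    cancel-1 : ∀ x y → (1# + x) - (1# + y) ≈ x - y
    cancel-1 x y = begin
      (1# + x) + - (1# + y)      ≈⟨ +-cong (+-comm _ _) (sym (⁻¹-∙-comm _ _)) ⟩
      (x + 1#) + (- 1# + - y)    ≈⟨ +-assoc _ _ _ ⟩
      x + (1# + (- 1# + - y))    ≈⟨ +-congˡ (sym (+-assoc _ _ _)) ⟩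
      x + ((1# + - 1#) + - y)    ≈⟨ +-congˡ (+-congʳ (-‿inverseʳ 1#)) ⟩
      x + (0# + - y)             ≈⟨ +-congˡ (+-identityˡ _) ⟩
      x + - y                    ∎

    fromℤ-⊖ : ∀ m n → fromℤ (m ⊖ n) ≈ m ×′ 1# - n ×′ 1#
    fromℤ-⊖ zero    zero    = sym (-‿inverseʳ _)
    fromℤ-⊖ zero    (suc n) = sym (+-identityˡ _)
    fromℤ-⊖ (suc m) zero    = sym (trans (+-congˡ -0#≈0#) (+-identityʳ _))
    fromℤ-⊖ (suc m) (suc n) = begin
      fromℤ (suc m ⊖ suc n)              ≡⟨ ≡.cong fromℤ (ℤ.[1+m]⊖[1+n]≡m⊖n m n) ⟩
      fromℤ (m ⊖ n)                      ≈⟨ fromℤ-⊖ m n ⟩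
      m ×′ 1# - n ×′ 1#                    ≈⟨ cancel-1 _ _ ⟨
      (1# + m ×′ 1#) - (1# + n ×′ 1#)      ≈⟨ +-cong (×-suc m) (-‿cong (×-suc n)) ⟨
      suc m ×′ 1# - suc n ×′ 1#            ∎

  fromℤ-+ : ∀ i j → fromℤ (i ℤ.+ j) ≈ fromℤ i + fromℤ j
  fromℤ-+ (+ m)    (+ n)    = ×-homo-+ 1# m n
  fromℤ-+ (+ m)    -[1+ n ] = fromℤ-⊖ m (suc n)
  fromℤ-+ -[1+ m ] (+ n)    = trans (fromℤ-⊖ n (suc m)) (+-comm _ _)
  fromℤ-+ -[1+ m ] -[1+ n ] = begin
    - (suc (suc (m ℕ.+ n)) ×′ 1#)      ≡⟨ ≡.cong (λ k → - (k ×′ 1#)) (lemma m n) ⟩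
    - ((suc m ℕ.+ suc n) ×′ 1#)        ≈⟨ -‿cong (×-homo-+ 1# (suc m) (suc n)) ⟩
    - (suc m ×′ 1# + suc n ×′ 1#)       ≈⟨ ⁻¹-∙-comm _ _ ⟨
    - (suc m ×′ 1#) + - (suc n ×′ 1#)   ∎
    where
    open import Data.Nat.Properties using (+-suc)
    lemma : ∀ m n → suc (suc (m ℕ.+ n)) ≡.≡ suc m ℕ.+ suc n
    lemma m n = ≡.cong suc (≡.sym (+-suc m n))

  fromℤ-*-pos : ∀ m n → fromℤ (+ m ℤ.* + n) ≈ fromℤ (+ m) * fromℤ (+ n)
  fromℤ-*-pos m n = trans (reflexive (≡.cong fromℤ (≡.sym (ℤ.pos-* m n)))) (×1-homo-* m n)

  fromℤ-* : ∀ i j → fromℤ (i ℤ.* j) ≈ fromℤ i * fromℤ j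
  fromℤ-* (+ m)    (+ n)    = fromℤ-*-pos m n
  fromℤ-* (+ m)    -[1+ n ] = begin
    fromℤ (+ m ℤ.* -[1+ n ])            ≡⟨ ≡.cong fromℤ (≡.sym (ℤ.neg-distribʳ-* (+ m) (+ suc n))) ⟩
    fromℤ (ℤ.- (+ m ℤ.* + suc n))       ≈⟨ fromℤ-neg (+ m ℤ.* + suc n) ⟩
    - fromℤ (+ m ℤ.* + suc n)           ≈⟨ -‿cong (fromℤ-*-pos m (suc n)) ⟩
    - (fromℤ (+ m) * fromℤ (+ suc n))   ≈⟨ -‿distribʳ-* _ _ ⟩
    fromℤ (+ m) * fromℤ -[1+ n ]        ∎
  fromℤ-* -[1+ m ] (+ n)    = begin
    fromℤ (-[1+ m ] ℤ.* + n)            ≡⟨ ≡.cong fromℤ (≡.sym (ℤ.neg-distribˡ-* (+ suc m) (+ n))) ⟩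
    fromℤ (ℤ.- (+ suc m ℤ.* + n))       ≈⟨ fromℤ-neg (+ suc m ℤ.* + n) ⟩
    - fromℤ (+ suc m ℤ.* + n)           ≈⟨ -‿cong (fromℤ-*-pos (suc m) n) ⟩
    - (fromℤ (+ suc m) * fromℤ (+ n))   ≈⟨ -‿distribˡ-* _ _ ⟩
    fromℤ -[1+ m ] * fromℤ (+ n)        ∎
  fromℤ-* -[1+ m ] -[1+ n ] = begin
    fromℤ (+ suc m ℤ.* + suc n)                 ≈⟨ fromℤ-*-pos (suc m) (suc n) ⟩
    fromℤ (+ suc m) * fromℤ (+ suc n)           ≈⟨ -‿involutive _ ⟨
    - - (fromℤ (+ suc m) * fromℤ (+ suc n))     ≈⟨ -‿cong (-‿distribʳ-* _ _) ⟩
    - (fromℤ (+ suc m) * fromℤ -[1+ n ])        ≈⟨ -‿distribˡ-* _ _ ⟩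
    fromℤ -[1+ m ] * fromℤ -[1+ n ]             ∎

  private
    morphism : ℤ.+-*-rawRing -Raw-AlmostCommutative⟶ fromCommutativeRing R
    morphism = record
      { ⟦_⟧    = fromℤ
      ; +-homo = fromℤ-+
      ; *-homo = fromℤ-*
      ; -‿homo = fromℤ-neg
      ; 0-homo = refl
      ; 1-homo = refl
      }

    fromℤ≟ : ∀ i j → Maybe (fromℤ i ≈ fromℤ j)
    fromℤ≟ i j with i ℤ.≟ j
    ... | yes ≡.refl = just refl
    ... | no _       = nothing

  open import Algebra.Solver.Ring ℤ.+-*-rawRing (fromCommutativeRing R) morphism fromℤ≟ public
    using (Polynomial; solve; _:=_; _:+_; _:*_; _:-_; :-_; con)

-- The polynomial ring ℤ[q] and its lack of zero divisors

module Polynomials where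
  open ≡ using (refl; sym; trans; cong; cong₂; module ≡-Reasoning)

  -- Lists with different trailing zeros denote the same polynomial. On coefficient functions the
  -- equality is pointwise, and the ring laws become identities between convolutions.
  Series : Set
  Series = ℕ → ℤ

  infix 4 _≐_
  _≐_ : Series → Series → Set
  f ≐ g = ∀ i → f i ≡ g i

  conv : Series → Series → Series
  conv f g zero    = f 0 ℤ.* g 0
  conv f g (suc i) = f 0 ℤ.* g (suc i) ℤ.+ conv (f ∘ suc) g i

  conv-cong : ∀ {f f′ g g′} → f ≐ f′ → g ≐ g′ → conv f g ≐ conv f′ g′
  conv-cong e e′ zero    = cong₂ ℤ._*_ (e 0) (e′ 0)
  conv-cong e e′ (suc i) = cong₂ ℤ._+_ (cong₂ ℤ._*_ (e 0) (e′ (suc i))) (conv-cong (e ∘ suc) e′ i)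

  conv-zeroˡ : ∀ g → conv (λ _ → 0ℤ) g ≐ λ _ → 0ℤ
  conv-zeroˡ g zero    = refl
  conv-zeroˡ g (suc i) = trans (ℤ.+-identityˡ _) (conv-zeroˡ g i)

  open +-*-Solver using (solve; _:=_; _:+_; _:*_)

  conv-sucʳ : ∀ f g i → conv f g (suc i) ≡ conv f (g ∘ suc) i ℤ.+ f (suc i) ℤ.* g 0
  conv-sucʳ f g zero    = refl
  conv-sucʳ f g (suc i) = trans
    (cong (λ z → (f 0 ℤ.* g (suc (suc i))) ℤ.+ z) (conv-sucʳ (f ∘ suc) g i))
    (sym (ℤ.+-assoc (f 0 ℤ.* g (suc (suc i))) _ _))

  conv-comm : ∀ f g → conv f g ≐ conv g f
  conv-comm f g zero    = ℤ.*-comm (f 0) (g 0)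
  conv-comm f g (suc i) = begin
    conv f g (suc i)                                ≡⟨ conv-sucʳ f g i ⟩
    conv f (g ∘ suc) i ℤ.+ f (suc i) ℤ.* g 0        ≡⟨ cong₂ ℤ._+_ (conv-comm f (g ∘ suc) i) (ℤ.*-comm (f (suc i)) (g 0)) ⟩
    conv (g ∘ suc) f i ℤ.+ g 0 ℤ.* f (suc i)        ≡⟨ ℤ.+-comm (conv (g ∘ suc) f i) _ ⟩
    conv g f (suc i)                                ∎
    where open ≡-Reasoning

  conv-distribʳ : ∀ f g h → conv (λ i → f i ℤ.+ g i) h ≐ λ i → conv f h i ℤ.+ conv g h i
  conv-distribʳ f g h zero    = ℤ.*-distribʳ-+ (h 0) (f 0) (g 0)
  conv-distribʳ f g h (suc i) = trans
    (cong (λ z → ((f 0 ℤ.+ g 0) ℤ.* h (suc i)) ℤ.+ z) (conv-distribʳ (f ∘ suc) (g ∘ suc) h i))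
    (solve 5 (λ a b c u v → (a :+ b) :* c :+ (u :+ v) := (a :* c :+ u) :+ (b :* c :+ v)) refl
       (f 0) (g 0) (h (suc i)) (conv (f ∘ suc) h i) (conv (g ∘ suc) h i))

  conv-scaleˡ : ∀ a f g → conv (λ i → a ℤ.* f i) g ≐ λ i → a ℤ.* conv f g i
  conv-scaleˡ a f g zero    = ℤ.*-assoc a (f 0) (g 0)
  conv-scaleˡ a f g (suc i) = trans
    (cong (λ z → (a ℤ.* f 0 ℤ.* g (suc i)) ℤ.+ z) (conv-scaleˡ a (f ∘ suc) g i))
    (solve 4 (λ a b c d → a :* b :* c :+ a :* d := a :* (b :* c :+ d)) refl
       a (f 0) (g (suc i)) (conv (f ∘ suc) g i))

  conv-assoc : ∀ f g h → conv (conv f g) h ≐ conv f (conv g h)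
  conv-assoc f g h zero    = ℤ.*-assoc (f 0) (g 0) (h 0)
  conv-assoc f g h (suc i) = begin
    f 0 ℤ.* g 0 ℤ.* h (suc i) ℤ.+ conv (λ j → f 0 ℤ.* g (suc j) ℤ.+ conv (f ∘ suc) g j) h i
      ≡⟨ cong (λ z → (f 0 ℤ.* g 0 ℤ.* h (suc i)) ℤ.+ z) (conv-distribʳ _ _ h i) ⟩
    f 0 ℤ.* g 0 ℤ.* h (suc i) ℤ.+ (conv (λ j → f 0 ℤ.* g (suc j)) h i ℤ.+ conv (conv (f ∘ suc) g) h i)
      ≡⟨ cong (λ z → (f 0 ℤ.* g 0 ℤ.* h (suc i)) ℤ.+ z)
           (cong₂ ℤ._+_ (conv-scaleˡ (f 0) (g ∘ suc) h i) (conv-assoc (f ∘ suc) g h i)) ⟩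
    f 0 ℤ.* g 0 ℤ.* h (suc i) ℤ.+ (f 0 ℤ.* conv (g ∘ suc) h i ℤ.+ conv (f ∘ suc) (conv g h) i)
      ≡⟨ solve 5 (λ a b c u v → a :* b :* c :+ (a :* u :+ v) := a :* (b :* c :+ u) :+ v) refl
           (f 0) (g 0) (h (suc i)) (conv (g ∘ suc) h i) (conv (f ∘ suc) (conv g h) i) ⟩
    f 0 ℤ.* (g 0 ℤ.* h (suc i) ℤ.+ conv (g ∘ suc) h i) ℤ.+ conv (f ∘ suc) (conv g h) i ∎
    where open ≡-Reasoning

  -- Locates the lowest nonzero coefficient. Lowest coefficients multiply, which makes products
  -- nonzero without any notion of degree.
  data NonZero (f : Series) : Set where
    here  : f 0 ≢ 0ℤ → NonZero f
    there : f 0 ≡ 0ℤ → NonZero (f ∘ suc) → NonZero f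

  NonZero-resp : ∀ {f g} → f ≐ g → NonZero f → NonZero g
  NonZero-resp e (here nz)    = here (nz ∘ trans (e 0))
  NonZero-resp e (there z nz) = there (trans (sym (e 0)) z) (NonZero-resp (e ∘ suc) nz)

  nonZero-at : ∀ {f} k → f k ≢ 0ℤ → NonZero f
  nonZero-at zero nz = here nz
  nonZero-at {f} (suc k) nz with f 0 ℤ.≟ 0ℤ
  ... | yes z = there z (nonZero-at k nz)
  ... | no h  = here h

  NonZero⇒≢0 : ∀ {f} → NonZero f → ¬ (f ≐ λ _ → 0ℤ)
  NonZero⇒≢0 (here nz)    z = nz (z 0)
  NonZero⇒≢0 (there _ nz) z = NonZero⇒≢0 nz (z ∘ suc)

  *-nonzero : ∀ {a b} → a ≢ 0ℤ → b ≢ 0ℤ → a ℤ.* b ≢ 0ℤ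
  *-nonzero {a} a≢0 b≢0 e with ℤ.i*j≡0⇒i≡0∨j≡0 a e
  ... | inj₁ z = a≢0 z
  ... | inj₂ z = b≢0 z

  conv-nonZero : ∀ {f g} → NonZero f → NonZero g → NonZero (conv f g)
  conv-nonZero (here a) (here b) = here (*-nonzero a b)
  conv-nonZero {f} {g} (here a) (there z b) = there
    (trans (cong (f 0 ℤ.*_) z) (ℤ.*-zeroʳ (f 0)))
    (NonZero-resp (λ i → sym (trans (conv-sucʳ f g i)
                    (trans (cong (λ u → conv f (g ∘ suc) i ℤ.+ f (suc i) ℤ.* u) z)
                    (trans (cong (λ z → conv f (g ∘ suc) i ℤ.+ z) (ℤ.*-zeroʳ (f (suc i)))) (ℤ.+-identityʳ _)))))
                  (conv-nonZero (here a) b))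
  conv-nonZero {f} {g} (there z a) b = there
    (cong (ℤ._* g 0) z)
    (NonZero-resp (λ i → sym (trans (cong (λ u → u ℤ.* g (suc i) ℤ.+ conv (f ∘ suc) g i) z)
                                    (ℤ.+-identityˡ _)))
                  (conv-nonZero a b))

  -- Once the leading zeros of f are stripped, f 0 ≠ 0 forces g 0 = 0; then f times the shifted g
  -- vanishes again, and so on through all coefficients.
  conv-cancel : ∀ {f} → NonZero f → ∀ g → (conv f g ≐ λ _ → 0ℤ) → g ≐ λ _ → 0ℤ
  conv-cancel {f} (here a) g e i = go i g e
    where
    head : ∀ g → (conv f g ≐ λ _ → 0ℤ) → g 0 ≡ 0ℤ
    head g e with ℤ.i*j≡0⇒i≡0∨j≡0 (f 0) (e 0)
    ... | inj₁ z = contradiction z a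
    ... | inj₂ z = z
    go : ∀ i g → (conv f g ≐ λ _ → 0ℤ) → g i ≡ 0ℤ
    go zero    g e = head g e
    go (suc i) g e = go i (g ∘ suc) λ j → begin
      conv f (g ∘ suc) j                              ≡⟨ ℤ.+-identityʳ _ ⟨
      conv f (g ∘ suc) j ℤ.+ 0ℤ                       ≡⟨ cong (λ z → conv f (g ∘ suc) j ℤ.+ z) (ℤ.*-zeroʳ (f (suc j))) ⟨
      conv f (g ∘ suc) j ℤ.+ f (suc j) ℤ.* 0ℤ         ≡⟨ cong (λ u → conv f (g ∘ suc) j ℤ.+ f (suc j) ℤ.* u) (head g e) ⟨
      conv f (g ∘ suc) j ℤ.+ f (suc j) ℤ.* g 0        ≡⟨ conv-sucʳ f g j ⟨
      conv f g (suc j)                                ≡⟨ e (suc j) ⟩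
      0ℤ                                              ∎
      where open ≡-Reasoning
  conv-cancel {f} (there z a) g e = conv-cancel a g λ i →
    trans (sym (trans (cong (λ u → u ℤ.* g (suc i) ℤ.+ conv (f ∘ suc) g i) z) (ℤ.+-identityˡ _))) (e (suc i))

  coeff-+ : ∀ p r i → coeff (p +P r) i ≡ coeff p i ℤ.+ coeff r i
  coeff-+ []      r       i       = sym (ℤ.+-identityˡ _)
  coeff-+ (a ∷ p) []      i       = sym (ℤ.+-identityʳ _)
  coeff-+ (a ∷ p) (b ∷ r) zero    = refl
  coeff-+ (a ∷ p) (b ∷ r) (suc i) = coeff-+ p r i

  coeff-neg : ∀ p i → coeff (negP p) i ≡ ℤ.- coeff p i
  coeff-neg []      i       = refl
  coeff-neg (a ∷ p) zero    = refl
  coeff-neg (a ∷ p) (suc i) = coeff-neg p i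

  coeff-scale : ∀ a p i → coeff (scaleP a p) i ≡ a ℤ.* coeff p i
  coeff-scale a []      i       = sym (ℤ.*-zeroʳ a)
  coeff-scale a (b ∷ p) zero    = refl
  coeff-scale a (b ∷ p) (suc i) = coeff-scale a p i

  coeff-* : ∀ p r → coeff (p *P r) ≐ conv (coeff p) (coeff r)
  coeff-* []      r i       = sym (conv-zeroˡ (coeff r) i)
  coeff-* (a ∷ p) r zero    = begin
    coeff (scaleP a r +P (0ℤ ∷ (p *P r))) 0    ≡⟨ coeff-+ (scaleP a r) _ 0 ⟩
    coeff (scaleP a r) 0 ℤ.+ 0ℤ                ≡⟨ ℤ.+-identityʳ _ ⟩
    coeff (scaleP a r) 0                       ≡⟨ coeff-scale a r 0 ⟩
    a ℤ.* coeff r 0                            ∎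
    where open ≡-Reasoning
  coeff-* (a ∷ p) r (suc i) = trans (coeff-+ (scaleP a r) _ (suc i))
    (cong₂ ℤ._+_ (coeff-scale a r (suc i)) (coeff-* p r i))

  -- A record, so that the two polynomials can be inferred from the type.
  infix 4 _≋_
  record _≋_ (p r : Poly) : Set where
    constructor mk≋
    field coeff-≡ : p ≈P r
  open _≋_ public

  polyRing : CommutativeRing 0ℓ 0ℓ
  polyRing = record
    { Carrier = Poly ; _≈_ = _≋_ ; _+_ = _+P_ ; _*_ = _*P_ ; -_ = negP ; 0# = [] ; 1# = oneP
    ; isCommutativeRing = record
      { isRing = record
        { +-isAbelianGroup = record
          { isGroup = record
            { isMonoid = record
              { isSemigroup = record
                { isMagma = record
                  { isEquivalence = record
                    { refl  = mk≋ λ _ → refl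
                    ; sym   = λ e → mk≋ λ i → sym (coeff-≡ e i)
                    ; trans = λ e e′ → mk≋ λ i → trans (coeff-≡ e i) (coeff-≡ e′ i)
                    }
                  ; ∙-cong = λ {p} {p′} {r} {r′} e e′ → mk≋ λ i →
                      trans (coeff-+ p r i) (trans (cong₂ ℤ._+_ (coeff-≡ e i) (coeff-≡ e′ i)) (sym (coeff-+ p′ r′ i)))
                  }
                ; assoc = λ p r s → mk≋ λ i → begin
                    coeff (p +P r +P s) i                         ≡⟨ coeff-+ (p +P r) s i ⟩
                    coeff (p +P r) i ℤ.+ coeff s i                ≡⟨ cong (ℤ._+ coeff s i) (coeff-+ p r i) ⟩
                    coeff p i ℤ.+ coeff r i ℤ.+ coeff s i         ≡⟨ ℤ.+-assoc (coeff p i) _ _ ⟩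
                    coeff p i ℤ.+ (coeff r i ℤ.+ coeff s i)       ≡⟨ cong (λ z → coeff p i ℤ.+ z) (coeff-+ r s i) ⟨
                    coeff p i ℤ.+ coeff (r +P s) i                ≡⟨ coeff-+ p (r +P s) i ⟨
                    coeff (p +P (r +P s)) i                       ∎
                }
              ; identity = (λ p → mk≋ λ _ → refl) , (λ p → mk≋ λ i → trans (coeff-+ p [] i) (ℤ.+-identityʳ _))
              }
            ; inverse = (λ p → mk≋ λ i → trans (coeff-+ (negP p) p i)
                          (trans (cong (ℤ._+ coeff p i) (coeff-neg p i)) (ℤ.+-inverseˡ (coeff p i))))
                      , (λ p → mk≋ λ i → trans (coeff-+ p (negP p) i)
                          (trans (cong (λ z → coeff p i ℤ.+ z) (coeff-neg p i)) (ℤ.+-inverseʳ (coeff p i))))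
            ; ⁻¹-cong = λ {p} {r} e → mk≋ λ i →
                trans (coeff-neg p i) (trans (cong ℤ.-_ (coeff-≡ e i)) (sym (coeff-neg r i)))
            }
          ; comm = λ p r → mk≋ λ i →
              trans (coeff-+ p r i) (trans (ℤ.+-comm (coeff p i) _) (sym (coeff-+ r p i)))
          }
        ; *-cong = λ {p} {p′} {r} {r′} e e′ → mk≋ λ i →
            trans (coeff-* p r i) (trans (conv-cong (coeff-≡ e) (coeff-≡ e′) i) (sym (coeff-* p′ r′ i)))
        ; *-assoc = λ p r s → mk≋ λ i → begin
            coeff (p *P r *P s) i                             ≡⟨ coeff-* (p *P r) s i ⟩
            conv (coeff (p *P r)) (coeff s) i                 ≡⟨ conv-cong (coeff-* p r) (λ _ → refl) i ⟩
            conv (conv (coeff p) (coeff r)) (coeff s) i       ≡⟨ conv-assoc (coeff p) (coeff r) (coeff s) i ⟩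
            conv (coeff p) (conv (coeff r) (coeff s)) i       ≡⟨ conv-cong (λ j → refl {x = coeff p j}) (coeff-* r s) i ⟨
            conv (coeff p) (coeff (r *P s)) i                 ≡⟨ coeff-* p (r *P s) i ⟨
            coeff (p *P (r *P s)) i                           ∎
        ; *-identity = one-* , λ p → mk≋ λ i → trans (*-comm′ p oneP i) (coeff-≡ (one-* p) i)
        ; distrib = (λ p r s → mk≋ λ i → begin
              coeff (p *P (r +P s)) i                  ≡⟨ *-comm′ p (r +P s) i ⟩
              coeff ((r +P s) *P p) i                  ≡⟨ distribʳ′ p r s i ⟩
              coeff (r *P p +P s *P p) i               ≡⟨ coeff-+ (r *P p) _ i ⟩
              coeff (r *P p) i ℤ.+ coeff (s *P p) i    ≡⟨ cong₂ ℤ._+_ (*-comm′ r p i) (*-comm′ s p i) ⟩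
              coeff (p *P r) i ℤ.+ coeff (p *P s) i    ≡⟨ coeff-+ (p *P r) _ i ⟨
              coeff (p *P r +P p *P s) i               ∎)
            , (λ p r s → mk≋ (distribʳ′ p r s))
        }
      ; *-comm = λ p r → mk≋ (*-comm′ p r)
      }
    }
    where
    open ≡-Reasoning
    *-comm′ : ∀ p r → p *P r ≈P r *P p
    *-comm′ p r i = trans (coeff-* p r i) (trans (conv-comm (coeff p) (coeff r) i) (sym (coeff-* r p i)))
    one-* : ∀ p → oneP *P p ≋ p
    one-* p = mk≋ λ i → begin
      coeff (scaleP 1ℤ p +P (0ℤ ∷ [])) i              ≡⟨ coeff-+ (scaleP 1ℤ p) _ i ⟩
      coeff (scaleP 1ℤ p) i ℤ.+ coeff (0ℤ ∷ []) i     ≡⟨ cong₂ ℤ._+_ (trans (coeff-scale 1ℤ p i) (ℤ.*-identityˡ _)) (zeros i) ⟩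
      coeff p i ℤ.+ 0ℤ                                ≡⟨ ℤ.+-identityʳ _ ⟩
      coeff p i                                       ∎
      where
      zeros : ∀ i → coeff (0ℤ ∷ []) i ≡ 0ℤ
      zeros zero    = refl
      zeros (suc i) = refl
    distribʳ′ : ∀ p r s → (r +P s) *P p ≈P r *P p +P s *P p
    distribʳ′ p r s i = begin
      coeff ((r +P s) *P p) i                                        ≡⟨ coeff-* (r +P s) p i ⟩
      conv (coeff (r +P s)) (coeff p) i                              ≡⟨ conv-cong (coeff-+ r s) (λ _ → refl) i ⟩
      conv (λ j → coeff r j ℤ.+ coeff s j) (coeff p) i               ≡⟨ conv-distribʳ (coeff r) (coeff s) (coeff p) i ⟩
      conv (coeff r) (coeff p) i ℤ.+ conv (coeff s) (coeff p) i      ≡⟨ cong₂ ℤ._+_ (coeff-* r p i) (coeff-* s p i) ⟨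
      coeff (r *P p) i ℤ.+ coeff (s *P p) i                          ≡⟨ coeff-+ (r *P p) _ i ⟨
      coeff (r *P p +P s *P p) i                                     ∎

  NonZeroP : Poly → Set
  NonZeroP p = NonZero (coeff p)

  nonZeroP-* : ∀ {p r} → NonZeroP p → NonZeroP r → NonZeroP (p *P r)
  nonZeroP-* {p} {r} nz nz′ = NonZero-resp (λ i → sym (coeff-* p r i)) (conv-nonZero nz nz′)

  nonZeroP-resp : ∀ {p r} → p ≋ r → NonZeroP p → NonZeroP r
  nonZeroP-resp e = NonZero-resp (coeff-≡ e)

  nonZeroP-cancel : ∀ {p} r → NonZeroP p → p *P r ≋ [] → r ≋ []
  nonZeroP-cancel {p} r nz e = mk≋ (conv-cancel nz (coeff r) λ i → trans (sym (coeff-* p r i)) (coeff-≡ e i))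

  nonZeroP⊎zero : ∀ p → NonZeroP p ⊎ p ≋ []
  nonZeroP⊎zero []      = inj₂ (mk≋ λ _ → refl)
  nonZeroP⊎zero (a ∷ p) with a ℤ.≟ 0ℤ | nonZeroP⊎zero p
  ... | no a≢0 | _       = inj₁ (here a≢0)
  ... | yes z  | inj₁ nz = inj₁ (there z nz)
  ... | yes z  | inj₂ e  = inj₂ (mk≋ λ { zero → z ; (suc i) → coeff-≡ e i })

  ¬nonZeroP-[] : ¬ NonZeroP []
  ¬nonZeroP-[] nz = NonZero⇒≢0 nz λ _ → refl

open Polynomials

-- Units and fractions

module Units {c ℓ} (R : CommutativeRing c ℓ) where
  open CommutativeRing R
  open IntegerSolver R
  open import Relation.Binary.Reasoning.Setoid setoid

  Unit : Carrier → Set _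
  Unit x = ∃ λ y → x * y ≈ 1#

  unit-1 : Unit 1#
  unit-1 = 1# , *-identityˡ 1#

  unit-* : ∀ {x y} → Unit x → Unit y → Unit (x * y)
  unit-* {x} {y} (u , xu) (v , yv) = u * v , (begin
    x * y * (u * v)    ≈⟨ solve 4 (λ x y u v → x :* y :* (u :* v) := x :* u :* (y :* v)) refl x y u v ⟩
    x * u * (y * v)    ≈⟨ *-cong xu yv ⟩
    1# * 1#            ≈⟨ *-identityˡ 1# ⟩
    1#                 ∎)

  unit-resp : ∀ {x y} → x ≈ y → Unit x → Unit y
  unit-resp e (u , xu) = u , trans (*-congʳ (sym e)) xu

  unit-factorˡ : ∀ {x y} → Unit (x * y) → Unit x
  unit-factorˡ {x} {y} (u , e) = y * u , trans (sym (*-assoc x y u)) e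

  unit-factorʳ : ∀ {x y} → Unit (x * y) → Unit y
  unit-factorʳ {x} {y} u = unit-factorˡ (unit-resp (*-comm x y) u)

  unit-cancel : ∀ {c x y} → Unit c → c * x ≈ c * y → x ≈ y
  unit-cancel {c} {x} {y} (u , cu) e = begin
    x              ≈⟨ *-identityˡ x ⟨
    1# * x         ≈⟨ *-congʳ cu ⟨
    c * u * x      ≈⟨ solve 3 (λ c u x → c :* u :* x := u :* (c :* x)) refl c u x ⟩
    u * (c * x)    ≈⟨ *-congˡ e ⟩
    u * (c * y)    ≈⟨ solve 3 (λ c u x → c :* u :* x := u :* (c :* x)) refl c u y ⟨
    c * u * y      ≈⟨ *-congʳ cu ⟩
    1# * y         ≈⟨ *-identityˡ y ⟩
    y              ∎

  unit-cancel-0 : ∀ {c x} → Unit c → c * x ≈ 0# → x ≈ 0#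
  unit-cancel-0 u e = unit-cancel u (trans e (sym (zeroʳ _)))

record NonZeroDivisors (R : CommutativeRing 0ℓ 0ℓ) : Set₁ where
  open CommutativeRing R
  field
    NZ        : Carrier → Set
    nz-1      : NZ 1#
    nz-*      : ∀ {x y} → NZ x → NZ y → NZ (x * y)
    nz-resp   : ∀ {x y} → x ≈ y → NZ x → NZ y
    nz-cancel : ∀ {x} y → NZ x → x * y ≈ 0# → y ≈ 0#
    nz⊎0      : ∀ x → NZ x ⊎ x ≈ 0#
    ¬nz-0     : ¬ NZ 0#

module Fractions (R : CommutativeRing 0ℓ 0ℓ) (nonZeroDivisors : NonZeroDivisors R) where
  open CommutativeRing R
  open NonZeroDivisors nonZeroDivisors
  open IntegerSolver R
  open import Algebra.Properties.Group +-group using (x∙y⁻¹≈ε⇒x≈y; x≈y⇒x∙y⁻¹≈ε)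

  record Frac : Set where
    constructor _/_[_]
    field
      num den : Carrier
      den-nz  : NZ den
  open Frac public

  infix 4 _≃_
  record _≃_ (x y : Frac) : Set where
    constructor mk≃
    field cross : num x * den y ≈ num y * den x
  open _≃_ public

  private
    cancel : ∀ {c x y} → NZ c → c * x ≈ c * y → x ≈ y
    cancel {c} {x} {y} nz e = x∙y⁻¹≈ε⇒x≈y x y (nz-cancel _ nz (trans
      (solve 3 (λ c x y → c :* (x :- y) := c :* x :- c :* y) refl c x y)
      (x≈y⇒x∙y⁻¹≈ε e)))

  infixl 6 _⊕_
  infixl 7 _⊗_
  _⊕_ _⊗_ : Frac → Frac → Frac
  (a / b [ p ]) ⊕ (c / d [ r ]) = (a * d + c * b) / b * d [ nz-* p r ]
  (a / b [ p ]) ⊗ (c / d [ r ]) = (a * c) / b * d [ nz-* p r ]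

  ⊖_ : Frac → Frac
  ⊖ (a / b [ p ]) = (- a) / b [ p ]

  ι : Carrier → Frac
  ι a = a / 1# [ nz-1 ]

  ≃-trans : ∀ {x y z} → x ≃ y → y ≃ z → x ≃ z
  ≃-trans {a / b [ _ ]} {c / d [ nz ]} {e / f [ _ ]} (mk≃ p) (mk≃ r) = mk≃ (cancel nz (begin
    d * (a * f)    ≈⟨ solve 3 (λ d a f → d :* (a :* f) := f :* (a :* d)) refl d a f ⟩
    f * (a * d)    ≈⟨ *-congˡ p ⟩
    f * (c * b)    ≈⟨ solve 3 (λ f c b → f :* (c :* b) := b :* (c :* f)) refl f c b ⟩
    b * (c * f)    ≈⟨ *-congˡ r ⟩
    b * (e * d)    ≈⟨ solve 3 (λ b e d → b :* (e :* d) := d :* (e :* b)) refl b e d ⟩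
    d * (e * b)    ∎))
    where open import Relation.Binary.Reasoning.Setoid setoid

  ⊕-cong : ∀ {x x′ y y′} → x ≃ x′ → y ≃ y′ → x ⊕ y ≃ x′ ⊕ y′
  ⊕-cong {a / b [ _ ]} {a′ / b′ [ _ ]} {c / d [ _ ]} {c′ / d′ [ _ ]} (mk≃ p) (mk≃ r) = mk≃ (begin
    (a * d + c * b) * (b′ * d′)
      ≈⟨ solve 6 (λ a b c d b′ d′ → (a :* d :+ c :* b) :* (b′ :* d′) := a :* b′ :* (d :* d′) :+ c :* d′ :* (b :* b′)) refl a b c d b′ d′ ⟩
    a * b′ * (d * d′) + c * d′ * (b * b′)
      ≈⟨ +-cong (*-congʳ p) (*-congʳ r) ⟩
    a′ * b * (d * d′) + c′ * d * (b * b′)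
      ≈⟨ solve 6 (λ a′ b c′ d b′ d′ → a′ :* b :* (d :* d′) :+ c′ :* d :* (b :* b′) := (a′ :* d′ :+ c′ :* b′) :* (b :* d)) refl a′ b c′ d b′ d′ ⟩
    (a′ * d′ + c′ * b′) * (b * d) ∎)
    where open import Relation.Binary.Reasoning.Setoid setoid

  ⊗-cong : ∀ {x x′ y y′} → x ≃ x′ → y ≃ y′ → x ⊗ y ≃ x′ ⊗ y′
  ⊗-cong {a / b [ _ ]} {a′ / b′ [ _ ]} {c / d [ _ ]} {c′ / d′ [ _ ]} (mk≃ p) (mk≃ r) = mk≃ (begin
    a * c * (b′ * d′)      ≈⟨ solve 4 (λ a c b′ d′ → a :* c :* (b′ :* d′) := a :* b′ :* (c :* d′)) refl a c b′ d′ ⟩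
    a * b′ * (c * d′)      ≈⟨ *-cong p r ⟩
    a′ * b * (c′ * d)      ≈⟨ solve 4 (λ a′ b c′ d → a′ :* b :* (c′ :* d) := a′ :* c′ :* (b :* d)) refl a′ b c′ d ⟩
    a′ * c′ * (b * d)      ∎)
    where open import Relation.Binary.Reasoning.Setoid setoid

  ⊖-cong : ∀ {x y} → x ≃ y → ⊖ x ≃ ⊖ y
  ⊖-cong {a / b [ _ ]} {c / d [ _ ]} (mk≃ p) = mk≃ (begin
    - a * d      ≈⟨ solve 2 (λ a d → (:- a) :* d := :- (a :* d)) refl a d ⟩
    - (a * d)    ≈⟨ -‿cong p ⟩
    - (c * b)    ≈⟨ solve 2 (λ a d → (:- a) :* d := :- (a :* d)) refl c b ⟨
    - c * b      ∎)
    where open import Relation.Binary.Reasoning.Setoid setoid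

  private
    O I : ∀ {n} → Polynomial n
    O = con (+ 0)
    I = con (+ 1)

  fractionRing : CommutativeRing 0ℓ 0ℓ
  fractionRing = record
    { Carrier = Frac ; _≈_ = _≃_ ; _+_ = _⊕_ ; _*_ = _⊗_ ; -_ = ⊖_ ; 0# = ι 0# ; 1# = ι 1#
    ; isCommutativeRing = record
      { isRing = record
        { +-isAbelianGroup = record
          { isGroup = record
            { isMonoid = record
              { isSemigroup = record
                { isMagma = record
                  { isEquivalence = record
                    { refl = mk≃ refl ; sym = λ (mk≃ e) → mk≃ (sym e) ; trans = ≃-trans }
                  ; ∙-cong = ⊕-cong
                  }
                ; assoc = λ (a / b [ _ ]) (c / d [ _ ]) (e / f [ _ ]) → mk≃ (solve 6 (λ a b c d e f →
                    ((a :* d :+ c :* b) :* f :+ e :* (b :* d)) :* (b :* (d :* f))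
                    := (a :* (d :* f) :+ (c :* f :+ e :* d) :* b) :* (b :* d :* f)) refl a b c d e f)
                }
              ; identity = (λ (a / b [ _ ]) → mk≃ (solve 2 (λ a b →
                    (O :* b :+ a :* I) :* b := a :* (I :* b)) refl a b))
                         , (λ (a / b [ _ ]) → mk≃ (solve 2 (λ a b →
                    (a :* I :+ O :* b) :* b := a :* (b :* I)) refl a b))
              }
            ; inverse = (λ (a / b [ _ ]) → mk≃ (solve 2 (λ a b →
                    ((:- a) :* b :+ a :* b) :* I := O :* (b :* b)) refl a b))
                      , (λ (a / b [ _ ]) → mk≃ (solve 2 (λ a b →
                    (a :* b :+ (:- a) :* b) :* I := O :* (b :* b)) refl a b))
            ; ⁻¹-cong = ⊖-cong
            }
          ; comm = λ (a / b [ _ ]) (c / d [ _ ]) → mk≃ (solve 4 (λ a b c d →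
              (a :* d :+ c :* b) :* (d :* b) := (c :* b :+ a :* d) :* (b :* d)) refl a b c d)
          }
        ; *-cong = ⊗-cong
        ; *-assoc = λ (a / b [ _ ]) (c / d [ _ ]) (e / f [ _ ]) → mk≃ (solve 6 (λ a b c d e f →
            a :* c :* e :* (b :* (d :* f)) := a :* (c :* e) :* (b :* d :* f)) refl a b c d e f)
        ; *-identity = (λ (a / b [ _ ]) → mk≃ (solve 2 (λ a b →
              I :* a :* b := a :* (I :* b)) refl a b))
                     , (λ (a / b [ _ ]) → mk≃ (solve 2 (λ a b →
              a :* I :* b := a :* (b :* I)) refl a b))
        ; distrib = (λ (a / b [ _ ]) (c / d [ _ ]) (e / f [ _ ]) → mk≃ (solve 6 (λ a b c d e f →
              a :* (c :* f :+ e :* d) :* (b :* d :* (b :* f))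
              := (a :* c :* (b :* f) :+ a :* e :* (b :* d)) :* (b :* (d :* f))) refl a b c d e f))
                  , (λ (a / b [ _ ]) (c / d [ _ ]) (e / f [ _ ]) → mk≃ (solve 6 (λ a b c d e f →
              (c :* f :+ e :* d) :* a :* (d :* b :* (f :* b))
              := (c :* a :* (f :* b) :+ e :* a :* (d :* b)) :* (d :* f :* b)) refl a b c d e f))
        }
      ; *-comm = λ (a / b [ _ ]) (c / d [ _ ]) → mk≃ (solve 4 (λ a b c d →
          a :* c :* (d :* b) := c :* a :* (b :* d)) refl a b c d)
      }
    }

  private module F = CommutativeRing fractionRing
  open Units fractionRing

  ι-cong : ∀ {x y} → x ≈ y → ι x F.≈ ι y
  ι-cong e = mk≃ (*-congʳ e)

  ι-injective : ∀ {x y} → ι x F.≈ ι y → x ≈ y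
  ι-injective (mk≃ e) = trans (sym (*-identityʳ _)) (trans e (*-identityʳ _))

  ι-+ : ∀ x y → ι (x + y) F.≈ ι x F.+ ι y
  ι-+ x y = mk≃ (solve 2 (λ x y → (x :+ y) :* (I :* I) := (x :* I :+ y :* I) :* I) refl x y)

  ι-* : ∀ x y → ι (x * y) F.≈ ι x F.* ι y
  ι-* x y = mk≃ (solve 2 (λ x y → (x :* y) :* (I :* I) := (x :* y) :* I) refl x y)

  ι-neg : ∀ x → ι (- x) F.≈ F.- ι x
  ι-neg x = mk≃ refl

  ι-unit : ∀ {x} → NZ x → Unit (ι x)
  ι-unit {x} nz = (1# / x [ nz ]) , mk≃ (solve 1 (λ x → x :* I :* I := I :* (I :* x)) refl x)

  recip : Frac → Frac
  recip (a / b [ _ ]) with nz⊎0 a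
  ... | inj₁ nz = b / a [ nz ]
  -- A default value, which makes `recip` total; `recip-inverse` speaks of units only, and there the
  -- numerator is nonzero.
  ... | inj₂ _  = ι 0#

  recip-inverse : ∀ {x} → Unit x → x F.* recip x F.≈ F.1#
  recip-inverse {a / b [ nz-b ]} ((c / d [ nz-d ]) , mk≃ e) with nz⊎0 a
  ... | inj₁ nz = mk≃ (solve 2 (λ a b → a :* b :* I := I :* (b :* a)) refl a b)
  ... | inj₂ z  = contradiction (nz-resp bd≈0 (nz-* nz-b nz-d)) ¬nz-0
    where
    open import Relation.Binary.Reasoning.Setoid setoid
    bd≈0 : b * d ≈ 0#
    bd≈0 = begin
      b * d           ≈⟨ *-identityˡ _ ⟨
      1# * (b * d)    ≈⟨ e ⟨
      a * c * 1#      ≈⟨ *-congʳ (*-congʳ z) ⟩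
      0# * c * 1#     ≈⟨ solve 1 (λ c → O :* c :* I := O) refl c ⟩
      0#              ∎

-- The series are developed over any commutative ring with a total operation that inverts the units;
-- ℚ(q) is substituted at the very end.
record Reciprocal {c ℓ} (F : CommutativeRing c ℓ) : Set (c ⊔ ℓ) where
  open CommutativeRing F
  open Units F
  field
    recip         : Carrier → Carrier
    recip-inverse : ∀ {x} → Unit x → x * recip x ≈ 1#

-- Finite sums and products, hypergeometric terms

module Products {c ℓ} (F : CommutativeRing c ℓ) where
  open CommutativeRing F
  open Units F
  open IntegerSolver F
  open import Relation.Binary.Reasoning.Setoid setoid

  private
    I O : ∀ {n} → Polynomial n
    I = con (+ 1)
    O = con (+ 0)

  Σ Π : ℕ → (ℕ → Carrier) → Carrier
  Σ zero    f = 0#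
  Σ (suc n) f = Σ n f + f n
  Π zero    f = 1#
  Π (suc n) f = Π n f * f n

  Σ-cong : ∀ n {f g} → (∀ k → k < n → f k ≈ g k) → Σ n f ≈ Σ n g
  Σ-cong zero    e = refl
  Σ-cong (suc n) e = +-cong (Σ-cong n λ k k<n → e k (ℕ.m<n⇒m<1+n k<n)) (e n ℕ.≤-refl)

  Π-cong : ∀ n {f g} → (∀ k → k < n → f k ≈ g k) → Π n f ≈ Π n g
  Π-cong zero    e = refl
  Π-cong (suc n) e = *-cong (Π-cong n λ k k<n → e k (ℕ.m<n⇒m<1+n k<n)) (e n ℕ.≤-refl)

  Σ-*ˡ : ∀ n a f → Σ n (λ k → a * f k) ≈ a * Σ n f
  Σ-*ˡ zero    a f = sym (zeroʳ a)
  Σ-*ˡ (suc n) a f = trans (+-congʳ (Σ-*ˡ n a f)) (sym (distribˡ a _ _))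

  Σ-linear : ∀ n a b f g → Σ n (λ k → a * f k - b * g k) ≈ a * Σ n f - b * Σ n g
  Σ-linear zero    a b f g = (solve 2 (λ a b → O := a :* O :- b :* O) refl a b)
  Σ-linear (suc n) a b f g = trans (+-congʳ (Σ-linear n a b f g))
    (solve 6 (λ a b s t u v → a :* s :- b :* t :+ (a :* u :- b :* v) := a :* (s :+ u) :- b :* (t :+ v)) refl
       a b (Σ n f) (Σ n g) (f n) (g n))

  Σ-+ : ∀ m n f → Σ (m ℕ.+ n) f ≈ Σ m f + Σ n (λ k → f (m ℕ.+ k))
  Σ-+ m zero    f = trans (reflexive (≡.cong (λ k → Σ k f) (ℕ.+-identityʳ m))) (sym (+-identityʳ _))
  Σ-+ m (suc n) f = trans (reflexive (≡.cong (λ k → Σ k f) (ℕ.+-suc m n)))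
    (trans (+-congʳ (Σ-+ m n f)) (+-assoc _ _ _))

  Π-* : ∀ n f g → Π n (λ k → f k * g k) ≈ Π n f * Π n g
  Π-* zero    f g = sym (*-identityˡ 1#)
  Π-* (suc n) f g = trans (*-congʳ (Π-* n f g))
    (solve 4 (λ s t u v → s :* t :* (u :* v) := s :* u :* (t :* v)) refl (Π n f) (Π n g) (f n) (g n))

  Π-unit : ∀ n {f} → (∀ k → k < n → Unit (f k)) → Unit (Π n f)
  Π-unit zero    u = unit-1
  Π-unit (suc n) u = unit-* (Π-unit n λ k k<n → u k (ℕ.m<n⇒m<1+n k<n)) (u n ℕ.≤-refl)

module Hypergeometric {c ℓ} (F : CommutativeRing c ℓ) (reciprocal : Reciprocal F) where
  open CommutativeRing F
  open Reciprocal reciprocal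
  open Units F
  open Products F
  open IntegerSolver F
  open import Relation.Binary.Reasoning.Setoid setoid
  open import Algebra.Properties.Semiring.Exp semiring using (_^_; ^-homo-*)
  open import Algebra.Properties.Group +-group using (x∙y⁻¹≈ε⇒x≈y)

  private
    I O : ∀ {n} → Polynomial n
    I = con (+ 1)
    O = con (+ 0)

  -- A hypergeometric term is given by its ratio `N k / D k`. Comparing and telescoping terms uses
  -- nothing else, and a zero of `N` terminates the series.
  hyper : (N D : ℕ → Carrier) → ℕ → Carrier
  hyper N D zero    = 1#
  hyper N D (suc k) = hyper N D k * (N k * recip (D k))

  hyper-suc : ∀ {N D} k → Unit (D k) → hyper N D (suc k) * D k ≈ hyper N D k * N k
  hyper-suc {N} {D} k u = begin
    h * (N k * r) * D k      ≈⟨ solve 4 (λ h n r d → h :* (n :* r) :* d := h :* n :* (d :* r)) refl h (N k) r (D k) ⟩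
    h * N k * (D k * r)      ≈⟨ *-congˡ (recip-inverse u) ⟩
    h * N k * 1#             ≈⟨ *-identityʳ _ ⟩
    h * N k                  ∎
    where
    h = hyper N D k
    r = recip (D k)

  hyper-vanish : ∀ {N D} j → N j ≈ 0# → ∀ k → j < k → hyper N D k ≈ 0#
  hyper-vanish {N} {D} j z (suc k) (s≤s j≤k) with ℕ.m≤n⇒m<n∨m≡n j≤k
  ... | inj₁ j<k    = trans (*-congʳ (hyper-vanish j z k j<k)) (zeroˡ _)
  ... | inj₂ ≡.refl = trans (*-congˡ (trans (*-congʳ z) (zeroˡ _))) (zeroʳ _)

  -- Both weighted terms have the same ratio `h k / (D k * D′ k)`. The ratios of the weights σ and τ
  -- are written without division, because the weights may vanish.
  hyper-transfer : ∀ {N D N′ D′} (σ τ h : ℕ → Carrier) → (∀ k → Unit (D k)) → (∀ k → Unit (D′ k)) →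
    σ 0 ≈ τ 0 →
    (∀ k → N k * D′ k * σ (suc k) ≈ σ k * h k) → (∀ k → N′ k * D k * τ (suc k) ≈ τ k * h k) →
    ∀ k → hyper N D k * σ k ≈ hyper N′ D′ k * τ k
  hyper-transfer σ τ h u u′ e₀ eσ eτ zero    = *-congˡ e₀
  hyper-transfer {N} {D} {N′} {D′} σ τ h u u′ e₀ eσ eτ (suc k) = unit-cancel (unit-* (u k) (u′ k)) (begin
    D k * D′ k * (κ₁ * σ (suc k))
      ≈⟨ solve 4 (λ d d′ κ s → d :* d′ :* (κ :* s) := κ :* d :* d′ :* s) refl (D k) (D′ k) κ₁ (σ (suc k)) ⟩
    κ₁ * D k * D′ k * σ (suc k)
      ≈⟨ *-congʳ (*-congʳ (hyper-suc k (u k))) ⟩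
    κ * N k * D′ k * σ (suc k)
      ≈⟨ solve 4 (λ κ n d s → κ :* n :* d :* s := κ :* (n :* d :* s)) refl κ (N k) (D′ k) (σ (suc k)) ⟩
    κ * (N k * D′ k * σ (suc k))
      ≈⟨ *-congˡ (eσ k) ⟩
    κ * (σ k * h k)
      ≈⟨ *-assoc _ _ _ ⟨
    κ * σ k * h k
      ≈⟨ *-congʳ (hyper-transfer σ τ h u u′ e₀ eσ eτ k) ⟩
    κ′ * τ k * h k
      ≈⟨ *-assoc _ _ _ ⟩
    κ′ * (τ k * h k)
      ≈⟨ *-congˡ (eτ k) ⟨
    κ′ * (N′ k * D k * τ (suc k))
      ≈⟨ solve 4 (λ κ n d s → κ :* (n :* d :* s) := κ :* n :* d :* s) refl κ′ (N′ k) (D k) (τ (suc k)) ⟩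
    κ′ * N′ k * D k * τ (suc k)
      ≈⟨ *-congʳ (*-congʳ (hyper-suc k (u′ k))) ⟨
    κ′₁ * D′ k * D k * τ (suc k)
      ≈⟨ solve 4 (λ d d′ κ s → κ :* d′ :* d :* s := d :* d′ :* (κ :* s)) refl (D k) (D′ k) κ′₁ (τ (suc k)) ⟩
    D k * D′ k * (κ′₁ * τ (suc k)) ∎)
    where
    κ  = hyper N D k
    κ₁ = hyper N D (suc k)
    κ′ = hyper N′ D′ k
    κ′₁ = hyper N′ D′ (suc k)

  -- Telescoping with certificate Γ / w.
  hyper-telescope : ∀ {N D} (w s U Γ : ℕ → Carrier) → (∀ k → Unit (D k)) → (∀ k → Unit (w k)) →
    (∀ k → w k * s k ≈ hyper N D k * U k) →
    (∀ k → w (suc k) * U k * D k ≈ N k * Γ (suc k) * w k - Γ k * w (suc k) * D k) →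
    Γ 0 ≈ 0# → ∀ K → w K * Σ K s ≈ hyper N D K * Γ K
  hyper-telescope w s U Γ u v eS eU e₀ zero    = trans (zeroʳ _) (trans (sym e₀) (sym (*-identityˡ _)))
  hyper-telescope {N} {D} w s U Γ u v eS eU e₀ (suc k) = unit-cancel (unit-* (v k) (u k)) (begin
    w k * D k * (w₁ * (Σ k s + s k))
      ≈⟨ solve 5 (λ w d w₁ S s → w :* d :* (w₁ :* (S :+ s)) := w₁ :* d :* (w :* S) :+ w₁ :* d :* (w :* s)) refl (w k) (D k) w₁ (Σ k s) (s k) ⟩
    w₁ * D k * (w k * Σ k s) + w₁ * D k * (w k * s k)
      ≈⟨ +-cong (*-congˡ (hyper-telescope w s U Γ u v eS eU e₀ k)) (*-congˡ (eS k)) ⟩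
    w₁ * D k * (κ * Γ k) + w₁ * D k * (κ * U k)
      ≈⟨ solve 5 (λ w₁ d κ g u → w₁ :* d :* (κ :* g) :+ w₁ :* d :* (κ :* u) := κ :* (g :* w₁ :* d :+ w₁ :* u :* d)) refl w₁ (D k) κ (Γ k) (U k) ⟩
    κ * (Γ k * w₁ * D k + w₁ * U k * D k)
      ≈⟨ *-congˡ (+-congˡ (eU k)) ⟩
    κ * (Γ k * w₁ * D k + (N k * Γ (suc k) * w k - Γ k * w₁ * D k))
      ≈⟨ solve 5 (λ a κ n g w → κ :* (a :+ (n :* g :* w :- a)) := w :* (κ :* n) :* g) refl (Γ k * w₁ * D k) κ (N k) (Γ (suc k)) (w k) ⟩
    w k * (κ * N k) * Γ (suc k)
      ≈⟨ *-congʳ (*-congˡ (hyper-suc k (u k))) ⟨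
    w k * (κ₁ * D k) * Γ (suc k)
      ≈⟨ solve 4 (λ w κ d g → w :* (κ :* d) :* g := w :* d :* (κ :* g)) refl (w k) κ₁ (D k) (Γ (suc k)) ⟩
    w k * D k * (κ₁ * Γ (suc k)) ∎)
    where
    κ  = hyper N D k
    κ₁ = hyper N D (suc k)
    w₁ = w (suc k)

  hyper-+ : ∀ N D m k → hyper N D (m ℕ.+ k) ≈ hyper N D m * hyper (λ j → N (m ℕ.+ j)) (λ j → D (m ℕ.+ j)) k
  hyper-+ N D m zero    = trans (reflexive (≡.cong (hyper N D) (ℕ.+-identityʳ m))) (sym (*-identityʳ _))
  hyper-+ N D m (suc k) = trans (reflexive (≡.cong (hyper N D) (ℕ.+-suc m k)))
    (trans (*-congʳ (hyper-+ N D m k)) (*-assoc _ _ _))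

  hyper-Π : ∀ {N D} k → (∀ j → j < k → Unit (D j)) → hyper N D k * Π k D ≈ Π k N
  hyper-Π zero    u = *-identityˡ 1#
  hyper-Π {N} {D} (suc k) u = begin
    hyper N D (suc k) * (Π k D * D k)    ≈⟨ solve 3 (λ h π d → h :* (π :* d) := h :* d :* π) refl _ _ (D k) ⟩
    hyper N D (suc k) * D k * Π k D      ≈⟨ *-congʳ (hyper-suc k (u k ℕ.≤-refl)) ⟩
    hyper N D k * N k * Π k D            ≈⟨ solve 3 (λ h n π → h :* n :* π := h :* π :* n) refl _ (N k) _ ⟩
    hyper N D k * Π k D * N k            ≈⟨ *-congʳ (hyper-Π k λ j j<k → u j (ℕ.m<n⇒m<1+n j<k)) ⟩
    Π k N * N k                          ∎

  -- Rahman's quadratic series and its contiguous relations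

  module Base (p : Carrier) (unit-p : Unit p) where

    unit-^ : ∀ k → Unit (p ^ k)
    unit-^ zero    = unit-1
    unit-^ (suc k) = unit-* unit-p (unit-^ k)

    -- With b b′ = p and σ = b + b′ these are (1 − b x)(1 − b′ x) and (1 − a b p x²)(1 − a b′ p x²).
    quad : Carrier → Carrier → Carrier
    quad σ x = 1# - σ * x + p * (x * x)

    quad² : Carrier → Carrier → Carrier → Carrier
    quad² a σ x = 1# - a * σ * p * (x * x) + a * a * (p * p * p) * (x * x * (x * x))

    cube : Carrier → Carrier → Carrier
    cube a x = 1# - a * (x * x * x)

    -- κ k is the k-th term, without its factor 1 − a p³ᵏ, of Rahman's quadratic series with parameters a, b, p / b
    -- and d = 1 / δ, in the confluent case f → ∞.
    N D : (a σ δ : Carrier) → Carrier → Carrier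
    N a σ δ x = (1# - a * x) * quad σ x * (p * a * x) * (δ - x * x)
    D a σ δ x = (1# - p * p * (x * x)) * quad² a σ x * (1# - a * δ * p * x)

    κ : (a σ δ : Carrier) → ℕ → Carrier
    κ a σ δ = hyper (λ k → N a σ δ (p ^ k)) (λ k → D a σ δ (p ^ k))

    S : (a σ δ : Carrier) → ℕ → Carrier
    S a σ δ K = Σ K (λ k → cube a (p ^ k) * κ a σ δ k)

    S-vanish : ∀ {a σ δ} m → N a σ δ (p ^ m) ≈ 0# → ∀ {K} → m < K → S a σ δ K ≈ S a σ δ (suc m)
    S-vanish {a} {σ} {δ} m z {suc K} (s≤s m≤K) with ℕ.m≤n⇒m<n∨m≡n m≤K
    ... | inj₂ ≡.refl = refl
    ... | inj₁ m<K    = trans (+-cong (S-vanish m z m<K) (trans (*-congˡ (hyper-vanish m z K m<K)) (zeroʳ _))) (+-identityʳ _)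

    -- A contiguous relation between the series with δ = H and with δ = p² H, with Γ / x² as certificate.
    module StepD (a σ H : Carrier) where
      E C₀ : Carrier
      E = p * p * H
      C₀ = (E - 1#) * (1# - a * (p * H)) * (1# - a * E)

      -- Equal to (1 - a b p H)(1 - a b′ p H) when b b′ = p and b + b′ = σ.
      X : Carrier
      X = 1# - a * σ * (p * H) + a * a * p * (p * H * (p * H))

      τ U Γ : Carrier → Carrier
      τ x = (E - x * x) * (1# - a * (p * H) * x) * (1# - a * E * x)
      U x = (E - 1#) * X * cube a x * (x * x) - cube a x * τ x
      Γ x = (1# - x * x) * (p * p - a * σ * p * (x * x) + a * a * p * (x * x * (x * x))) * (1# - a * E * x) * H

      -- `Γ (p * x)` is p² H times the denominator `D a σ E x`. In the telescoping condition this
      -- denominator therefore cancels, and an identity of polynomials in five independent variables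
      -- is left.
      certificate : ∀ x → U x ≈ H * ((1# - a * x) * quad σ x * (p * a * x)) * (E - x * x) - Γ x
      certificate x = (solve 5 (λ a σ H p x → (p :* p :* H :- I) :* (I :- a :* σ :* (p :* H) :+ a :* a :* p :* (p :* H :* (p :* H))) :* (I :- a :* (x :* x :* x)) :* (x :* x) :- (I :- a :* (x :* x :* x)) :* ((p :* p :* H :- x :* x) :* (I :- a :* (p :* H) :* x) :* (I :- a :* (p :* p :* H) :* x)) := H :* ((I :- a :* x) :* (I :- σ :* x :+ p :* (x :* x)) :* (p :* a :* x)) :* (p :* p :* H :- x :* x) :- (I :- x :* x) :* (p :* p :- a :* σ :* p :* (x :* x) :+ a :* a :* p :* (x :* x :* (x :* x))) :* (I :- a :* (p :* p :* H) :* x) :* H) refl a σ H p x)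

      module _ (unit-D : ∀ k → Unit (D a σ H (p ^ k))) (unit-D′ : ∀ k → Unit (D a σ E (p ^ k))) where

        -- Replacing H by p² H changes only the factors that contain δ. Their quotient telescopes
        -- over the indices below k to `τ x / (x * x * C₀)` with x = p^k, and `C₀` is τ at x = 1.
        transfer : ∀ k → κ a σ H k * (p ^ k * p ^ k * C₀) ≈ κ a σ E k * τ (p ^ k)
        transfer = hyper-transfer (λ k → p ^ k * p ^ k * C₀) (λ k → τ (p ^ k)) (λ k → let x = p ^ k in
            (1# - a * x) * quad σ x * (p * a * x) * ((1# - p * p * (x * x)) * quad² a σ x) * (p * p * (H - x * x)) * (1# - a * E * p * x))
          unit-D unit-D′ (solve 3 (λ a p H → I :* I :* ((p :* p :* H :- I) :* (I :- a :* (p :* H)) :* (I :- a :* (p :* p :* H))) := (p :* p :* H :- I :* I) :* (I :- a :* (p :* H) :* I) :* (I :- a :* (p :* p :* H) :* I)) refl a p H)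
          (λ k → let x = p ^ k ; n = (1# - a * x) * quad σ x * (p * a * x) ; d = (1# - p * p * (x * x)) * quad² a σ x in
            (solve 7 (λ n d a H p x C₀ → n :* (H :- x :* x) :* (d :* (I :- a :* (p :* p :* H) :* p :* x)) :* (p :* x :* (p :* x) :* C₀) := x :* x :* C₀ :* (n :* d :* (p :* p :* (H :- x :* x)) :* (I :- a :* (p :* p :* H) :* p :* x))) refl n d a H p x C₀))
          (λ k → let x = p ^ k ; n = (1# - a * x) * quad σ x * (p * a * x) ; d = (1# - p * p * (x * x)) * quad² a σ x in
            (solve 6 (λ n d a H p x → n :* (p :* p :* H :- x :* x) :* (d :* (I :- a :* H :* p :* x)) :* ((p :* p :* H :- p :* x :* (p :* x)) :* (I :- a :* (p :* H) :* (p :* x)) :* (I :- a :* (p :* p :* H) :* (p :* x))) := (p :* p :* H :- x :* x) :* (I :- a :* (p :* H) :* x) :* (I :- a :* (p :* p :* H) :* x) :* (n :* d :* (p :* p :* (H :- x :* x)) :* (I :- a :* (p :* p :* H) :* p :* x))) refl n d a H p x))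

        shift : ∀ x → p * x * (p * x) * U x * D a σ E x ≈ N a σ E x * Γ (p * x) * (x * x) - Γ x * (p * x * (p * x)) * D a σ E x
        shift x = trans (*-congʳ (*-congˡ (certificate x))) (let n = (1# - a * x) * quad σ x * (p * a * x) in
          solve 7 (λ a σ H p x n g → let E = p :* p :* H ; d = (I :- p :* p :* (x :* x)) :* (I :- a :* σ :* p :* (x :* x) :+ a :* a :* (p :* p :* p) :* (x :* x :* (x :* x))) :* (I :- a :* E :* p :* x) in
             p :* x :* (p :* x) :* (H :* n :* (E :- x :* x) :- g) :* d
             := n :* (E :- x :* x) :* ((I :- p :* x :* (p :* x)) :* (p :* p :- a :* σ :* p :* (p :* x :* (p :* x)) :+ a :* a :* p :* (p :* x :* (p :* x) :* (p :* x :* (p :* x)))) :* (I :- a :* E :* (p :* x)) :* H) :* (x :* x)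
                :- g :* (p :* x :* (p :* x)) :* d) refl a σ H p x n (Γ x))

        -- The combination of the two sums telescopes to a multiple of the term of index K, which is
        -- zero because K lies beyond the zero of the numerator.
        step : ∀ {K m} → N a σ E (p ^ m) ≈ 0# → m < K →
               (E - 1#) * X * S a σ E K ≈ C₀ * S a σ H K
        step {K} {m} z m<K = x∙y⁻¹≈ε⇒x≈y _ _ (trans (sym (Σ-linear K _ _ _ _))
          (unit-cancel-0 (unit-* (unit-^ K) (unit-^ K)) (trans
            (hyper-telescope (λ k → p ^ k * p ^ k) _ (λ k → U (p ^ k)) (λ k → Γ (p ^ k)) unit-D′
              (λ k → unit-* (unit-^ k) (unit-^ k))
              (λ k → let x = p ^ k ; c = cube a x in begin
                x * x * ((E - 1#) * X * (c * κ a σ E k) - C₀ * (c * κ a σ H k))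
                  ≈⟨ solve 6 (λ x A c e C₀ h → x :* x :* (A :* (c :* e) :- C₀ :* (c :* h)) := e :* (A :* c :* (x :* x)) :- c :* (h :* (x :* x :* C₀))) refl x ((E - 1#) * X) c (κ a σ E k) C₀ (κ a σ H k) ⟩
                κ a σ E k * ((E - 1#) * X * c * (x * x)) - c * (κ a σ H k * (x * x * C₀))
                  ≈⟨ +-congˡ (-‿cong (*-congˡ (transfer k))) ⟩
                κ a σ E k * ((E - 1#) * X * c * (x * x)) - c * (κ a σ E k * τ x)
                  ≈⟨ solve 4 (λ e A c t → e :* A :- c :* (e :* t) := e :* (A :- c :* t)) refl (κ a σ E k) ((E - 1#) * X * c * (x * x)) c (τ x) ⟩
                κ a σ E k * U x ∎)
              (λ k → shift (p ^ k))
              (solve 4 (λ a σ p H → (I :- I :* I) :* (p :* p :- a :* σ :* p :* (I :* I) :+ a :* a :* p :* (I :* I :* (I :* I))) :* (I :- a :* (p :* p :* H) :* I) :* H := O) refl a σ p H) K)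
            (trans (*-congʳ (hyper-vanish m z K m<K)) (zeroˡ _)))))

    N-cong : ∀ {a a′ σ σ′ δ δ′} x → a ≈ a′ → σ ≈ σ′ → δ ≈ δ′ → N a σ δ x ≈ N a′ σ′ δ′ x
    N-cong x ea eσ eδ = *-cong (*-cong (*-cong (+-congˡ (-‿cong (*-congʳ ea)))
      (+-congʳ (+-congˡ (-‿cong (*-congʳ eσ))))) (*-congʳ (*-congˡ ea))) (+-congʳ eδ)

    D-cong : ∀ {a a′ σ σ′ δ δ′} x → a ≈ a′ → σ ≈ σ′ → δ ≈ δ′ → D a σ δ x ≈ D a′ σ′ δ′ x
    D-cong x ea eσ eδ = *-cong (*-congˡ (+-cong
        (+-congˡ (-‿cong (*-congʳ (*-congʳ (*-cong ea eσ)))))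
        (*-congʳ (*-congʳ (*-cong ea ea)))))
      (+-congˡ (-‿cong (*-congʳ (*-congʳ (*-cong ea eδ)))))

    S-cong : ∀ {a a′ σ σ′ δ δ′} → (∀ k → Unit (D a σ δ (p ^ k))) → a ≈ a′ → σ ≈ σ′ → δ ≈ δ′ →
             ∀ K → S a σ δ K ≈ S a′ σ′ δ′ K
    S-cong {a} {a′} {σ} {σ′} {δ} {δ′} u ea eσ eδ K = Σ-cong K λ k _ → *-cong (+-congˡ (-‿cong (*-congʳ ea)))
      (trans (sym (*-identityʳ _)) (trans
        (hyper-transfer (λ _ → 1#) (λ _ → 1#) (λ k → N a σ δ (p ^ k) * D a σ δ (p ^ k)) u
          (λ j → unit-resp (D-cong (p ^ j) ea eσ eδ) (u j)) refl
          (λ j → trans (*-identityʳ _) (trans (*-congˡ (sym (D-cong (p ^ j) ea eσ eδ))) (sym (*-identityˡ _))))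
          (λ j → trans (*-identityʳ _) (trans (*-congʳ (sym (N-cong (p ^ j) ea eσ eδ))) (sym (*-identityˡ _)))) k)
        (*-identityʳ _)))

    -- A contiguous relation between a = α and a = p² α.
    module StepA (α σ δ : Carrier) where
      a′ C Y : Carrier
      a′ = α * (p * p)
      C = (1# - α) * (1# - α * p)
      Y = 1# - α * σ * p * δ + α * α * (p * p * p) * (δ * δ)

      W V P Γ U : Carrier → Carrier
      W x = quad² α σ x * (1# - α * δ * p * x) * (1# - α * δ * p * (p * x))
      V x = (1# - α * x) * (1# - α * p * x) * (x * x)
      P x = α * α * δ * p * (x * x) - 1#
      Γ x = (1# - x * x) * quad² α σ x * (1# - α * δ * p * (p * x)) * P x
      U x = cube α x * W x - Y * (cube a′ x * V x)

      certificate : ∀ x → U x ≈ N α σ δ x * P (p * x) - Γ x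
      certificate x = (solve 5 (λ α σ δ p x → (I :- α :* (x :* x :* x)) :* ((I :- α :* σ :* p :* (x :* x) :+ α :* α :* (p :* p :* p) :* (x :* x :* (x :* x))) :* (I :- α :* δ :* p :* x) :* (I :- α :* δ :* p :* (p :* x))) :- (I :- α :* σ :* p :* δ :+ α :* α :* (p :* p :* p) :* (δ :* δ)) :* ((I :- α :* (p :* p) :* (x :* x :* x)) :* ((I :- α :* x) :* (I :- α :* p :* x) :* (x :* x))) := (I :- α :* x) :* (I :- σ :* x :+ p :* (x :* x)) :* (p :* α :* x) :* (δ :- x :* x) :* (α :* α :* δ :* p :* (p :* x :* (p :* x)) :- I) :- (I :- x :* x) :* (I :- α :* σ :* p :* (x :* x) :+ α :* α :* (p :* p :* p) :* (x :* x :* (x :* x))) :* (I :- α :* δ :* p :* (p :* x)) :* (α :* α :* δ :* p :* (x :* x) :- I)) refl α σ δ p x)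

      shift : ∀ x → 1# * U x * D a′ σ δ x ≈ N α σ δ x * Γ (p * x) * 1# - Γ x * 1# * D a′ σ δ x
      shift x = trans (*-congʳ (*-congˡ (certificate x)))
        (solve 8 (λ α σ δ p x n g π →
           let d = (I :- p :* p :* (x :* x)) :* (I :- α :* (p :* p) :* σ :* p :* (x :* x) :+ α :* (p :* p) :* (α :* (p :* p)) :* (p :* p :* p) :* (x :* x :* (x :* x))) :* (I :- α :* (p :* p) :* δ :* p :* x) in
           I :* (n :* π :- g) :* d
           := n :* ((I :- p :* x :* (p :* x)) :* (I :- α :* σ :* p :* (p :* x :* (p :* x)) :+ α :* α :* (p :* p :* p) :* (p :* x :* (p :* x) :* (p :* x :* (p :* x)))) :* (I :- α :* δ :* p :* (p :* (p :* x))) :* π) :* I :- g :* I :* d) refl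
           α σ δ p x (N α σ δ x) (Γ x) (P (p * x)))

      -- The numerator of a = α over the denominator of a = p² α. Both series are this common term
      -- times a polynomial in p^k, `W` for α and `V` for p² α, up to the constants `W 1#` and `C`.
      core : ℕ → Carrier
      core = hyper (λ k → N α σ δ (p ^ k)) (λ k → D a′ σ δ (p ^ k))

      module _ (unit-D : ∀ k → Unit (D α σ δ (p ^ k))) (unit-D′ : ∀ k → Unit (D a′ σ δ (p ^ k))) where

        transfer-new : ∀ k → κ α σ δ k * W 1# ≈ core k * W (p ^ k)
        transfer-new = hyper-transfer (λ _ → W 1#) (λ k → W (p ^ k)) (λ k → N α σ δ (p ^ k) * D a′ σ δ (p ^ k))
          unit-D unit-D′ refl (λ k → *-comm _ _)
          (λ k → let x = p ^ k in solve 6 (λ α σ δ p x n →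
             let Q = λ x → I :- α :* σ :* p :* (x :* x) :+ α :* α :* (p :* p :* p) :* (x :* x :* (x :* x)) in
             n :* ((I :- p :* p :* (x :* x)) :* Q x :* (I :- α :* δ :* p :* x)) :* (Q (p :* x) :* (I :- α :* δ :* p :* (p :* x)) :* (I :- α :* δ :* p :* (p :* (p :* x))))
             := Q x :* (I :- α :* δ :* p :* x) :* (I :- α :* δ :* p :* (p :* x)) :* (n :* ((I :- p :* p :* (x :* x)) :* (I :- α :* (p :* p) :* σ :* p :* (x :* x) :+ α :* (p :* p) :* (α :* (p :* p)) :* (p :* p :* p) :* (x :* x :* (x :* x))) :* (I :- α :* (p :* p) :* δ :* p :* x)))) refl
             α σ δ p x (N α σ δ x))

        transfer-old : ∀ k → κ a′ σ δ k * C ≈ core k * V (p ^ k)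
        transfer-old = hyper-transfer (λ _ → C) (λ k → V (p ^ k)) (λ k → N a′ σ δ (p ^ k) * D a′ σ δ (p ^ k))
          unit-D′ unit-D′ (solve 2 (λ α p → (I :- α) :* (I :- α :* p) := (I :- α :* I) :* (I :- α :* p :* I) :* (I :* I)) refl α p) (λ k → *-comm _ _)
          (λ k → let x = p ^ k ; s = quad σ x ; t = δ - x * x ; d = D a′ σ δ x in
             (solve 6 (λ α p x s t d → (I :- α :* x) :* s :* (p :* α :* x) :* t :* d :* ((I :- α :* (p :* x)) :* (I :- α :* p :* (p :* x)) :* (p :* x :* (p :* x))) := (I :- α :* x) :* (I :- α :* p :* x) :* (x :* x) :* ((I :- α :* (p :* p) :* x) :* s :* (p :* (α :* (p :* p)) :* x) :* t :* d)) refl α p x s t d))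

        step : ∀ {K m} → N α σ δ (p ^ m) ≈ 0# → m < K → W 1# * S α σ δ K ≈ Y * C * S a′ σ δ K
        step {K} {m} z m<K = x∙y⁻¹≈ε⇒x≈y _ _ (trans (sym (Σ-linear K _ _ _ _)) (trans (sym (*-identityˡ _)) (trans
          (hyper-telescope (λ _ → 1#) _ (λ k → U (p ^ k)) (λ k → Γ (p ^ k)) unit-D′ (λ _ → unit-1)
            (λ k → let x = p ^ k in begin
              1# * (W 1# * (cube α x * κ α σ δ k) - Y * C * (cube a′ x * κ a′ σ δ k))
                ≈⟨ solve 7 (λ w c n Y C c′ o → I :* (w :* (c :* n) :- Y :* C :* (c′ :* o)) := c :* (n :* w) :- Y :* (c′ :* (o :* C))) refl (W 1#) (cube α x) (κ α σ δ k) Y C (cube a′ x) (κ a′ σ δ k) ⟩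
              cube α x * (κ α σ δ k * W 1#) - Y * (cube a′ x * (κ a′ σ δ k * C))
                ≈⟨ +-cong (*-congˡ (transfer-new k)) (-‿cong (*-congˡ (*-congˡ (transfer-old k)))) ⟩
              cube α x * (core k * W x) - Y * (cube a′ x * (core k * V x))
                ≈⟨ solve 6 (λ c e w Y c′ v → c :* (e :* w) :- Y :* (c′ :* (e :* v)) := e :* (c :* w :- Y :* (c′ :* v))) refl (cube α x) (core k) (W x) Y (cube a′ x) (V x) ⟩
              core k * U x ∎)
            (λ k → shift (p ^ k))
            (trans (*-congʳ (*-congʳ (*-congʳ (+-congˡ (-‿cong (*-identityˡ 1#))))))
              (solve 3 (λ u v w → (I :- I) :* u :* v :* w := O) refl (quad² α σ 1#) (1# - α * δ * p * (p * 1#)) (P 1#))) K)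
          (trans (*-congʳ (hyper-vanish m z K m<K)) (zeroˡ _)))))

    quad-factor : ∀ {b b′} x → b * b′ ≈ p → quad (b + b′) x ≈ (1# - b * x) * (1# - b′ * x)
    quad-factor {b} {b′} x e = trans (+-congˡ (*-congʳ (sym e)))
      (solve 3 (λ b b′ x → I :- (b :+ b′) :* x :+ b :* b′ :* (x :* x) := (I :- b :* x) :* (I :- b′ :* x)) refl b b′ x)

    quad²-factor : ∀ a {b b′} x → b * b′ ≈ p →
      quad² a (b + b′) x ≈ (1# - a * b * p * (x * x)) * (1# - a * b′ * p * (x * x))
    quad²-factor a {b} {b′} x e = trans (+-congˡ (*-congʳ (*-congˡ (*-congʳ (*-congʳ (sym e))))))
      (trans (+-congˡ (*-congʳ (*-congˡ (*-assoc _ _ _))))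
      (solve 5 (λ a b b′ p x → I :- a :* (b :+ b′) :* p :* (x :* x) :+ a :* a :* (b :* b′ :* (p :* p)) :* (x :* x :* (x :* x)) := (I :- a :* b :* p :* (x :* x)) :* (I :- a :* b′ :* p :* (x :* x))) refl a b b′ p x))

    -- The numerator contains the factors of the lower parameters β and η, the denominator those of
    -- the upper ones p² β and p² η. The terms for {β , p² η} and for {p² β , η} are then both this
    -- common term times a polynomial.
    coreN coreD : (a δ β η : Carrier) → Carrier → Carrier
    coreN a δ β η x = (1# - a * x) * ((1# - β * x) * (1# - η * x)) * (p * a * x) * (δ - x * x)
    coreD a δ β η x = (1# - p * p * (x * x)) * ((1# - a * β * (p * p * p) * (x * x)) * (1# - a * η * (p * p * p) * (x * x))) * (1# - a * δ * p * x)

    -- The common term is a parameter known only up to ≈: it serves once for (β , η) and once for (η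
    -- , β), where its symmetric factors appear in the other order.
    module TransferB (a δ β η : Carrier) (βηp : β * η * p ≈ 1#) (Nᶜ Dᶜ : ℕ → Carrier)
      (Nᶜ-≈ : ∀ k → Nᶜ k ≈ coreN a δ β η (p ^ k)) (Dᶜ-≈ : ∀ k → Dᶜ k ≈ coreD a δ β η (p ^ k))
      (unit-Dᶜ : ∀ k → Unit (Dᶜ k)) (unit-D : ∀ k → Unit (D a (β + η * (p * p)) δ (p ^ k))) where
      σ A : Carrier
      σ = β + η * (p * p)
      A = (1# - η) * (1# - η * p) * (1# - a * β * p)

      V : Carrier → Carrier
      V x = (1# - η * x) * (1# - η * p * x) * (1# - a * β * p * (x * x))

      product-p : β * (η * (p * p)) ≈ p
      product-p = trans (solve 3 (λ β η p → β :* (η :* (p :* p)) := β :* η :* p :* p) refl β η p) (trans (*-congʳ βηp) (*-identityˡ p))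

      h : ℕ → Carrier
      h k = let x = p ^ k in (1# - a * x) * ((1# - β * x) * (1# - η * (p * p) * x)) * (p * a * x) * (δ - x * x) * coreD a δ β η x

      transfer : ∀ k → κ a σ δ k * A ≈ hyper Nᶜ Dᶜ k * V (p ^ k)
      transfer = hyper-transfer (λ _ → A) (λ k → V (p ^ k)) h unit-D unit-Dᶜ
        (solve 4 (λ a β η p → (I :- η) :* (I :- η :* p) :* (I :- a :* β :* p) := (I :- η :* I) :* (I :- η :* p :* I) :* (I :- a :* β :* p :* (I :* I))) refl a β η p)
        (λ k → trans (*-comm _ _) (*-congˡ (*-cong (*-congʳ (*-congʳ (*-congˡ (quad-factor (p ^ k) product-p)))) (Dᶜ-≈ k))))
        (λ k → trans (*-congʳ (*-cong (Nᶜ-≈ k) (*-congʳ (*-congˡ (quad²-factor a (p ^ k) product-p)))))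
          (let x = p ^ k
               r = (1# - a * x) * (1# - β * x) * (p * a * x) * (δ - x * x) * (1# - p * p * (x * x)) * (1# - a * δ * p * x)
                   * (1# - η * x) * (1# - a * β * p * (x * x))
           in begin
             (1# - a * x) * ((1# - β * x) * (1# - η * x)) * (p * a * x) * (δ - x * x) *
               ((1# - p * p * (x * x)) * ((1# - a * β * p * (x * x)) * (1# - a * (η * (p * p)) * p * (x * x))) * (1# - a * δ * p * x)) * V (p * x)
               ≈⟨ solve 10 (λ t₁ t₂ t₃ t₄ t₅ t₆ t₇ t₈ t₉ v → t₁ :* (t₂ :* t₇) :* t₃ :* t₄ :* (t₅ :* (t₈ :* t₉) :* t₆) :* v := t₁ :* t₂ :* t₃ :* t₄ :* t₅ :* t₆ :* t₇ :* t₈ :* (t₉ :* v)) refl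
                    (1# - a * x) (1# - β * x) (p * a * x) (δ - x * x) (1# - p * p * (x * x)) (1# - a * δ * p * x) (1# - η * x) (1# - a * β * p * (x * x)) (1# - a * (η * (p * p)) * p * (x * x)) (V (p * x)) ⟩
             r * ((1# - a * (η * (p * p)) * p * (x * x)) * V (p * x))
               ≈⟨ *-congˡ (solve 5 (λ a β η p x → (I :- a :* (η :* (p :* p)) :* p :* (x :* x)) :* ((I :- η :* (p :* x)) :* (I :- η :* p :* (p :* x)) :* (I :- a :* β :* p :* (p :* x :* (p :* x)))) := (I :- η :* p :* x) :* (I :- η :* (p :* p) :* x) :* ((I :- a :* β :* (p :* p :* p) :* (x :* x)) :* (I :- a :* η :* (p :* p :* p) :* (x :* x)))) refl a β η p x) ⟩
             r * ((1# - η * p * x) * (1# - η * (p * p) * x) * ((1# - a * β * (p * p * p) * (x * x)) * (1# - a * η * (p * p * p) * (x * x))))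
               ≈⟨ solve 11 (λ t₁ t₂ t₃ t₄ t₅ t₆ t₇ t₈ t₉ e c → t₁ :* t₂ :* t₃ :* t₄ :* t₅ :* t₆ :* t₇ :* t₈ :* (t₉ :* e :* c) := t₇ :* t₉ :* t₈ :* (t₁ :* (t₂ :* e) :* t₃ :* t₄ :* (t₅ :* c :* t₆))) refl
                    (1# - a * x) (1# - β * x) (p * a * x) (δ - x * x) (1# - p * p * (x * x)) (1# - a * δ * p * x) (1# - η * x) (1# - a * β * p * (x * x)) (1# - η * p * x) (1# - η * (p * p) * x) _ ⟩
             V x * h k ∎))

    -- A contiguous relation between {b , b′} = {β , p² η} and {b , b′} = {p² β , η}.
    module StepB (a δ β η : Carrier) (βηp : β * η * p ≈ 1#)
      (unit-Dᶜ : ∀ k → Unit (coreD a δ β η (p ^ k)))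
      (unit-new : ∀ k → Unit (D a (β + η * (p * p)) δ (p ^ k)))
      (unit-old : ∀ k → Unit (D a (η + β * (p * p)) δ (p ^ k)))
      (unit-1-η : Unit (1# - η)) (unit-1-ηp : Unit (1# - η * p)) where
      σ-new σ-old X Y : Carrier
      σ-new = β + η * (p * p)
      σ-old = η + β * (p * p)
      X = β - a * δ
      Y = η - a * δ

      ηβp : η * β * p ≈ 1#
      ηβp = trans (*-congʳ (*-comm _ _)) βηp

      private
        module New = TransferB a δ β η βηp (λ k → coreN a δ β η (p ^ k)) (λ k → coreD a δ β η (p ^ k))
          (λ _ → refl) (λ _ → refl) unit-Dᶜ unit-new
        module Old = TransferB a δ η β ηβp (λ k → coreN a δ β η (p ^ k)) (λ k → coreD a δ β η (p ^ k))
          (λ _ → *-congʳ (*-congʳ (*-congˡ (*-comm _ _)))) (λ _ → *-congʳ (*-congˡ (*-comm _ _))) unit-Dᶜ unit-old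

      core : ℕ → Carrier
      core = hyper (λ k → coreN a δ β η (p ^ k)) (λ k → coreD a δ β η (p ^ k))

      U Γ : Carrier → Carrier
      U x = cube a x * (X * New.V x - Y * Old.V x)
      Γ x = (1# - x * x) * ((1# - a * β * p * (x * x)) * (1# - a * η * p * (x * x))) * (1# - a * δ * x) * (η - β)

      certificate : ∀ x → U x ≈ coreN a δ β η x * (η - β) - Γ x
      certificate x = begin
        U x
          -- The identity holds only under β η p = 1. For free variables the two sides differ by β η
          -- p - 1 times `cofactor`, a form that the solver can check.
          ≈⟨ (solve 6 (λ a δ β η p x → (I :- a :* (x :* x :* x)) :* ((β :- a :* δ) :* ((I :- η :* x) :* (I :- η :* p :* x) :* (I :- a :* β :* p :* (x :* x))) :- (η :- a :* δ) :* ((I :- β :* x) :* (I :- β :* p :* x) :* (I :- a :* η :* p :* (x :* x)))) := (I :- a :* x) :* ((I :- β :* x) :* (I :- η :* x)) :* (p :* a :* x) :* (δ :- x :* x) :* (η :- β) :- (I :- x :* x) :* ((I :- a :* β :* p :* (x :* x)) :* (I :- a :* η :* p :* (x :* x))) :* (I :- a :* δ :* x) :* (η :- β) :+ (β :* η :* p :- I) :* ((η :- β) :* (x :* x) :* ((I :- a :* x) :* (I :- a :* p :* x) :* (I :- a :* δ :* x)))) refl a δ β η p x) ⟩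
        coreN a δ β η x * (η - β) - Γ x + (β * η * p - 1#) * cofactor
          ≈⟨ +-congˡ (trans (*-congʳ (trans (+-congʳ βηp) (-‿inverseʳ 1#))) (zeroˡ _)) ⟩
        coreN a δ β η x * (η - β) - Γ x + 0#
          ≈⟨ +-identityʳ _ ⟩
        coreN a δ β η x * (η - β) - Γ x ∎
        where cofactor = (η - β) * (x * x) * ((1# - a * x) * (1# - a * p * x) * (1# - a * δ * x))

      shift : ∀ x → 1# * U x * coreD a δ β η x ≈ coreN a δ β η x * Γ (p * x) * 1# - Γ x * 1# * coreD a δ β η x
      shift x = trans (*-congʳ (*-congˡ (certificate x))) (let n = coreN a δ β η x ; g = Γ x in
        (solve 8 (λ a δ β η p x n g → I :* (n :* (η :- β) :- g) :* ((I :- p :* p :* (x :* x)) :* ((I :- a :* β :* (p :* p :* p) :* (x :* x)) :* (I :- a :* η :* (p :* p :* p) :* (x :* x))) :* (I :- a :* δ :* p :* x)) := n :* ((I :- p :* x :* (p :* x)) :* ((I :- a :* β :* p :* (p :* x :* (p :* x))) :* (I :- a :* η :* p :* (p :* x :* (p :* x)))) :* (I :- a :* δ :* (p :* x)) :* (η :- β)) :* I :- g :* I :* ((I :- p :* p :* (x :* x)) :* ((I :- a :* β :* (p :* p :* p) :* (x :* x)) :* (I :- a :* η :* (p :* p :* p) :* (x :* x))) :* (I :- a :* δ :* p :* x))) refl a δ β η p x n g))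

      telescoped : ∀ {K m} → coreN a δ β η (p ^ m) ≈ 0# → m < K →
                   X * New.A * S a σ-new δ K ≈ Y * Old.A * S a σ-old δ K
      telescoped {K} {m} z m<K = x∙y⁻¹≈ε⇒x≈y _ _ (trans (sym (Σ-linear K _ _ _ _)) (trans (sym (*-identityˡ _)) (trans
        (hyper-telescope (λ _ → 1#) _ (λ k → U (p ^ k)) (λ k → Γ (p ^ k)) unit-Dᶜ (λ _ → unit-1)
          (λ k → let x = p ^ k in begin
            1# * (X * New.A * (cube a x * κ a σ-new δ k) - Y * Old.A * (cube a x * κ a σ-old δ k))
              ≈⟨ solve 7 (λ X A c n Y B o → I :* (X :* A :* (c :* n) :- Y :* B :* (c :* o)) := c :* (X :* (n :* A) :- Y :* (o :* B))) refl X New.A (cube a x) (κ a σ-new δ k) Y Old.A (κ a σ-old δ k) ⟩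
            cube a x * (X * (κ a σ-new δ k * New.A) - Y * (κ a σ-old δ k * Old.A))
              ≈⟨ *-congˡ (+-cong (*-congˡ (New.transfer k)) (-‿cong (*-congˡ (Old.transfer k)))) ⟩
            cube a x * (X * (core k * New.V x) - Y * (core k * Old.V x))
              ≈⟨ solve 6 (λ c X e v Y w → c :* (X :* (e :* v) :- Y :* (e :* w)) := e :* (c :* (X :* v :- Y :* w))) refl (cube a x) X (core k) (New.V x) Y (Old.V x) ⟩
            core k * U x ∎)
          (λ k → shift (p ^ k))
          (trans (*-congʳ (*-congʳ (*-congʳ (+-congˡ (-‿cong (*-identityˡ 1#))))))
            (solve 3 (λ u v w → (I :- I) :* u :* v :* w := O) refl _ _ _)) K)
        (trans (*-congʳ (hyper-vanish m z K m<K)) (zeroˡ _)))))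

      -- Under β η p = 1 every constant of `telescoped` can be expressed by η: β - a δ = β (1 - a δ
      -- η p), 1 - a β p = β p (η - a), and (1 - β)(1 - β p) = β² p (1 - η)(1 - η p). The common
      -- unit `w` then cancels.
      step : ∀ {K m} → coreN a δ β η (p ^ m) ≈ 0# → m < K →
             (1# - a * δ * η * p) * (η - a) * S a σ-new δ K ≈ (η - a * δ) * (1# - a * η * p) * S a σ-old δ K
      step {K} {m} z m<K = unit-cancel (unit-* (unit-* (unit-* unit-β unit-β) unit-p) (unit-* unit-1-η unit-1-ηp)) (begin
        w * ((1# - a * δ * η * p) * (η - a) * s)
          ≈⟨ (solve 6 (λ a δ β η p s → β :* β :* p :* ((I :- η) :* (I :- η :* p)) :* ((I :- a :* δ :* η :* p) :* (η :- a) :* s) := (β :- a :* δ :* (β :* η :* p)) :* ((I :- η) :* (I :- η :* p) :* (β :* η :* p :- a :* β :* p)) :* s) refl a δ β η p s) ⟩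
        (β - a * δ * (β * η * p)) * ((1# - η) * (1# - η * p) * (β * η * p - a * β * p)) * s
          ≈⟨ *-congʳ (*-cong (+-congˡ (-‿cong (trans (*-congˡ βηp) (*-identityʳ _)))) (*-congˡ (+-congʳ βηp))) ⟩
        X * New.A * s
          ≈⟨ telescoped z m<K ⟩
        Y * Old.A * t
          ≈⟨ (solve 6 (λ a δ β η p t → (η :- a :* δ) :* ((I :- β) :* (I :- β :* p) :* (I :- a :* η :* p)) :* t := (β :- I) :* (β :* p :- I) :* ((η :- a :* δ) :* (I :- a :* η :* p) :* t)) refl a δ β η p t) ⟩
        (β - 1#) * (β * p - 1#) * ((η - a * δ) * (1# - a * η * p) * t)
          ≈⟨ *-congʳ (*-cong (+-congˡ (-‿cong βηp)) (+-congˡ (-‿cong βηp))) ⟨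
        (β - β * η * p) * (β * p - β * η * p) * ((η - a * δ) * (1# - a * η * p) * t)
          ≈⟨ (solve 6 (λ a δ β η p t → (β :- β :* η :* p) :* (β :* p :- β :* η :* p) :* ((η :- a :* δ) :* (I :- a :* η :* p) :* t) := β :* β :* p :* ((I :- η) :* (I :- η :* p)) :* ((η :- a :* δ) :* (I :- a :* η :* p) :* t)) refl a δ β η p t) ⟩
        w * ((η - a * δ) * (1# - a * η * p) * t) ∎)
        where
        w = β * β * p * ((1# - η) * (1# - η * p))
        s = S a σ-new δ K
        t = S a σ-old δ K
        unit-β : Unit β
        unit-β = η * p , trans (sym (*-assoc _ _ _)) βηp

    -- Closed forms of the terminating series

    squares : ℕ → Carrier
    squares zero    = 1#
    squares (suc m) = p * p * squares m

    squares-^ : ∀ m → squares m ≈ p ^ m * p ^ m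
    squares-^ zero    = sym (*-identityˡ 1#)
    squares-^ (suc m) = trans (*-congˡ (squares-^ m))
      (solve 2 (λ p x → p :* p :* (x :* x) := p :* x :* (p :* x)) refl p (p ^ m))

    N-δ-zero : ∀ a σ m → N a σ (squares m) (p ^ m) ≈ 0#
    N-δ-zero a σ m = trans (*-congˡ (trans (+-congʳ (squares-^ m)) (-‿inverseʳ _))) (zeroʳ _)

    -- `StepD` lowers δ from p^(2 m) to 1, where the numerator vanishes at x = 1 and only the first
    -- term 1 - a survives. The recursion for `squares` makes `E` equal to the next δ by
    -- computation. The factors `X` stay on the left, since they are not assumed to be units.
    sum-δ : ∀ a σ → (∀ i k → Unit (D a σ (squares i) (p ^ k))) → (∀ i → Unit (squares (suc i) - 1#)) →
      ∀ m {K} → m < K →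
      Π m (λ i → StepD.X a σ (squares i)) * S a σ (squares m) K
        ≈ (1# - a) * Π m (λ i → (1# - a * (p * squares i)) * (1# - a * squares (suc i)))
    sum-δ a σ u v zero {K} 0<K = trans (*-identityˡ _) (trans (S-vanish 0 (N-δ-zero a σ 0) 0<K)
      (solve 1 (λ a → O :+ (I :- a :* (I :* I :* I)) :* I := (I :- a) :* I) refl a))
    sum-δ a σ u v (suc m) {K} m<K = begin
      P * X * s             ≈⟨ *-assoc _ _ _ ⟩
      P * (X * s)           ≈⟨ *-congˡ (unit-cancel (v m) (trans (sym (*-assoc _ _ _)) (trans
                                 (step (u m) (u (suc m)) (N-δ-zero a σ (suc m)) m<K)
                                 (trans (*-congʳ (*-assoc _ _ _)) (*-assoc _ _ _))))) ⟩
      P * (Z * t)           ≈⟨ solve 3 (λ P Z t → P :* (Z :* t) := P :* t :* Z) refl P Z t ⟩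
      P * t * Z             ≈⟨ *-congʳ (sum-δ a σ u v m (ℕ.<-trans ℕ.≤-refl m<K)) ⟩
      (1# - a) * R * Z      ≈⟨ *-assoc _ _ _ ⟩
      (1# - a) * (R * Z)    ∎
      where
      open StepD a σ (squares m)
      P = Π m (λ i → StepD.X a σ (squares i))
      R = Π m (λ i → (1# - a * (p * squares i)) * (1# - a * squares (suc i)))
      Z = (1# - a * (p * squares m)) * (1# - a * squares (suc m))
      s = S a σ (squares (suc m)) K
      t = S a σ (squares m) K

    module Inverse (p⁻¹ : Carrier) (pp⁻¹ : p * p⁻¹ ≈ 1#) where

      squares⁻¹ : ℕ → Carrier
      squares⁻¹ zero    = 1#
      squares⁻¹ (suc m) = p⁻¹ * p⁻¹ * squares⁻¹ m

      squares⁻¹-step : ∀ m → squares⁻¹ (suc m) * (p * p) ≈ squares⁻¹ m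
      squares⁻¹-step m = begin
        p⁻¹ * p⁻¹ * s * (p * p)      ≈⟨ solve 3 (λ i s p → i :* i :* s :* (p :* p) := p :* i :* (p :* i) :* s) refl p⁻¹ s p ⟩
        p * p⁻¹ * (p * p⁻¹) * s      ≈⟨ *-congʳ (*-cong pp⁻¹ pp⁻¹) ⟩
        1# * 1# * s                  ≈⟨ trans (*-congʳ (*-identityˡ 1#)) (*-identityˡ s) ⟩
        s                            ∎
        where s = squares⁻¹ m

      squares⁻¹-^ : ∀ m → squares⁻¹ m * p ^ (m ℕ.+ m) ≈ 1#
      squares⁻¹-^ zero    = *-identityˡ 1#
      squares⁻¹-^ (suc m) = begin
        s₁ * (p * p ^ (m ℕ.+ suc m))        ≡⟨ ≡.cong (λ j → s₁ * (p * p ^ j)) (ℕ.+-suc m m) ⟩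
        s₁ * (p * (p * p ^ (m ℕ.+ m)))      ≈⟨ solve 3 (λ s p x → s :* (p :* (p :* x)) := s :* (p :* p) :* x) refl s₁ p (p ^ (m ℕ.+ m)) ⟩
        s₁ * (p * p) * p ^ (m ℕ.+ m)        ≈⟨ *-congʳ (squares⁻¹-step m) ⟩
        squares⁻¹ m * p ^ (m ℕ.+ m)         ≈⟨ squares⁻¹-^ m ⟩
        1#                                  ∎
        where s₁ = squares⁻¹ (suc m)

      N-a-zero : ∀ σ δ m → N (squares⁻¹ m) σ δ (p ^ (m ℕ.+ m)) ≈ 0#
      N-a-zero σ δ m = trans (*-congʳ (*-congʳ (*-congʳ (trans (+-congˡ (-‿cong (squares⁻¹-^ m))) (-‿inverseʳ 1#)))))
        (solve 3 (λ u v w → O :* u :* v :* w := O) refl _ _ _)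

      -- At a = 1 the first term is 1 - a = 0 and the numerator vanishes at x = 1; `StepA` carries
      -- this zero to a = p^(-2 m). Units are asked for i ≤ m only, because for some of the σ and δ
      -- used later a denominator vanishes beyond.
      sum-a : ∀ σ δ m → (∀ i → i ≤ m → ∀ k → Unit (D (squares⁻¹ i) σ δ (p ^ k))) →
        ∀ {K} → m ℕ.+ m < K → S (squares⁻¹ m) σ δ K ≈ 0#
      sum-a σ δ zero    u 0<K = trans (S-vanish 0 (N-a-zero σ δ 0) 0<K)
        (solve 0 (O :+ (I :- I :* (I :* I :* I)) :* I := O) refl)
      sum-a σ δ (suc m) u {K} m<K = unit-cancel-0 unit-W (begin
        W 1# * S (squares⁻¹ (suc m)) σ δ K    ≈⟨ step (u (suc m) ℕ.≤-refl) unit-a′ (N-a-zero σ δ (suc m)) m<K ⟩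
        Y * C * S a′ σ δ K                    ≈⟨ *-congˡ (S-cong unit-a′ (squares⁻¹-step m) refl refl K) ⟩
        Y * C * S (squares⁻¹ m) σ δ K         ≈⟨ *-congˡ (sum-a σ δ m (λ i i≤m → u i (ℕ.m≤n⇒m≤1+n i≤m))
                                                   (ℕ.≤-<-trans (ℕ.+-mono-≤ (ℕ.n≤1+n m) (ℕ.n≤1+n m)) m<K)) ⟩
        Y * C * 0#                            ≈⟨ zeroʳ _ ⟩
        0#                                    ∎)
        where
        open StepA (squares⁻¹ (suc m)) σ δ
        unit-W : Unit (W 1#)
        unit-W = unit-* (unit-* (unit-factorʳ (unit-factorˡ (u (suc m) ℕ.≤-refl 0))) (unit-factorʳ (u (suc m) ℕ.≤-refl 0)))
          (unit-resp (+-congˡ (-‿cong (*-congˡ refl))) (unit-factorʳ (u (suc m) ℕ.≤-refl 1)))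
        unit-a′ : ∀ k → Unit (D a′ σ δ (p ^ k))
        unit-a′ k = unit-resp (D-cong (p ^ k) (sym (squares⁻¹-step m)) refl refl) (u m (ℕ.n≤1+n m) k)

      odd : ℕ → Carrier
      odd m = p * squares m

      -- The value of b + p / b at b = p^(-2 m); the factor 1 - b x ends the series at x = p^(2 m).
      σ-at : ℕ → Carrier
      σ-at m = squares⁻¹ m + odd m

      squares-inverse : ∀ m → squares⁻¹ m * squares m ≈ 1#
      squares-inverse m = trans (*-congˡ (trans (squares-^ m) (sym (^-homo-* p m m)))) (squares⁻¹-^ m)

      σ-at-product : ∀ m → squares⁻¹ m * odd m ≈ p
      σ-at-product m = trans (solve 3 (λ i p s → i :* (p :* s) := i :* s :* p) refl _ p _)
        (trans (*-congʳ (squares-inverse m)) (*-identityˡ p))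

      N-σ-zero : ∀ a δ m → N a (σ-at m) δ (p ^ (m ℕ.+ m)) ≈ 0#
      N-σ-zero a δ m = trans (*-congʳ (*-congʳ (*-congˡ (trans (quad-factor _ (σ-at-product m))
          (*-congʳ (trans (+-congˡ (-‿cong (squares⁻¹-^ m))) (-‿inverseʳ 1#)))))))
        (solve 4 (λ u v w x → u :* (O :* v) :* w :* x := O) refl _ _ _ _)

      -- `StepB` with β = p^(-2 m - 2) and η = p^(2 m + 1) satisfies β η p = 1 and joins
      -- `σ-at (suc m)` to `σ-at m`. The descent ends at b = 1, where only the first term 1 - a is
      -- left.
      sum-b : ∀ a δ → (∀ i k → Unit (D a (σ-at i) δ (p ^ k))) →
        (∀ i k → Unit (coreD a δ (squares⁻¹ (suc i)) (odd i) (p ^ k))) →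
        (∀ i → Unit (1# - odd i)) → (∀ i → Unit (1# - odd i * p)) →
        ∀ m {K} → m ℕ.+ m < K →
        Π m (λ i → (1# - a * δ * odd i * p) * (odd i - a)) * S a (σ-at m) δ K
          ≈ (1# - a) * Π m (λ i → (odd i - a * δ) * (1# - a * odd i * p))
      sum-b a δ u v w w′ zero 0<K = trans (*-identityˡ _) (trans (S-vanish 0 (N-σ-zero a δ 0) 0<K)
        (solve 1 (λ a → O :+ (I :- a :* (I :* I :* I)) :* I := (I :- a) :* I) refl a))
      sum-b a δ u v w w′ (suc m) {K} m<K = begin
        P * X′ * S a (σ-at (suc m)) δ K    ≈⟨ *-assoc _ _ _ ⟩
        P * (X′ * S a (σ-at (suc m)) δ K)  ≈⟨ *-congˡ (*-congˡ (S-cong (u (suc m)) refl σ-new-≈ refl K)) ⟩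
        P * (X′ * S a σ-new δ K)           ≈⟨ *-congˡ (step zero-core m<K) ⟩
        P * (Z * S a σ-old δ K)            ≈⟨ *-congˡ (*-congˡ (S-cong (u m) refl σ-old-≈ refl K)) ⟨
        P * (Z * t)                        ≈⟨ solve 3 (λ P Z t → P :* (Z :* t) := P :* t :* Z) refl P Z t ⟩
        P * t * Z                          ≈⟨ *-congʳ (sum-b a δ u v w w′ m (ℕ.≤-<-trans (ℕ.+-mono-≤ (ℕ.n≤1+n m) (ℕ.n≤1+n m)) m<K)) ⟩
        (1# - a) * R * Z                   ≈⟨ *-assoc _ _ _ ⟩
        (1# - a) * (R * Z)                 ∎
        where
        P = Π m (λ i → (1# - a * δ * odd i * p) * (odd i - a))
        R = Π m (λ i → (odd i - a * δ) * (1# - a * odd i * p))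
        X′ = (1# - a * δ * odd m * p) * (odd m - a)
        Z = (odd m - a * δ) * (1# - a * odd m * p)
        t = S a (σ-at m) δ K
        σ-new-≈ : σ-at (suc m) ≈ squares⁻¹ (suc m) + odd m * (p * p)
        σ-new-≈ = +-congˡ (solve 2 (λ p s → p :* (p :* p :* s) := p :* s :* (p :* p)) refl p (squares m))
        σ-old-≈ : σ-at m ≈ odd m + squares⁻¹ (suc m) * (p * p)
        σ-old-≈ = trans (+-comm _ _) (+-congˡ (sym (squares⁻¹-step m)))
        product-1 : squares⁻¹ (suc m) * odd m * p ≈ 1#
        product-1 = trans (solve 3 (λ i p s → i :* (p :* s) :* p := i :* (p :* p) :* s) refl _ p _)
          (trans (*-congʳ (squares⁻¹-step m)) (squares-inverse m))
        open StepB a δ (squares⁻¹ (suc m)) (odd m) product-1 (v m)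
          (λ k → unit-resp (D-cong (p ^ k) refl σ-new-≈ refl) (u (suc m) k))
          (λ k → unit-resp (D-cong (p ^ k) refl σ-old-≈ refl) (u m k)) (w m) (w′ m)
        zero-core : coreN a δ (squares⁻¹ (suc m)) (odd m) (p ^ (suc m ℕ.+ suc m)) ≈ 0#
        zero-core = trans (*-congʳ (*-congʳ (*-congˡ (*-congʳ
            (trans (+-congˡ (-‿cong (squares⁻¹-^ (suc m)))) (-‿inverseʳ 1#))))))
          (solve 4 (λ u v w x → u :* (O :* v) :* w :* x := O) refl _ _ _ _)

-- Cyclotomic polynomials and coprimality

module Cyclotomic (R : CommutativeRing 0ℓ 0ℓ) where
  open CommutativeRing R
  open import Data.Nat.Divisibility using (_∣_; _∣?_; divides; ∣-refl; ∣-trans; ∣⇒≤)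
  open import Data.Nat.GCD using (gcd; gcd[m,n]∣m; gcd[m,n]∣n; gcd-GCD; module Bézout)
  open IntegerSolver R
  open Products R using (Σ)
  open import Algebra.Properties.Semiring.Exp semiring using (_^_; ^-homo-*; ^-assocʳ)
  open import Algebra.Properties.Group +-group using (x∙y⁻¹≈ε⇒x≈y; x≈y⇒x∙y⁻¹≈ε)
  open import Relation.Binary.Reasoning.Setoid setoid

  private
    I O : ∀ {n} → Polynomial n
    I = con (+ 1)
    O = con (+ 0)

  geometric : ∀ y i → (1# - y) * Σ i (y ^_) ≈ 1# - y ^ i
  geometric y zero    = solve 1 (λ y → (I :- y) :* O := I :- I) refl y
  geometric y (suc i) = begin
    (1# - y) * (Σ i (y ^_) + y ^ i)               ≈⟨ distribˡ _ _ _ ⟩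
    (1# - y) * Σ i (y ^_) + (1# - y) * y ^ i      ≈⟨ +-congʳ (geometric y i) ⟩
    (1# - y ^ i) + (1# - y) * y ^ i               ≈⟨ solve 2 (λ y z → (I :- z) :+ (I :- y) :* z := I :- y :* z) refl y (y ^ i) ⟩
    1# - y ^ suc i                                ∎

  1-^-divisible : ∀ y i → ∃ λ z → 1# - y ^ i ≈ (1# - y) * z
  1-^-divisible y i = Σ i (y ^_) , sym (geometric y i)

  -- Every power of y is 1 modulo 1 - y, so the sum reduces to its number of terms. The nonzero
  -- integers that witness coprimality of cyclotomic factors come from here.
  geometric-mod : ∀ y i → ∃ λ z → Σ i (y ^_) ≈ fromℤ (+ i) + (1# - y) * z
  geometric-mod y zero    = 0# , sym (trans (+-congˡ (zeroʳ (1# - y))) (+-identityʳ 0#))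
  geometric-mod y (suc i) = z - w , (begin
    Σ i (y ^_) + y ^ i                              ≈⟨ +-cong (proj₂ (geometric-mod y i)) (solve 1 (λ u → u := I :- (I :- u)) refl (y ^ i)) ⟩
    fromℤ (+ i) + (1# - y) * z + (1# - (1# - y ^ i))
      ≈⟨ +-congˡ (+-congˡ (-‿cong (proj₂ (1-^-divisible y i)))) ⟩
    fromℤ (+ i) + (1# - y) * z + (1# - (1# - y) * w)
      ≈⟨ solve 4 (λ c y z w → c :+ (I :- y) :* z :+ (I :- (I :- y) :* w) := I :+ c :+ (I :- y) :* (z :- w)) refl (fromℤ (+ i)) y z w ⟩
    1# + fromℤ (+ i) + (1# - y) * (z - w)           ≈⟨ +-congʳ (fromℤ-+ (+ 1) (+ i)) ⟨
    fromℤ (+ suc i) + (1# - y) * (z - w)            ∎)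
    where
    z = proj₁ (geometric-mod y i)
    w = proj₁ (1-^-divisible y i)

  infix 4 _⟂_
  -- The coprimality of `CoprimeP`, over any ring. An integer in place of 1 is essential over ℤ: the
  -- ideal generated by q - 1 and q + 1 contains 2 but not 1.
  _⟂_ : Carrier → Carrier → Set
  D ⟂ P = ∃ λ U → ∃ λ V → ∃ λ c → c ≢ 0ℤ × U * D + V * P ≈ fromℤ c

  ⟂-sym : ∀ {D P} → D ⟂ P → P ⟂ D
  ⟂-sym (U , V , c , c≢0 , e) = V , U , c , c≢0 , trans (+-comm _ _) e

  ⟂-*ʳ : ∀ {D P P′} → D ⟂ P → D ⟂ P′ → D ⟂ P * P′
  ⟂-*ʳ {D} {P} {P′} (U , V , c , c≢0 , e) (U′ , V′ , c′ , c′≢0 , e′) =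
    U * (U′ * D + V′ * P′) + V * P * U′ , V * V′ , c ℤ.* c′ , *-nonzero c≢0 c′≢0 , (begin
      (U * (U′ * D + V′ * P′) + V * P * U′) * D + V * V′ * (P * P′)
        ≈⟨ solve 7 (λ U V U′ V′ D P P′ → (U :* (U′ :* D :+ V′ :* P′) :+ V :* P :* U′) :* D :+ V :* V′ :* (P :* P′) := (U :* D :+ V :* P) :* (U′ :* D :+ V′ :* P′)) refl U V U′ V′ D P P′ ⟩
      (U * D + V * P) * (U′ * D + V′ * P′)  ≈⟨ *-cong e e′ ⟩
      fromℤ c * fromℤ c′                  ≈⟨ sym (fromℤ-* c c′) ⟩
      fromℤ (c ℤ.* c′)                     ∎)

  ⟂-*ˡ : ∀ {D D′ P} → D ⟂ P → D′ ⟂ P → D * D′ ⟂ P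
  ⟂-*ˡ d d′ = ⟂-sym (⟂-*ʳ (⟂-sym d) (⟂-sym d′))

  1⟂ : ∀ P → 1# ⟂ P
  1⟂ P = 1# , 0# , 1ℤ , (λ ()) , solve 1 (λ P → I :* I :+ O :* P := I) refl P

  ⟂-mod : ∀ {D D′ P} Z → D′ ≈ D + P * Z → D ⟂ P → D′ ⟂ P
  ⟂-mod {D} {D′} {P} Z e′ (U , V , c , c≢0 , e) = U , V - U * Z , c , c≢0 , (begin
    U * D′ + (V - U * Z) * P           ≈⟨ +-congʳ (*-congˡ e′) ⟩
    U * (D + P * Z) + (V - U * Z) * P  ≈⟨ (solve 5 (λ U V D P Z → U :* (D :+ P :* Z) :+ (V :- U :* Z) :* P := U :* D :+ V :* P) refl U V D P Z) ⟩
    U * D + V * P                      ≈⟨ e ⟩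
    fromℤ c                           ∎)

  ⟂-resp : ∀ {D D′ P P′} → D ≈ D′ → P ≈ P′ → D ⟂ P → D′ ⟂ P′
  ⟂-resp eD eP (U , V , c , c≢0 , e) = U , V , c , c≢0 , trans (+-cong (*-congˡ (sym eD)) (*-congˡ (sym eP))) e

  ⟂-factorʳ : ∀ {D} P K → D ⟂ P * K → D ⟂ P
  ⟂-factorʳ P K (U , V , c , c≢0 , e) = U , V * K , c , c≢0 ,
    trans (+-congˡ (solve 3 (λ V K P → V :* K :* P := V :* (P :* K)) refl V K P)) e

  ⟂-factorˡ : ∀ {P} D K → D * K ⟂ P → D ⟂ P
  ⟂-factorˡ D K d = ⟂-sym (⟂-factorʳ D K (⟂-sym d))

  const-⟂ : ∀ i {P} → + suc i ≢ 0ℤ → fromℤ (+ suc i) ⟂ P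
  const-⟂ i {P} i≢0 = 1# , 0# , + suc i , i≢0 , solve 2 (λ c P → I :* c :+ O :* P := c) refl (fromℤ (+ suc i)) P

  divProd : (ℕ → Carrier) → ℕ → ℕ → Carrier
  divProd f n zero    = 1#
  divProd f n (suc d) with suc d ∣? n
  ... | yes _ = divProd f n d * f (suc d)
  ... | no _  = divProd f n d

  module _ (f : ℕ → Carrier) where

    divProd-∣ : ∀ {n d} → suc d ∣ n → divProd f n (suc d) ≡ divProd f n d * f (suc d)
    divProd-∣ {n} {d} d∣n with suc d ∣? n
    ... | yes _  = ≡.refl
    ... | no d∤n = contradiction d∣n d∤n

    divProd-∤ : ∀ {n d} → ¬ suc d ∣ n → divProd f n (suc d) ≡ divProd f n d
    divProd-∤ {n} {d} d∤n with suc d ∣? n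
    ... | yes d∣n = contradiction d∣n d∤n
    ... | no _    = ≡.refl

    divProd-divides : ∀ {g n} → g ∣ n → ∀ k → ∃ λ K → divProd f n k ≈ divProd f g k * K
    divProd-divides g∣n zero = 1# , sym (*-identityˡ 1#)
    divProd-divides {g} {n} g∣n (suc k) with divProd-divides g∣n k | suc k ∣? g | suc k ∣? n
    ... | K , e | yes _   | yes _   = K , trans (*-congʳ e) (solve 3 (λ a K b → a :* K :* b := a :* b :* K) refl _ K _)
    ... | K , e | yes k∣g | no k∤n  = contradiction (∣-trans k∣g g∣n) k∤n
    ... | K , e | no _    | yes _   = K * f (suc k) , trans (*-congʳ e) (*-assoc _ _ _)
    ... | K , e | no _    | no _    = K , e

    divProd-stable : ∀ g k → divProd f (suc g) (suc g ℕ.+ k) ≡ divProd f (suc g) (suc g)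
    divProd-stable g zero    = ≡.cong (divProd f (suc g)) (ℕ.+-identityʳ (suc g))
    divProd-stable g (suc k) = ≡.trans (≡.cong (divProd f (suc g)) (ℕ.+-suc (suc g) k))
      (≡.trans (divProd-∤ λ d → ℕ.<⇒≱ (ℕ.m≤m+n (suc (suc g)) k) (∣⇒≤ d)) (divProd-stable g k))

  -- Division occurs only by the elements `1# - X ^ suc k`, which is what `cancel` permits.
  module Family (X : Carrier) (cancel : ∀ k {x y} → (1# - X ^ suc k) * x ≈ (1# - X ^ suc k) * y → x ≈ y)
    (Φ : ℕ → Carrier) (cyclotomic : ∀ n → divProd Φ (suc n) (suc n) ≈ X ^ suc n - 1#) where

    divProd-top : ∀ n → 1# - X ^ suc n ≈ - (divProd Φ (suc n) n * Φ (suc n))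
    divProd-top n = begin
      1# - X ^ suc n                          ≈⟨ solve 1 (λ x → I :- x := :- (x :- I)) refl (X ^ suc n) ⟩
      - (X ^ suc n - 1#)                      ≈⟨ -‿cong (cyclotomic n) ⟨
      - divProd Φ (suc n) (suc n)             ≡⟨ ≡.cong -_ (divProd-∣ Φ {suc n} {n} ∣-refl) ⟩
      - (divProd Φ (suc n) n * Φ (suc n))     ∎

    Φ∣ : ∀ e → ∃ λ K → 1# - X ^ suc e ≈ Φ (suc e) * K
    Φ∣ e = - divProd Φ (suc e) e ,
      trans (divProd-top e) (solve 2 (λ a b → :- (a :* b) := b :* (:- a)) refl (divProd Φ (suc e) e) (Φ (suc e)))

    -- The divisors of the smaller index are divisors of the larger one and lie below it. Hence the
    -- product for the larger index contains the whole product for the smaller one and, in addition,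
    -- its own top factor.
    Φ∣-proper : ∀ {g e} → suc g ∣ suc e → suc g < suc e → ∃ λ K → 1# - X ^ suc e ≈ (1# - X ^ suc g) * (Φ (suc e) * K)
    Φ∣-proper {g} {e} g∣e (s≤s g<e) = K , (begin
      1# - X ^ suc e                                     ≈⟨ divProd-top e ⟩
      - (divProd Φ (suc e) e * Φ (suc e))                ≈⟨ -‿cong (*-congʳ (proj₂ (divProd-divides Φ g∣e e))) ⟩
      - (divProd Φ (suc g) e * K * Φ (suc e))            ≡⟨ ≡.cong (λ z → - (z * K * Φ (suc e))) stable ⟩
      - (divProd Φ (suc g) (suc g) * K * Φ (suc e))      ≈⟨ -‿cong (*-congʳ (*-congʳ (cyclotomic g))) ⟩
      - ((X ^ suc g - 1#) * K * Φ (suc e))               ≈⟨ solve 3 (λ x K b → :- ((x :- I) :* K :* b) := (I :- x) :* (b :* K)) refl (X ^ suc g) K (Φ (suc e)) ⟩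
      (1# - X ^ suc g) * (Φ (suc e) * K)                 ∎)
      where
      K = proj₁ (divProd-divides Φ g∣e e)
      stable : divProd Φ (suc g) e ≡ divProd Φ (suc g) (suc g)
      stable = ≡.trans (≡.cong (divProd Φ (suc g)) (≡.sym (ℕ.m+[n∸m]≡n g<e)))
        (divProd-stable Φ g (e ℕ.∸ suc g))

    -- Since Φ divides 1 - y for y = `X ^ suc e`, the sum is congruent to its number of terms, a
    -- nonzero integer.
    geometric-⟂ : ∀ e i → Σ (suc i) ((X ^ suc e) ^_) ⟂ Φ (suc e)
    geometric-⟂ e i = ⟂-mod (K * Z)
      (trans (proj₂ (geometric-mod (X ^ suc e) (suc i))) (+-congˡ (trans (*-congʳ (proj₂ (Φ∣ e))) (*-assoc (Φ (suc e)) K Z))))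
      (const-⟂ i λ ())
      where
      Z = proj₁ (geometric-mod (X ^ suc e) (suc i))
      K = proj₁ (Φ∣ e)

    -- Bézout's identity in the exponents. With natural coefficients it reads g + y e = x j, so X^g
    -- X^(y e) is a power of X^j.
    combine : ∀ j e x y g → g ℕ.+ y ℕ.* e ≡ x ℕ.* j →
      ∃ λ A → ∃ λ B → 1# - X ^ g ≈ A * (1# - X ^ j) + B * (1# - X ^ e)
    combine j e x y g eq = A , - (X ^ g * B) , (begin
      1# - X ^ g
        ≈⟨ solve 2 (λ u v → I :- u := I :- u :* v :- u :* (I :- v)) refl (X ^ g) (X ^ (y ℕ.* e)) ⟩
      1# - X ^ g * X ^ (y ℕ.* e) - X ^ g * (1# - X ^ (y ℕ.* e))
        ≈⟨ +-cong (+-congˡ (-‿cong (trans (sym (^-homo-* X g (y ℕ.* e))) (trans (reflexive (≡.cong (X ^_) eq)) (power j x)))))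
             (-‿cong (*-congˡ (+-congˡ (-‿cong (power e y))))) ⟩
      1# - (X ^ j) ^ x - X ^ g * (1# - (X ^ e) ^ y)
        ≈⟨ +-cong (proj₂ (1-^-divisible (X ^ j) x)) (-‿cong (*-congˡ (proj₂ (1-^-divisible (X ^ e) y)))) ⟩
      (1# - X ^ j) * A - X ^ g * ((1# - X ^ e) * B)
        ≈⟨ solve 5 (λ u A g v B → u :* A :- g :* (v :* B) := A :* u :+ (:- (g :* B)) :* v) refl (1# - X ^ j) A (X ^ g) (1# - X ^ e) B ⟩
      A * (1# - X ^ j) + - (X ^ g * B) * (1# - X ^ e) ∎)
      where
      A = proj₁ (1-^-divisible (X ^ j) x)
      B = proj₁ (1-^-divisible (X ^ e) y)
      power : ∀ j x → X ^ (x ℕ.* j) ≈ (X ^ j) ^ x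
      power j x = trans (reflexive (≡.cong (X ^_) (ℕ.*-comm x j))) (sym (^-assocʳ X j x))

    bezout : ∀ {g} j e → Bézout.Identity g j e → ∃ λ A → ∃ λ B → 1# - X ^ g ≈ A * (1# - X ^ j) + B * (1# - X ^ e)
    bezout {g} j e (Bézout.+- x y eq) = combine j e x y g eq
    bezout {g} j e (Bézout.-+ x y eq) = swap (combine e j y x g eq)
      where
      swap : (∃ λ B → ∃ λ A → 1# - X ^ g ≈ B * (1# - X ^ e) + A * (1# - X ^ j)) →
        ∃ λ A → ∃ λ B → 1# - X ^ g ≈ A * (1# - X ^ j) + B * (1# - X ^ e)
      swap (B , A , eq′) = A , B , trans eq′ (+-comm _ _)

    -- For the gcd g of j and the index of Φ, 1 - X^g lies in the ideal of 1 - X^j and Φ by Bézout.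
    -- Since g is a proper divisor of the index, Φ divides the quotient of the two differences, a
    -- geometric sum congruent to the number of its terms modulo 1 - X^g. That number is the
    -- required integer.
    1-X^-⟂ : ∀ j e → ¬ suc e ∣ j → 1# - X ^ j ⟂ Φ (suc e)
    1-X^-⟂ j e e∤j = go (gcd j (suc e)) (gcd[m,n]∣m j (suc e)) (gcd[m,n]∣n j (suc e)) (bezout j (suc e) (Bézout.identity (gcd-GCD j (suc e))))
      where
      φ = Φ (suc e)
      go : ∀ g → g ∣ j → g ∣ suc e → (∃ λ A → ∃ λ B → 1# - X ^ g ≈ A * (1# - X ^ j) + B * (1# - X ^ suc e)) →
        1# - X ^ j ⟂ φ
      go zero    _   (divides i e≡) _ = contradiction (≡.trans e≡ (ℕ.*-zeroʳ i)) λ ()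
      go (suc g) g∣j (divides zero ()) _
      go (suc g) g∣j g∣e@(divides (suc i) e≡) (A , B , b) =
        - (Z * A) , K - Z * (B * ((1# - y) * K)) , + suc i , (λ ()) , (begin
          - (Z * A) * (1# - X ^ j) + (K - Z * (B * ((1# - y) * K))) * φ
            ≈⟨ solve 7 (λ Z A u K B v φ → (:- (Z :* A)) :* u :+ (K :- Z :* (B :* (v :* K))) :* φ := φ :* K :- (A :* u :+ B :* (v :* (φ :* K))) :* Z) refl
                 Z A (1# - X ^ j) K B (1# - y) φ ⟩
          φ * K - (A * (1# - X ^ j) + B * ((1# - y) * (φ * K))) * Z
            ≈⟨ +-congˡ (-‿cong (*-congʳ (sym (trans b (+-congˡ (*-congˡ k)))))) ⟩
          φ * K - (1# - y) * Z
            ≈⟨ +-congʳ (trans (sym quotient) (proj₂ (geometric-mod y (suc i)))) ⟩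
          fromℤ (+ suc i) + (1# - y) * Z - (1# - y) * Z
            ≈⟨ solve 2 (λ c w → c :+ w :- w := c) refl (fromℤ (+ suc i)) ((1# - y) * Z) ⟩
          fromℤ (+ suc i) ∎)
        where
        y = X ^ suc g
        proper : suc g < suc e
        proper = ℕ.≤∧≢⇒< (∣⇒≤ g∣e) λ { ≡.refl → e∤j g∣j }
        K = proj₁ (Φ∣-proper g∣e proper)
        k = proj₂ (Φ∣-proper g∣e proper)
        Z = proj₁ (geometric-mod y (suc i))
        quotient : Σ (suc i) (y ^_) ≈ φ * K
        quotient = cancel g (trans (geometric y (suc i)) (trans
          (+-congˡ (-‿cong (trans (^-assocʳ X (suc g) (suc i)) (reflexive (≡.cong (X ^_) (≡.trans (ℕ.*-comm (suc g) (suc i)) (≡.sym e≡)))))))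
          k))

    Φ-⟂ : ∀ {a b} → a < b → Φ (suc a) ⟂ Φ (suc b)
    Φ-⟂ {a} {b} a<b = ⟂-factorˡ (Φ (suc a)) (proj₁ (Φ∣ a)) (⟂-resp (proj₂ (Φ∣ a)) refl (1-X^-⟂ (suc a) b λ d → ℕ.<⇒≱ (s≤s a<b) (∣⇒≤ d)))

    -- The product of Φ d over the divisors 1 < d ≤ k + 1 of n.
    divProd₊ : ℕ → ℕ → Carrier
    divProd₊ n zero    = 1#
    divProd₊ n (suc k) with suc (suc k) ∣? n
    ... | yes _ = divProd₊ n k * Φ (suc (suc k))
    ... | no _  = divProd₊ n k

    divProd₊-suc : ∀ n k → (suc (suc k) ∣ n × divProd₊ n (suc k) ≡ divProd₊ n k * Φ (suc (suc k))) ⊎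
      divProd₊ n (suc k) ≡ divProd₊ n k
    divProd₊-suc n k with suc (suc k) ∣? n
    ... | yes d∣n = inj₁ (d∣n , ≡.refl)
    ... | no _    = inj₂ ≡.refl

    divProd₊-≈ : ∀ n k → divProd Φ (suc n) (suc k) ≈ Φ 1 * divProd₊ (suc n) k
    divProd₊-≈ n zero    = trans (reflexive (divProd-∣ Φ {suc n} {0} (divides (suc n) (≡.sym (ℕ.*-identityʳ (suc n))))))
      (*-comm _ _)
    divProd₊-≈ n (suc k) with suc (suc k) ∣? suc n | divProd₊-≈ n k
    ... | yes _ | e = trans (*-congʳ e) (*-assoc _ _ _)
    ... | no _  | e = e

    -- The left side is the q-integer. Dividing 1 - X^N by 1 - X removes exactly the factor for the
    -- divisor 1; the top factor is kept apart, since it also occurs in the cube of the modulus.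
    divProd₊-factor : ∀ n → Σ (suc (suc n)) (X ^_) ≈ divProd₊ (suc (suc n)) n * Φ (suc (suc n))
    divProd₊-factor n = cancel 0 (begin
      (1# - X ^ 1) * Σ N (X ^_)                        ≈⟨ *-congʳ (+-congˡ (-‿cong (*-identityʳ X))) ⟩
      (1# - X) * Σ N (X ^_)                            ≈⟨ geometric X N ⟩
      1# - X ^ N                                       ≈⟨ divProd-top (suc n) ⟩
      - (divProd Φ N (suc n) * Φ N)                    ≈⟨ -‿cong (*-congʳ (divProd₊-≈ (suc n) n)) ⟩
      - (Φ 1 * divProd₊ N n * Φ N)                     ≈⟨ solve 3 (λ a b c → :- (a :* b :* c) := (:- (I :* a)) :* (b :* c)) refl (Φ 1) (divProd₊ N n) (Φ N) ⟩
      - (1# * Φ 1) * (divProd₊ N n * Φ N)              ≈⟨ *-congʳ (divProd-top 0) ⟨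
      (1# - X ^ 1) * (divProd₊ N n * Φ N)              ∎)
      where N = suc (suc n)

    divProd₊-⟂ : ∀ n {j} k → k < j → Φ (suc j) ⟂ divProd₊ n k
    divProd₊-⟂ n zero    _   = ⟂-sym (1⟂ _)
    divProd₊-⟂ n (suc k) k<j with suc (suc k) ∣? n
    ... | yes _ = ⟂-*ʳ (divProd₊-⟂ n k (ℕ.<-trans ℕ.≤-refl k<j)) (⟂-sym (Φ-⟂ k<j))
    ... | no _  = divProd₊-⟂ n k (ℕ.<-trans ℕ.≤-refl k<j)

-- prodDiv is defined through a local function that cannot be named from outside; unification recovers it as
-- divProdP, once `suc d` and _*P_ have been generalised so that the equation to solve is a pattern.
mutual
  divProdP : (ℕ → Poly) → ℕ → ℕ → Poly
  divProdP = _

  prodDiv-suc : ∀ f d → prodDiv f (suc d) ≡ divProdP f (suc d) d *P f (suc d)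
  prodDiv-suc f d with suc d ℕ.∣? suc d
  ... | no ∤    = contradiction ℕ.∣-refl ∤
  ... | yes _ with suc d | _*P_
  ...   | _ | _ = ≡.refl

divProdP-≡ : ∀ f n k → divProdP f n k ≡ Cyclotomic.divProd polyRing f n k
divProdP-≡ f n zero    = ≡.refl
divProdP-≡ f n (suc k) with suc k ℕ.∣? n
... | yes _ = ≡.cong (_*P f (suc k)) (divProdP-≡ f n k)
... | no _  = divProdP-≡ f n k

prodDiv-≡ : ∀ f n → prodDiv f n ≡ Cyclotomic.divProd polyRing f n n
prodDiv-≡ f n = divProdP-≡ f n n

-- Polynomials of the statement inside the ring ℤ[q]

X : Poly
X = qpow 1

module ℤ[q] where
  open CommutativeRing polyRing public
  open import Algebra.Properties.Semiring.Exp semiring public using (_^_; ^-assocʳ)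
  open IntegerSolver polyRing public
  open Products polyRing public using (Σ)
  open Cyclotomic polyRing public
  open import Algebra.Properties.Group +-group public using (x∙y⁻¹≈ε⇒x≈y; x≈y⇒x∙y⁻¹≈ε)

shift-≋ : ∀ p → 0ℤ ∷ p ≋ X *P p
shift-≋ p = mk≋ λ i → ≡.sym (≡.trans (coeff-+ (scaleP 0ℤ p) (0ℤ ∷ (oneP *P p)) i) (≡.trans
  (≡.cong₂ ℤ._+_ (coeff-scale 0ℤ p i) (tail i)) (ℤ.+-identityˡ _)))
  where
  tail : ∀ i → coeff (0ℤ ∷ (oneP *P p)) i ≡ coeff (0ℤ ∷ p) i
  tail zero    = ≡.refl
  tail (suc i) = coeff-≡ (ℤ[q].*-identityˡ p) i

qpow-≋ : ∀ k → qpow k ≋ X ℤ[q].^ k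
qpow-≋ zero    = ℤ[q].refl
qpow-≋ (suc k) = ℤ[q].trans (shift-≋ (qpow k)) (ℤ[q].*-congˡ {X} (qpow-≋ k))

^P-≡ : ∀ p k → p ^P k ≡ p ℤ[q].^ k
^P-≡ p zero    = ≡.refl
^P-≡ p (suc k) = ≡.cong (p *P_) (^P-≡ p k)

qint-≋ : ∀ r → qint r ≋ ℤ[q].Σ r (X ℤ[q].^_)
qint-≋ zero    = ℤ[q].refl
qint-≋ (suc r) = ℤ[q].+-cong (qint-≋ r) (qpow-≋ r)

nonZero-1-X^ : ∀ k → NonZeroP (oneP -P X ℤ[q].^ suc k)
nonZero-1-X^ k = here λ e → 1≢0 (≡.trans (≡.sym coeff₀) e)
  where
  1≢0 : 1ℤ ≢ 0ℤ
  1≢0 ()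
  coeff₀ : coeff (oneP -P X ℤ[q].^ suc k) 0 ≡ 1ℤ
  coeff₀ = ≡.trans (coeff-+ oneP (negP (X ℤ[q].^ suc k)) 0) (≡.cong (λ z → 1ℤ ℤ.+ z)
    (≡.trans (coeff-neg (X ℤ[q].^ suc k) 0) (≡.cong ℤ.-_ (≡.sym (coeff-≡ (shift-≋ (X ℤ[q].^ k)) 0)))))

cancelP : ∀ {c x y} → NonZeroP c → c *P x ≋ c *P y → x ≋ y
cancelP {c} {x} {y} nz e = ℤ[q].x∙y⁻¹≈ε⇒x≈y x y (nonZeroP-cancel {c} (x -P y) nz (ℤ[q].trans
  (ℤ[q].solve 3 (λ c x y → c ℤ[q].:* (x ℤ[q].:- y) ℤ[q].:= c ℤ[q].:* x ℤ[q].:- c ℤ[q].:* y) ℤ[q].refl c x y)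
  (ℤ[q].x≈y⇒x∙y⁻¹≈ε {c *P x} {c *P y} e)))

fromℕ-≋ : ∀ n → ℤ[q].fromℤ (+ n) ≋ constP (+ n)
fromℕ-≋ zero    = mk≋ λ { zero → ≡.refl ; (suc i) → ≡.refl }
fromℕ-≋ (suc n) = ℤ[q].trans (ℤ[q].fromℤ-+ (+ 1) (+ n)) (ℤ[q].+-congˡ {oneP} (fromℕ-≋ n))

fromℤ-≋ : ∀ c → ℤ[q].fromℤ c ≋ constP c
fromℤ-≋ (+ n)    = fromℕ-≋ n
fromℤ-≋ -[1+ n ] = ℤ[q].-‿cong (fromℕ-≋ (suc n))

⟂⇒CoprimeP : ∀ {D P} → D ℤ[q].⟂ P → CoprimeP D P
⟂⇒CoprimeP (U , V , c , c≢0 , e) = U , V , c , c≢0 , coeff-≡ (ℤ[q].trans e (fromℤ-≋ c))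

cyclotomic-≋ : ∀ {Φ} → IsCyclotomic Φ → ∀ n → ℤ[q].divProd Φ (suc n) (suc n) ≋ X ℤ[q].^ suc n -P oneP
cyclotomic-≋ {Φ} cyclotomic n = ℤ[q].trans (ℤ[q].reflexive (≡.sym (prodDiv-≡ Φ (suc n))))
  (ℤ[q].trans (mk≋ (cyclotomic (suc n) (s≤s z≤n))) (ℤ[q].+-congʳ {negP oneP} (qpow-≋ (suc n))))

-- Divisibility in a subring and differences over a cube

open import Data.Vec using (head; tail)

record IsSubring (F : CommutativeRing 0ℓ 0ℓ) (Int : CommutativeRing.Carrier F → Set) : Set where
  open CommutativeRing F
  field
    int-resp : ∀ {x y} → x ≈ y → Int x → Int y
    int-0    : Int 0#
    int-1    : Int 1#
    int-+    : ∀ {x y} → Int x → Int y → Int (x + y)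
    int-*    : ∀ {x y} → Int x → Int y → Int (x * y)
    int-neg  : ∀ {x} → Int x → Int (- x)

module Integrality (F : CommutativeRing 0ℓ 0ℓ) (reciprocal : Reciprocal F)
  (Int : CommutativeRing.Carrier F → Set) (isSubring : IsSubring F Int) where
  open CommutativeRing F
  open Reciprocal reciprocal
  open IsSubring isSubring public
  open Units F
  open Products F
  open Hypergeometric F reciprocal
  open IntegerSolver F
  open import Relation.Binary.Reasoning.Setoid setoid
  open import Algebra.Properties.Semiring.Exp semiring using (_^_)

  int-minus : ∀ {x y} → Int x → Int y → Int (x - y)
  int-minus ix iy = int-+ ix (int-neg iy)

  int-^ : ∀ {x} k → Int x → Int (x ^ k)
  int-^ zero    ix = int-1
  int-^ (suc k) ix = int-* ix (int-^ k ix)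

  int-Σ : ∀ n {f} → (∀ k → k < n → Int (f k)) → Int (Σ n f)
  int-Σ zero    h = int-0
  int-Σ (suc n) h = int-+ (int-Σ n λ k k<n → h k (ℕ.m<n⇒m<1+n k<n)) (h n ℕ.≤-refl)

  int-Π : ∀ n {f} → (∀ k → k < n → Int (f k)) → Int (Π n f)
  int-Π zero    h = int-1
  int-Π (suc n) h = int-* (int-Π n λ k k<n → h k (ℕ.m<n⇒m<1+n k<n)) (h n ℕ.≤-refl)

  -- Invertible within the subring, whereas `Unit` means invertible in the ambient ring.
  IntUnit : Carrier → Set
  IntUnit x = Int x × ∃ λ y → Int y × x * y ≈ 1#

  intUnit⇒unit : ∀ {x} → IntUnit x → Unit x
  intUnit⇒unit (_ , y , _ , e) = y , e

  intUnit-1 : IntUnit 1#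
  intUnit-1 = int-1 , 1# , int-1 , *-identityˡ 1#

  intUnit-* : ∀ {x y} → IntUnit x → IntUnit y → IntUnit (x * y)
  intUnit-* {x} {y} (ix , u , iu , e) (iy , v , iv , e′) =
    int-* ix iy , u * v , int-* iu iv , proj₂ (unit-* {x} {y} (u , e) (v , e′))

  intUnit-resp : ∀ {x y} → x ≈ y → IntUnit x → IntUnit y
  intUnit-resp e (ix , u , iu , e′) = int-resp e ix , u , iu , trans (*-congʳ (sym e)) e′

  intUnit-Π : ∀ n {f} → (∀ k → k < n → IntUnit (f k)) → IntUnit (Π n f)
  intUnit-Π zero    h = intUnit-1
  intUnit-Π (suc n) h = intUnit-* (intUnit-Π n λ k k<n → h k (ℕ.m<n⇒m<1+n k<n)) (h n ℕ.≤-refl)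

  int-recip : ∀ {x} → IntUnit x → Int (recip x)
  int-recip {x} u@(_ , y , iy , e) = int-resp
    (unit-cancel (intUnit⇒unit u) (trans e (sym (recip-inverse (intUnit⇒unit u))))) iy

  infix 4 _∣_
  _∣_ : Carrier → Carrier → Set
  d ∣ x = ∃ λ y → Int y × x ≈ d * y

  ∣-resp : ∀ {d x y} → x ≈ y → d ∣ x → d ∣ y
  ∣-resp e (z , iz , e′) = z , iz , trans (sym e) e′

  ∣-resp-divisor : ∀ {d d′ x} → d ≈ d′ → d ∣ x → d′ ∣ x
  ∣-resp-divisor e (z , iz , e′) = z , iz , trans e′ (*-congʳ e)

  int⇒1∣ : ∀ {x} → Int x → 1# ∣ x
  int⇒1∣ ix = _ , ix , sym (*-identityˡ _)

  ∣-0 : ∀ {d} → d ∣ 0#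
  ∣-0 = 0# , int-0 , sym (zeroʳ _)

  ∣-+ : ∀ {d x y} → d ∣ x → d ∣ y → d ∣ x + y
  ∣-+ (u , iu , e) (v , iv , e′) = u + v , int-+ iu iv , trans (+-cong e e′) (sym (distribˡ _ _ _))

  ∣-neg : ∀ {d x} → d ∣ x → d ∣ - x
  ∣-neg (u , iu , e) = - u , int-neg iu , trans (-‿cong e) (solve 2 (λ d u → :- (d :* u) := d :* (:- u)) refl _ u)

  ∣-minus : ∀ {d x y} → d ∣ x → d ∣ y → d ∣ x - y
  ∣-minus dx dy = ∣-+ dx (∣-neg dy)

  ∣-* : ∀ {d d′ x y} → d ∣ x → d′ ∣ y → d * d′ ∣ x * y
  ∣-* (u , iu , e) (v , iv , e′) = u * v , int-* iu iv , trans (*-cong e e′)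
    (solve 4 (λ d d′ u v → d :* u :* (d′ :* v) := d :* d′ :* (u :* v)) refl _ _ u v)

  ∣-*ʳ : ∀ {d x y} → d ∣ x → Int y → d ∣ x * y
  ∣-*ʳ (u , iu , e) iy = u * _ , int-* iu iy , trans (*-congʳ e) (*-assoc _ _ _)

  ∣-*ˡ : ∀ {d x y} → Int x → d ∣ y → d ∣ x * y
  ∣-*ˡ ix dy = ∣-resp (*-comm _ _) (∣-*ʳ dy ix)

  ∣⇒int : ∀ {d x} → Int d → d ∣ x → Int x
  ∣⇒int id (u , iu , e) = int-resp (sym e) (int-* id iu)

  ∣-Σ : ∀ n {d f} → (∀ k → k < n → d ∣ f k) → d ∣ Σ n f
  ∣-Σ zero    h = ∣-0
  ∣-Σ (suc n) h = ∣-+ (∣-Σ n λ k k<n → h k (ℕ.m<n⇒m<1+n k<n)) (h n ℕ.≤-refl)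

  ∣-Π : ∀ n {d f} → (∀ k → k < n → Int (f k)) → ∀ j → j < n → d ∣ f j → d ∣ Π n f
  ∣-Π (suc n) h j (s≤s j≤n) dj with ℕ.m≤n⇒m<n∨m≡n j≤n
  ... | inj₁ j<n    = ∣-*ʳ (∣-Π n (λ k k<n → h k (ℕ.m<n⇒m<1+n k<n)) j j<n dj) (h n ℕ.≤-refl)
  ... | inj₂ ≡.refl = ∣-*ˡ (int-Π n λ k k<n → h k (ℕ.m<n⇒m<1+n k<n)) dj

  ∣-cancel : ∀ {d u x} → IntUnit u → d ∣ u * x → d ∣ x
  ∣-cancel {d} {u} {x} (iu , v , iv , e) dux = ∣-resp (begin
    v * (u * x)   ≈⟨ solve 3 (λ v u x → v :* (u :* x) := u :* v :* x) refl v u x ⟩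
    u * v * x     ≈⟨ *-congʳ e ⟩
    1# * x        ≈⟨ *-identityˡ x ⟩
    x             ∎) (∣-*ˡ iv dux)

  -- Good cs f: every mixed difference of the function f on the cube is divisible by the product of the
  -- corresponding moduli.
  Good : ∀ {r} → Vec Carrier r → (Vec Bool r → Carrier) → Set
  Good []       f = Int (f [])
  Good (c ∷ cs) f = Good cs (f ∘ (false ∷_)) ×
    ∃ λ g → Good cs g × (∀ v → f (true ∷ v) ≈ f (false ∷ v) + c * g v)

  AllInt : ∀ {r} → Vec Carrier r → Set
  AllInt []       = ⊤
  AllInt (c ∷ cs) = Int c × AllInt cs

  good-resp : ∀ {r} (cs : Vec Carrier r) {f g} → (∀ v → f v ≈ g v) → Good cs f → Good cs g
  good-resp []       e i = int-resp (e []) i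
  good-resp (c ∷ cs) e (f₀ , h , gh , eq) = good-resp cs (e ∘ (false ∷_)) f₀ , h , gh ,
    λ v → trans (sym (e _)) (trans (eq v) (+-congʳ (e _)))

  good-const : ∀ {r} (cs : Vec Carrier r) {x} → Int x → Good cs (λ _ → x)
  good-const []       ix = ix
  good-const (c ∷ cs) ix = good-const cs ix , (λ _ → 0#) , good-const cs int-0 ,
    λ v → sym (trans (+-congˡ (zeroʳ c)) (+-identityʳ _))

  good-+ : ∀ {r} (cs : Vec Carrier r) {f g} → Good cs f → Good cs g → Good cs (λ v → f v + g v)
  good-+ []       i j = int-+ i j
  good-+ (c ∷ cs) (f₀ , f′ , gf , ef) (g₀ , g′ , gg , eg) = good-+ cs f₀ g₀ , (λ v → f′ v + g′ v) , good-+ cs gf gg ,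
    λ v → trans (+-cong (ef v) (eg v))
      (solve 5 (λ a c b a′ b′ → a :+ c :* b :+ (a′ :+ c :* b′) := a :+ a′ :+ c :* (b :+ b′)) refl _ c (f′ v) _ (g′ v))

  good-neg : ∀ {r} (cs : Vec Carrier r) {f} → Good cs f → Good cs (λ v → - f v)
  good-neg []       i = int-neg i
  good-neg (c ∷ cs) (f₀ , f′ , gf , ef) = good-neg cs f₀ , (λ v → - f′ v) , good-neg cs gf ,
    λ v → trans (-‿cong (ef v)) (solve 3 (λ a c b → :- (a :+ c :* b) := :- a :+ c :* (:- b)) refl _ c (f′ v))

  good-minus : ∀ {r} (cs : Vec Carrier r) {f g} → Good cs f → Good cs g → Good cs (λ v → f v - g v)
  good-minus cs gf gg = good-+ cs gf (good-neg cs gg)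

  mutual
    good-true : ∀ {r c} (cs : Vec Carrier r) {f} → AllInt (c ∷ cs) → Good (c ∷ cs) f → Good cs (f ∘ (true ∷_))
    good-true cs (ic , ics) (f₀ , f′ , gf , ef) =
      good-resp cs (λ v → sym (ef v)) (good-+ cs f₀ (good-* cs ics (good-const cs ic) gf))

    -- The product rule f₁ g₁ - f₀ g₀ = (f₁ - f₀) g₁ + f₀ (g₁ - g₀) in the first coordinate. It
    -- involves g on the face `true`, which is good because the modulus is integral.
    good-* : ∀ {r} (cs : Vec Carrier r) {f g} → AllInt cs → Good cs f → Good cs g → Good cs (λ v → f v * g v)
    good-* []       _   i j = int-* i j
    good-* (c ∷ cs) {f} {g} ics@(_ , ics′) gf@(f₀ , f′ , gf′ , ef) gg@(g₀ , g′ , gg′ , eg) =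
      good-* cs ics′ f₀ g₀ ,
      (λ v → f′ v * g (true ∷ v) + f (false ∷ v) * g′ v) ,
      good-+ cs (good-* cs ics′ gf′ (good-true cs {g} ics gg)) (good-* cs ics′ f₀ gg′) ,
      λ v → begin
        f (true ∷ v) * g (true ∷ v)
          ≈⟨ *-congʳ (ef v) ⟩
        (f (false ∷ v) + c * f′ v) * g (true ∷ v)
          ≈⟨ distribʳ _ _ _ ⟩
        f (false ∷ v) * g (true ∷ v) + c * f′ v * g (true ∷ v)
          ≈⟨ +-congʳ (*-congˡ (eg v)) ⟩
        f (false ∷ v) * (g (false ∷ v) + c * g′ v) + c * f′ v * g (true ∷ v)
          ≈⟨ solve 6 (λ a b c b′ a′ d → a :* (b :+ c :* b′) :+ c :* a′ :* d := a :* b :+ c :* (a′ :* d :+ a :* b′)) refl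
               (f (false ∷ v)) (g (false ∷ v)) c (g′ v) (f′ v) (g (true ∷ v)) ⟩
        f (false ∷ v) * g (false ∷ v) + c * (f′ v * g (true ∷ v) + f (false ∷ v) * g′ v) ∎

  -- From 1 / b - 1 / a = - (b - a) / (a b): the difference of the inverses is an integral multiple
  -- of the difference of f, so every modulus survives.
  good-inverse : ∀ {r} (cs : Vec Carrier r) {f g} → AllInt cs → Good cs f →
    (∀ v → f v * g v ≈ 1#) → (∀ v → Int (g v)) → Good cs g
  good-inverse []       _   gf e ig = ig []
  good-inverse (c ∷ cs) {f} {g} ics@(_ , ics′) gf@(f₀ , f′ , gf′ , ef) e ig =
    g₀ , (λ v → - (f′ v * (g (false ∷ v) * g (true ∷ v)))) ,
    good-neg cs (good-* cs ics′ gf′ (good-* cs ics′ g₀ g₁)) ,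
    λ v → let a = f (false ∷ v) ; b = f (true ∷ v) ; x = g (false ∷ v) ; y = g (true ∷ v) in begin
      y                                     ≈⟨ solve 2 (λ x y → y := x :+ con (+ 1) :* y :- x :* con (+ 1)) refl x y ⟩
      x + 1# * y - x * 1#                   ≈⟨ +-cong (+-congˡ (*-congʳ (e (false ∷ v)))) (-‿cong (*-congˡ (e (true ∷ v)))) ⟨
      x + a * x * y - x * (b * y)           ≈⟨ +-congˡ (-‿cong (*-congˡ (*-congʳ (ef v)))) ⟩
      x + a * x * y - x * ((a + c * f′ v) * y)
        ≈⟨ solve 5 (λ x a y c d → x :+ a :* x :* y :- x :* ((a :+ c :* d) :* y) := x :+ c :* (:- (d :* (x :* y)))) refl x a y c (f′ v) ⟩
      x + c * - (f′ v * (x * y))            ∎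
    where
    g₀ = good-inverse cs ics′ f₀ (e ∘ (false ∷_)) (ig ∘ (false ∷_))
    g₁ = good-inverse cs ics′ (good-true cs {f} ics gf) (e ∘ (true ∷_)) (ig ∘ (true ∷_))

  choose : Carrier → Carrier → Bool → Carrier
  choose x y false = x
  choose x y true  = y

  good-head : ∀ {r} c (cs : Vec Carrier r) x y → Int x → c ∣ y - x → Good (c ∷ cs) (λ v → choose x y (head v))
  good-head c cs x y ix (z , iz , e) = good-const cs ix , (λ _ → z) , good-const cs iz ,
    λ _ → trans (solve 2 (λ x y → y := x :+ (y :- x)) refl x y) (+-congˡ e)

  good-tail : ∀ {r} c (cs : Vec Carrier r) {f} → Good cs f → Good (c ∷ cs) (λ v → f (tail v))
  good-tail c cs gf = gf , (λ _ → 0#) , good-const cs int-0 , λ v → sym (trans (+-congˡ (zeroʳ c)) (+-identityʳ _))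

  good-hyper : ∀ {r} (cs : Vec Carrier r) → AllInt cs → (N D : Vec Bool r → ℕ → Carrier) → ∀ K →
    (∀ k → k < K → Good cs (λ v → N v k)) → (∀ k → k < K → Good cs (λ v → D v k)) →
    (∀ k → k < K → ∀ v → IntUnit (D v k)) → Good cs (λ v → hyper (N v) (D v) K)
  good-hyper cs ics N D zero    gN gD u = good-const cs int-1
  good-hyper cs ics N D (suc K) gN gD u = good-* cs ics
    (good-hyper cs ics N D K (λ k k<K → gN k (ℕ.m<n⇒m<1+n k<K)) (λ k k<K → gD k (ℕ.m<n⇒m<1+n k<K)) (λ k k<K → u k (ℕ.m<n⇒m<1+n k<K)))
    (good-* cs ics (gN K ℕ.≤-refl) (good-inverse cs ics (gD K ℕ.≤-refl)
      (λ v → recip-inverse (intUnit⇒unit (u K ℕ.≤-refl v))) (λ v → int-recip (u K ℕ.≤-refl v))))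

  good-Σ : ∀ {r} (cs : Vec Carrier r) (f : Vec Bool r → ℕ → Carrier) → ∀ K →
    (∀ k → k < K → Good cs (λ v → f v k)) → Good cs (λ v → Σ K (f v))
  good-Σ cs f zero    h = good-const cs int-0
  good-Σ cs f (suc K) h = good-+ cs (good-Σ cs f K λ k k<K → h k (ℕ.m<n⇒m<1+n k<K)) (h K ℕ.≤-refl)

  module _ (p : Carrier) (unit-p : Unit p) (int-p : Int p) {r} (cs : Vec Carrier r) (ics : AllInt cs) where
    open Base p unit-p

    private
      infixl 6 _⊞_ _⊟_
      infixl 7 _⊠_
      _⊞_ : ∀ {f g} → Good cs f → Good cs g → Good cs (λ v → f v + g v)
      _⊞_ = good-+ cs
      _⊟_ : ∀ {f g} → Good cs f → Good cs g → Good cs (λ v → f v - g v)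
      _⊟_ = good-minus cs
      _⊠_ : ∀ {f g} → Good cs f → Good cs g → Good cs (λ v → f v * g v)
      _⊠_ = good-* cs ics
      𝟏 : Good cs (λ _ → 1#)
      𝟏 = good-const cs int-1
      P : Good cs (λ _ → p)
      P = good-const cs int-p

    module _ {a σ δ x : Vec Bool r → Carrier}
      (ga : Good cs a) (gσ : Good cs σ) (gδ : Good cs δ) (gx : Good cs x) where

      good-cube : Good cs (λ v → cube (a v) (x v))
      good-cube = 𝟏 ⊟ ga ⊠ (gx ⊠ gx ⊠ gx)

      good-N : Good cs (λ v → N (a v) (σ v) (δ v) (x v))
      good-N = (𝟏 ⊟ ga ⊠ gx) ⊠ (𝟏 ⊟ gσ ⊠ gx ⊞ P ⊠ (gx ⊠ gx)) ⊠ (P ⊠ ga ⊠ gx) ⊠ (gδ ⊟ gx ⊠ gx)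

      good-D : Good cs (λ v → D (a v) (σ v) (δ v) (x v))
      good-D = (𝟏 ⊟ P ⊠ P ⊠ (gx ⊠ gx)) ⊠
        (𝟏 ⊟ ga ⊠ gσ ⊠ P ⊠ (gx ⊠ gx) ⊞ ga ⊠ ga ⊠ (P ⊠ P ⊠ P) ⊠ (gx ⊠ gx ⊠ (gx ⊠ gx))) ⊠ (𝟏 ⊟ ga ⊠ gδ ⊠ P ⊠ gx)

    -- The argument `x v` may vary over the cube too, as needed to compare a later block of the
    -- series with the first one. The last of the `suc K` terms involves denominators of index below
    -- K only.
    good-sum : (a σ δ : Vec Bool r → Carrier) (x : Vec Bool r → ℕ → Carrier) → ∀ K →
      Good cs a → Good cs σ → Good cs δ → (∀ k → k < suc K → Good cs (λ v → x v k)) →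
      (∀ k → k < K → ∀ v → IntUnit (D (a v) (σ v) (δ v) (x v k))) →
      Good cs (λ v → Σ (suc K) (λ k → cube (a v) (x v k) * hyper (λ j → N (a v) (σ v) (δ v) (x v j)) (λ j → D (a v) (σ v) (δ v) (x v j)) k))
    good-sum a σ δ x K ga gσ gδ gx u = good-Σ cs _ (suc K) λ k k<K →
      good-cube ga gσ gδ (gx k k<K) ⊠ good-hyper cs ics _ _ k
        (λ j j<k → good-N ga gσ gδ (gx j (ℕ.<-trans j<k k<K)))
        (λ j j<k → good-D ga gσ gδ (gx j (ℕ.<-trans j<k k<K)))
        (λ j j<k → u j (ℕ.<-≤-trans j<k (ℕ.≤-pred k<K)))

  int-hyper : ∀ {N D} k → (∀ j → j < k → Int (N j)) → (∀ j → j < k → IntUnit (D j)) → Int (hyper N D k)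
  int-hyper zero    iN uD = int-1
  int-hyper (suc k) iN uD = int-* (int-hyper k (λ j j<k → iN j (ℕ.m<n⇒m<1+n j<k)) (λ j j<k → uD j (ℕ.m<n⇒m<1+n j<k)))
    (int-* (iN k ℕ.≤-refl) (int-recip (uD k ℕ.≤-refl)))

  ∣-hyper : ∀ {d N D} j r → d ∣ hyper N D j → (∀ i → i < r → Int (N (j ℕ.+ i))) →
    (∀ i → i < r → IntUnit (D (j ℕ.+ i))) → d ∣ hyper N D (j ℕ.+ r)
  ∣-hyper {d} {N} {D} j r dj iN uD = ∣-resp (sym (hyper-+ N D j r)) (∣-*ʳ dj (int-hyper r iN uD))

  -- A quotient of products is integral as soon as, over every block of length e, the numerator makes up for
  -- the factor d of the last denominator.
  module Blocks (e : ℕ) (N D : ℕ → Carrier) (d : Carrier) (unit-d : Unit d)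
    (int-N : ∀ k → Int (N k))
    (unit-D : ∀ l r → r < e → IntUnit (D (l ℕ.* suc e ℕ.+ r)))
    (last-D : ∀ l → ∃ λ u → IntUnit u × D (l ℕ.* suc e ℕ.+ e) ≈ d * u)
    (block-N : ∀ l → d ∣ Π (suc e) (λ r → N (l ℕ.* suc e ℕ.+ r))) where

    int-block : ∀ l → Int (hyper (λ r → N (l ℕ.* suc e ℕ.+ r)) (λ r → D (l ℕ.* suc e ℕ.+ r)) (suc e))
    int-block l with last-D l | block-N l
    ... | u , iu , eu | z , iz , ez = ∣⇒int int-1 (∣-cancel (intUnit-* πu iu) (∣-resp (unit-cancel unit-d (begin
      d * z                  ≈⟨ ez ⟨
      Π (suc e) Nˡ           ≈⟨ hyper-Π (suc e) unit ⟨
      h * (Π e Dˡ * Dˡ e)    ≈⟨ *-congˡ (*-congˡ eu) ⟩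
      h * (Π e Dˡ * (d * u)) ≈⟨ solve 4 (λ h π d u → h :* (π :* (d :* u)) := d :* (π :* u :* h)) refl h (Π e Dˡ) d u ⟩
      d * (Π e Dˡ * u * h)   ∎)) (int⇒1∣ iz)))
      where
      Nˡ Dˡ : ℕ → Carrier
      Nˡ r = N (l ℕ.* suc e ℕ.+ r)
      Dˡ r = D (l ℕ.* suc e ℕ.+ r)
      h = hyper Nˡ Dˡ (suc e)
      πu = intUnit-Π e (λ r → unit-D l r)
      unit : ∀ j → j < suc e → Unit (Dˡ j)
      unit j (s≤s j≤e) with ℕ.m≤n⇒m<n∨m≡n j≤e
      ... | inj₁ j<e    = intUnit⇒unit (unit-D l j j<e)
      ... | inj₂ ≡.refl = unit-resp (sym eu) (unit-* unit-d (intUnit⇒unit iu))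

    int-multiple : ∀ l → Int (hyper N D (l ℕ.* suc e))
    int-multiple zero    = int-1
    int-multiple (suc l) = int-resp
      (trans (sym (hyper-+ N D (l ℕ.* suc e) (suc e))) (reflexive (≡.cong (hyper N D) (ℕ.+-comm (l ℕ.* suc e) (suc e)))))
      (int-* (int-multiple l) (int-block l))

    int-at : ∀ l r → r < suc e → Int (hyper N D (l ℕ.* suc e ℕ.+ r))
    int-at l r (s≤s r≤e) = int-resp (sym (hyper-+ N D (l ℕ.* suc e) r)) (int-* (int-multiple l)
      (int-hyper r (λ j _ → int-N _) (λ j j<r → unit-D l j (ℕ.<-≤-trans j<r r≤e))))

-- Exponents: nonvanishing and residues

open +-*-Solver using () renaming
  (solve to solveℤ; _:=_ to _:≡_; _:+_ to _⊕_; _:*_ to _⊗_; _:-_ to _⊝_; :-_ to ⊝_)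

#_ : ∀ {n} → ℕ → +-*-Solver.Polynomial n
# k = +-*-Solver.con (+ k)

-- The factor 1 - q^z is invertible in ℚ(q) as soon as z ≠ 0. Exponents of known sign are treated by
-- positivity, those of variable sign by parity.
positive-≢0 : ∀ c a b {z} → z ≡ + c ℤ.* + a ℤ.+ + suc b → z ≢ 0ℤ
positive-≢0 c a b ≡.refl e with ≡.trans (≡.cong (ℤ._+ + suc b) (ℤ.pos-* c a)) e
... | e′ = ℕ.1+n≢0 (≡.trans (≡.sym (ℕ.+-suc (c ℕ.* a) b)) (ℤ.+-injective e′))

odd-≢0 : ∀ w {z} → z ≡ 1ℤ ℤ.+ + 2 ℤ.* w → z ≢ 0ℤ
odd-≢0 w ≡.refl e = 2∣w∣≢1 ∣ w ∣ (≡.trans (≡.sym (ℤ.abs-* (+ 2) w)) (≡.cong ∣_∣ 2w≡-1))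
  where
  2w≡-1 : + 2 ℤ.* w ≡ -[1+ 0 ]
  2w≡-1 = ≡.trans (solveℤ 1 (λ x → x :≡ (⊝ # 1) ⊕ (# 1 ⊕ x)) ≡.refl (+ 2 ℤ.* w))
    (≡.cong (λ x → -[1+ 0 ] ℤ.+ x) e)
  2∣w∣≢1 : ∀ k → 2 ℕ.* k ≢ 1
  2∣w∣≢1 zero    ()
  2∣w∣≢1 (suc k) e = ℕ.1+n≢0 (ℕ.suc-injective (≡.trans (≡.sym (≡.cong suc (ℕ.+-suc k (k ℕ.+ 0)))) e))

2*odd-≢0 : ∀ w {z} → z ≡ + 2 ℤ.* (1ℤ ℤ.+ + 2 ℤ.* w) → z ≢ 0ℤ
2*odd-≢0 w e z≡0 with ℤ.i*j≡0⇒i≡0∨j≡0 (+ 2) (≡.trans (≡.sym e) z≡0)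
... | inj₁ ()
... | inj₂ e′ = odd-≢0 w ≡.refl e′

∤-mod : ∀ {e c z} w → ¬ e ℕ.∣ c → z ≡ + c ℤ.+ + e ℤ.* w → ¬ e ℕ.∣ ∣ z ∣
∤-mod {e} {c} w e∤c ≡.refl e∣z with ℤ.∣ᵤ⇒∣ {+ e} {+ c ℤ.+ + e ℤ.* w} e∣z
... | ℤ.divides k eq = e∤c (ℤ.∣⇒∣ᵤ {+ e} {+ c} (ℤ.divides (k ℤ.- w) (≡.trans
  (solveℤ 2 (λ c ew → c :≡ c ⊕ ew ⊝ ew) ≡.refl (+ c) (+ e ℤ.* w))
  (≡.trans (≡.cong (ℤ._- + e ℤ.* w) eq)
    (solveℤ 3 (λ k e w → k ⊗ e ⊝ e ⊗ w :≡ (k ⊝ w) ⊗ e) ≡.refl k (+ e) w)))))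

-- Powers of q and the summable parameter values

module Powers (F : CommutativeRing 0ℓ 0ℓ) (reciprocal : Reciprocal F) where
  open CommutativeRing F
  open Reciprocal reciprocal
  open Units F
  open Products F
  open IntegerSolver F
  open Hypergeometric F reciprocal
  open import Relation.Binary.Reasoning.Setoid setoid
  open import Algebra.Properties.Semiring.Exp semiring using (_^_; ^-homo-*)

  private
    I O : ∀ {n} → Polynomial n
    I = con (+ 1)
    O = con (+ 0)

  module Exponentials (Q Q⁻¹ : Carrier) (QQ⁻¹ : Q * Q⁻¹ ≈ 1#) (unit-1-Q^ : ∀ j → Unit (1# - Q ^ suc j)) where

    E : ℤ → Carrier
    E (+ n)    = Q ^ n
    E -[1+ n ] = Q⁻¹ ^ suc n

    Q^Q⁻¹^ : ∀ n → Q ^ n * Q⁻¹ ^ n ≈ 1#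
    Q^Q⁻¹^ zero    = *-identityˡ 1#
    Q^Q⁻¹^ (suc n) = trans (solve 4 (λ q i x y → q :* x :* (i :* y) := q :* i :* (x :* y)) refl Q Q⁻¹ (Q ^ n) (Q⁻¹ ^ n))
      (trans (*-cong QQ⁻¹ (Q^Q⁻¹^ n)) (*-identityˡ 1#))

    E-⊖ : ∀ m n → E (m ⊖ n) ≈ Q ^ m * Q⁻¹ ^ n
    E-⊖ zero    zero    = sym (*-identityˡ 1#)
    E-⊖ zero    (suc n) = sym (*-identityˡ _)
    E-⊖ (suc m) zero    = sym (*-identityʳ _)
    E-⊖ (suc m) (suc n) = begin
      E (suc m ⊖ suc n)                  ≡⟨ ≡.cong E (ℤ.[1+m]⊖[1+n]≡m⊖n m n) ⟩
      E (m ⊖ n)                          ≈⟨ E-⊖ m n ⟩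
      Q ^ m * Q⁻¹ ^ n                    ≈⟨ *-identityˡ _ ⟨
      1# * (Q ^ m * Q⁻¹ ^ n)             ≈⟨ *-congʳ QQ⁻¹ ⟨
      Q * Q⁻¹ * (Q ^ m * Q⁻¹ ^ n)        ≈⟨ solve 4 (λ q i x y → q :* i :* (x :* y) := q :* x :* (i :* y)) refl Q Q⁻¹ (Q ^ m) (Q⁻¹ ^ n) ⟩
      Q ^ suc m * Q⁻¹ ^ suc n            ∎

    E-+ : ∀ i j → E i * E j ≈ E (i ℤ.+ j)
    E-+ (+ m)    (+ n)    = sym (^-homo-* Q m n)
    E-+ (+ m)    -[1+ n ] = sym (E-⊖ m (suc n))
    E-+ -[1+ m ] (+ n)    = trans (*-comm _ _) (sym (E-⊖ n (suc m)))
    E-+ -[1+ m ] -[1+ n ] = trans (sym (^-homo-* Q⁻¹ (suc m) (suc n)))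
      (reflexive (≡.cong (λ k → Q⁻¹ ^ suc k) (ℕ.+-suc m n)))

    -- A record, so that the exponent can be inferred.
    infix 4 _↦_
    record _↦_ (x : Carrier) (i : ℤ) : Set where
      constructor power
      field power-≈ : x ≈ E i
    open _↦_ public

    E↦ : ∀ i → E i ↦ i
    E↦ i = power refl

    E-+′ : ∀ {x y i j} → x ↦ i → y ↦ j → x * y ↦ i ℤ.+ j
    E-+′ {i = i} {j} (power ex) (power ey) = power (trans (*-cong ex ey) (E-+ i j))

    1-↦ : ∀ {x i} → x ↦ i → 1# - x ≈ 1# - E i
    1-↦ (power e) = +-congˡ (-‿cong e)

    E-≡ : ∀ {i j} → i ≡ j → E i ≈ E j
    E-≡ e = reflexive (≡.cong E e)

    E-inverse : ∀ i → E i * E (ℤ.- i) ≈ 1#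
    E-inverse i = trans (E-+ i (ℤ.- i)) (E-≡ (ℤ.+-inverseʳ i))

    unit-E : ∀ i → Unit (E i)
    unit-E i = E (ℤ.- i) , E-inverse i

    E-^ : ∀ i k → E i ^ k ≈ E (i ℤ.* + k)
    E-^ i zero    = E-≡ (≡.sym (ℤ.*-zeroʳ i))
    E-^ i (suc k) = trans (*-congˡ (E-^ i k)) (trans (E-+ i _) (E-≡ (≡.sym (ℤ.*-suc i (+ k)))))

    1-E-negative : ∀ n → 1# - E -[1+ n ] ≈ - E -[1+ n ] * (1# - Q ^ suc n)
    1-E-negative n = begin
      1# - Q⁻¹ ^ suc n                               ≈⟨ +-congʳ (Q^Q⁻¹^ (suc n)) ⟨
      Q ^ suc n * Q⁻¹ ^ suc n - Q⁻¹ ^ suc n          ≈⟨ solve 2 (λ x y → x :* y :- y := (:- y) :* (I :- x)) refl (Q ^ suc n) (Q⁻¹ ^ suc n) ⟩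
      - E -[1+ n ] * (1# - Q ^ suc n)                ∎

    unit-neg : ∀ {x} → Unit x → Unit (- x)
    unit-neg {x} (u , e) = - u , trans (solve 2 (λ x u → (:- x) :* (:- u) := x :* u) refl x u) e

    unit-1-E : ∀ {z} → z ≢ 0ℤ → Unit (1# - E z)
    unit-1-E {+ zero}   z≢0 = contradiction ≡.refl z≢0
    unit-1-E {+ suc n}  _   = unit-1-Q^ n
    unit-1-E { -[1+ n ]} _  = unit-resp (sym (1-E-negative n)) (unit-* (unit-neg (unit-E -[1+ n ])) (unit-1-Q^ n))

    p p⁻¹ : Carrier
    p = E (+ 2)
    p⁻¹ = E -[1+ 1 ]

    unit-p : Unit p
    unit-p = unit-E (+ 2)

    pp⁻¹ : p * p⁻¹ ≈ 1#
    pp⁻¹ = E-inverse (+ 2)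

    open Base p unit-p public
    open Inverse p⁻¹ pp⁻¹ public

    p↦ : p ↦ + 2
    p↦ = E↦ (+ 2)

    p^↦ : ∀ k → p ^ k ↦ + 2 ℤ.* + k
    p^↦ k = power (E-^ (+ 2) k)

    squares↦ : ∀ i → squares i ↦ + 4 ℤ.* + i
    squares↦ i = power (trans (squares-^ i) (trans (power-≈ (E-+′ (p^↦ i) (p^↦ i)))
      (E-≡ (solveℤ 1 (λ i → # 2 ⊗ i ⊕ # 2 ⊗ i :≡ # 4 ⊗ i) ≡.refl (+ i)))))

    squares⁻¹↦ : ∀ i → squares⁻¹ i ↦ ℤ.- (+ 4 ℤ.* + i)
    squares⁻¹↦ i = power (unit-cancel (unit-E (+ 4 ℤ.* + i)) (trans (*-congʳ (sym (power-≈ (squares↦ i))))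
      (trans (*-comm _ _) (trans (squares-inverse i) (sym (E-inverse (+ 4 ℤ.* + i)))))))

    odd↦ : ∀ i → odd i ↦ + 2 ℤ.+ + 4 ℤ.* + i
    odd↦ i = E-+′ p↦ (squares↦ i)

    quad²-E : ∀ {a b b′ x α β β′ ξ} → a ↦ α → b ↦ β → b′ ↦ β′ → x ↦ ξ → β ℤ.+ β′ ≡ + 2 →
      quad² a (b + b′) x ≈ (1# - E (α ℤ.+ β ℤ.+ + 2 ℤ.+ (ξ ℤ.+ ξ))) * (1# - E (α ℤ.+ β′ ℤ.+ + 2 ℤ.+ (ξ ℤ.+ ξ)))
    quad²-E {a} {b} {b′} {x} ea eb eb′ ex e = trans (quad²-factor a x (trans (power-≈ (E-+′ eb eb′)) (E-≡ e)))
      (*-cong (1-↦ (E-+′ (E-+′ (E-+′ ea eb) p↦) (E-+′ ex ex)))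
              (1-↦ (E-+′ (E-+′ (E-+′ ea eb′) p↦) (E-+′ ex ex))))

    D-E : ∀ {a b b′ δ x α β β′ γ ξ} → a ↦ α → b ↦ β → b′ ↦ β′ → δ ↦ γ → x ↦ ξ → β ℤ.+ β′ ≡ + 2 →
      D a (b + b′) δ x ≈
        (1# - E (+ 4 ℤ.+ (ξ ℤ.+ ξ))) *
        ((1# - E (α ℤ.+ β ℤ.+ + 2 ℤ.+ (ξ ℤ.+ ξ))) * (1# - E (α ℤ.+ β′ ℤ.+ + 2 ℤ.+ (ξ ℤ.+ ξ)))) *
        (1# - E (α ℤ.+ γ ℤ.+ + 2 ℤ.+ ξ))
    D-E ea eb eb′ eδ ex e = *-cong (*-cong
      (1-↦ (E-+′ (E-+′ p↦ p↦) (E-+′ ex ex))) (quad²-E ea eb eb′ ex e))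
      (1-↦ (E-+′ (E-+′ (E-+′ ea eδ) p↦) ex))

    coreD-E : ∀ {a δ β η x α γ b h ξ} → a ↦ α → δ ↦ γ → β ↦ b → η ↦ h → x ↦ ξ →
      coreD a δ β η x ≈
        (1# - E (+ 4 ℤ.+ (ξ ℤ.+ ξ))) *
        ((1# - E (α ℤ.+ b ℤ.+ + 6 ℤ.+ (ξ ℤ.+ ξ))) * (1# - E (α ℤ.+ h ℤ.+ + 6 ℤ.+ (ξ ℤ.+ ξ)))) *
        (1# - E (α ℤ.+ γ ℤ.+ + 2 ℤ.+ ξ))
    coreD-E ea eδ eβ eη ex = *-cong (*-cong
      (1-↦ (E-+′ (E-+′ p↦ p↦) (E-+′ ex ex)))
      (*-cong (1-↦ (E-+′ (E-+′ (E-+′ ea eβ) p³) (E-+′ ex ex)))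
              (1-↦ (E-+′ (E-+′ (E-+′ ea eη) p³) (E-+′ ex ex)))))
      (1-↦ (E-+′ (E-+′ (E-+′ ea eδ) p↦) ex))
      where
      p³ : p * p * p ↦ + 6
      p³ = E-+′ (E-+′ p↦ p↦) p↦

    4+4k≢0 : ∀ k → + 4 ℤ.+ (+ 2 ℤ.* + k ℤ.+ + 2 ℤ.* + k) ≢ 0ℤ
    4+4k≢0 k = positive-≢0 4 k 3 (solveℤ 1 (λ k → # 4 ⊕ (# 2 ⊗ k ⊕ # 2 ⊗ k) :≡ # 4 ⊗ k ⊕ # 4) ≡.refl (+ k))

    unit-D : ∀ {a b b′ δ α β β′ γ} → a ↦ α → b ↦ β → b′ ↦ β′ → δ ↦ γ → β ℤ.+ β′ ≡ + 2 → ∀ k →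
      let ξ = + 2 ℤ.* + k in
      α ℤ.+ β ℤ.+ + 2 ℤ.+ (ξ ℤ.+ ξ) ≢ 0ℤ → α ℤ.+ β′ ℤ.+ + 2 ℤ.+ (ξ ℤ.+ ξ) ≢ 0ℤ → α ℤ.+ γ ℤ.+ + 2 ℤ.+ ξ ≢ 0ℤ →
      Unit (D a (b + b′) δ (p ^ k))
    unit-D ea eb eb′ eδ e k n₁ n₂ n₃ = unit-resp (sym (D-E ea eb eb′ eδ (p^↦ k) e))
      (unit-* (unit-* (unit-1-E (4+4k≢0 k)) (unit-* (unit-1-E n₁) (unit-1-E n₂))) (unit-1-E n₃))

    unit-coreD : ∀ {a δ β η α γ b h} → a ↦ α → δ ↦ γ → β ↦ b → η ↦ h → ∀ k →
      let ξ = + 2 ℤ.* + k in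
      α ℤ.+ b ℤ.+ + 6 ℤ.+ (ξ ℤ.+ ξ) ≢ 0ℤ → α ℤ.+ h ℤ.+ + 6 ℤ.+ (ξ ℤ.+ ξ) ≢ 0ℤ → α ℤ.+ γ ℤ.+ + 2 ℤ.+ ξ ≢ 0ℤ →
      Unit (coreD a δ β η (p ^ k))
    unit-coreD ea eδ eβ eη k n₁ n₂ n₃ = unit-resp (sym (coreD-E ea eδ eβ eη (p^↦ k)))
      (unit-* (unit-* (unit-1-E (4+4k≢0 k)) (unit-* (unit-1-E n₁) (unit-1-E n₂))) (unit-1-E n₃))

    -- The parameters of the theorem: a = q, δ = 1 / d with d = q, and σ = b + q² / b with b = q.
    a₀ δ₀ σ₀ : Carrier
    a₀ = E (+ 1)
    δ₀ = E -[1+ 0 ]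
    σ₀ = E (+ 1) + E (+ 1)

    -- At a = q, splitting σ into two powers of q with product q² turns each factor `X` of `sum-δ`
    -- into two factors 1 - q^z.
    sum-δ-E : ∀ {b b′ β β′} → b ↦ β → b′ ↦ β′ → β ℤ.+ β′ ≡ + 2 →
      (∀ k → + 1 ℤ.+ β ℤ.+ + 2 ℤ.+ (+ 2 ℤ.* + k ℤ.+ + 2 ℤ.* + k) ≢ 0ℤ) →
      (∀ k → + 1 ℤ.+ β′ ℤ.+ + 2 ℤ.+ (+ 2 ℤ.* + k ℤ.+ + 2 ℤ.* + k) ≢ 0ℤ) →
      ∀ j {δ K} → δ ↦ + 4 ℤ.* + j → j < K →
      Π j (λ i → (1# - E (+ 3 ℤ.+ β ℤ.+ + 4 ℤ.* + i)) * (1# - E (+ 3 ℤ.+ β′ ℤ.+ + 4 ℤ.* + i))) * S a₀ (b + b′) δ K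
        ≈ (1# - E (+ 1)) * Π j (λ i → (1# - E (+ 3 ℤ.+ + 4 ℤ.* + i)) * (1# - E (+ 5 ℤ.+ + 4 ℤ.* + i)))
    sum-δ-E {b} {b′} {β} {β′} eb eb′ e n₁ n₂ j {δ} {K} eδ j<K = begin
      Π j _ * S a₀ (b + b′) δ K
        ≈⟨ *-cong (Π-cong j λ i _ → X-E i) (S-cong (λ k → units j k) refl refl (trans (power-≈ (squares↦ j)) (sym (power-≈ eδ))) K) ⟨
      Π j (λ i → StepD.X a₀ (b + b′) (squares i)) * S a₀ (b + b′) (squares j) K
        ≈⟨ sum-δ a₀ (b + b′) units (λ i → unit-resp (solve 1 (λ x → :- (I :- x) := x :- I) refl _)
             (unit-neg (unit-resp (sym (1-↦ (squares↦ (suc i)))) (unit-1-E (positive-≢0 4 i 3 (solveℤ 1 (λ i → # 4 ⊗ (# 1 ⊕ i) :≡ # 4 ⊗ i ⊕ # 4) ≡.refl (+ i))))))) j j<K ⟩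
      (1# - a₀) * Π j (λ i → (1# - a₀ * (p * squares i)) * (1# - a₀ * squares (suc i)))
        ≈⟨ *-congˡ (Π-cong j λ i _ → *-cong
             (trans (1-↦ (E-+′ (E↦ (+ 1)) (odd↦ i))) (+-congˡ (-‿cong (E-≡ (solveℤ 1 (λ i → # 1 ⊕ (# 2 ⊕ # 4 ⊗ i) :≡ # 3 ⊕ # 4 ⊗ i) ≡.refl (+ i))))))
             (trans (1-↦ (E-+′ (E↦ (+ 1)) (squares↦ (suc i)))) (+-congˡ (-‿cong (E-≡ (solveℤ 1 (λ i → # 1 ⊕ # 4 ⊗ (# 1 ⊕ i) :≡ # 5 ⊕ # 4 ⊗ i) ≡.refl (+ i))))))) ⟩
      (1# - a₀) * Π j (λ i → (1# - E (+ 3 ℤ.+ + 4 ℤ.* + i)) * (1# - E (+ 5 ℤ.+ + 4 ℤ.* + i))) ∎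
      where
      units : ∀ i k → Unit (D a₀ (b + b′) (squares i) (p ^ k))
      units i k = unit-D (E↦ (+ 1)) eb eb′ (squares↦ i) e k (n₁ k) (n₂ k)
        (positive-≢0 2 (2 ℕ.* i ℕ.+ k) 2 (≡.trans
          (solveℤ 2 (λ i k → # 1 ⊕ # 4 ⊗ i ⊕ # 2 ⊕ # 2 ⊗ k :≡ # 2 ⊗ (# 2 ⊗ i ⊕ k) ⊕ # 3) ≡.refl (+ i) (+ k))
          (≡.cong (λ z → + 2 ℤ.* (z ℤ.+ + k) ℤ.+ + 3) (≡.sym (ℤ.pos-* 2 i)))))
      X-E : ∀ i → StepD.X a₀ (b + b′) (squares i) ≈ (1# - E (+ 3 ℤ.+ β ℤ.+ + 4 ℤ.* + i)) * (1# - E (+ 3 ℤ.+ β′ ℤ.+ + 4 ℤ.* + i))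
      X-E i = begin
        StepD.X a₀ (b + b′) (squares i)
          ≈⟨ +-congˡ (*-congʳ (*-congˡ (sym (trans (power-≈ (E-+′ eb eb′)) (E-≡ e))))) ⟩
        1# - a₀ * (b + b′) * odd i + a₀ * a₀ * (b * b′) * (odd i * odd i)
          ≈⟨ solve 4 (λ a b c z → I :- a :* (b :+ c) :* z :+ a :* a :* (b :* c) :* (z :* z) := (I :- a :* b :* z) :* (I :- a :* c :* z)) refl a₀ b b′ (odd i) ⟩
        (1# - a₀ * b * odd i) * (1# - a₀ * b′ * odd i)
          ≈⟨ *-cong (trans (1-↦ (E-+′ (E-+′ (E↦ (+ 1)) eb) (odd↦ i))) (+-congˡ (-‿cong (E-≡ (solveℤ 2 (λ β i → # 1 ⊕ β ⊕ (# 2 ⊕ # 4 ⊗ i) :≡ # 3 ⊕ β ⊕ # 4 ⊗ i) ≡.refl β (+ i))))))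
                    (trans (1-↦ (E-+′ (E-+′ (E↦ (+ 1)) eb′) (odd↦ i))) (+-congˡ (-‿cong (E-≡ (solveℤ 2 (λ β′ i → # 1 ⊕ β′ ⊕ (# 2 ⊕ # 4 ⊗ i) :≡ # 3 ⊕ β′ ⊕ # 4 ⊗ i) ≡.refl β′ (+ i)))))) ⟩
        (1# - E (+ 3 ℤ.+ β ℤ.+ + 4 ℤ.* + i)) * (1# - E (+ 3 ℤ.+ β′ ℤ.+ + 4 ℤ.* + i)) ∎

    1-E-≡ : ∀ {i j} → i ≡ j → 1# - E i ≈ 1# - E j
    1-E-≡ e = +-congˡ (-‿cong (E-≡ e))

    Π-telescope : ∀ m s (f : ℕ → Carrier) → f 0 * Π m (λ i → s * f (suc i)) ≈ Π m (λ i → s * f i) * f m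
    Π-telescope zero    s f = *-comm _ _
    Π-telescope (suc m) s f = begin
      f 0 * (Π m (λ i → s * f (suc i)) * (s * f (suc m)))   ≈⟨ *-assoc _ _ _ ⟨
      f 0 * Π m (λ i → s * f (suc i)) * (s * f (suc m))     ≈⟨ *-congʳ (Π-telescope m s f) ⟩
      Π m (λ i → s * f i) * f m * (s * f (suc m))
        ≈⟨ solve 4 (λ π a s b → π :* a :* (s :* b) := π :* (s :* a) :* b) refl (Π m (λ i → s * f i)) (f m) s (f (suc m)) ⟩
      Π m (λ i → s * f i) * (s * f m) * f (suc m)           ∎

    Π-E : ∀ m → Π m (λ _ → E (+ 1)) ≈ E (+ m)
    Π-E zero    = refl
    Π-E (suc m) = trans (*-congʳ (Π-E m)) (trans (E-+ (+ m) (+ 1)) (E-≡ (≡.cong +_ (ℕ.+-comm m 1))))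

    module Values (m : ℕ) where
      ν : ℤ
      ν = + 4 ℤ.* + m ℤ.+ + 1

      -- a₁, σ₁ and δ₁ agree with a₀, σ₀ and δ₀ modulo 1 − qⁿ, n = 4 m + 1, and each of them makes the series summable.
      a₁ b₁ b₁′ σ₁ δ₁ : Carrier
      a₁  = E (+ 1 ℤ.- ν)
      b₁  = E (+ 1 ℤ.+ ν)
      b₁′ = E (+ 1 ℤ.- ν)
      σ₁  = b₁ + b₁′
      δ₁  = E (ν ℤ.- + 1)

      A z : ℕ → Carrier
      A i = 1# - E (+ 4 ℤ.+ + 4 ℤ.* + i)
      z i = E (+ 4 ℤ.+ + 4 ℤ.* + i)

      σ₁-sum : + 1 ℤ.+ ν ℤ.+ (+ 1 ℤ.- ν) ≡ + 2
      σ₁-sum = (solveℤ 1 (λ ν → # 1 ⊕ ν ⊕ (# 1 ⊝ ν) :≡ # 2) ≡.refl ν)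

      split : ∀ {i} → i ≤ m → + m ≡ + i ℤ.+ + (m ℕ.∸ i)
      split i≤m = ≡.cong +_ (≡.sym (ℕ.m+[n∸m]≡n i≤m))

      -- The value a₁ is p^(-2 m), so `sum-a` applies whatever the other parameters are. The
      -- conditions keep the denominators invertible while i descends from m; for b₁ and δ₁ the
      -- exponents stay positive exactly because i ≤ m.
      S-zero : ∀ {b b′ β β′} γ → b ↦ β → b′ ↦ β′ → β ℤ.+ β′ ≡ + 2 →
        (∀ i → i ≤ m → ∀ k → ℤ.- (+ 4 ℤ.* + i) ℤ.+ β ℤ.+ + 2 ℤ.+ (+ 2 ℤ.* + k ℤ.+ + 2 ℤ.* + k) ≢ 0ℤ) →
        (∀ i → i ≤ m → ∀ k → ℤ.- (+ 4 ℤ.* + i) ℤ.+ β′ ℤ.+ + 2 ℤ.+ (+ 2 ℤ.* + k ℤ.+ + 2 ℤ.* + k) ≢ 0ℤ) →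
        (∀ i → i ≤ m → ∀ k → ℤ.- (+ 4 ℤ.* + i) ℤ.+ γ ℤ.+ + 2 ℤ.+ + 2 ℤ.* + k ≢ 0ℤ) →
        ∀ {K} → m ℕ.+ m < K → S a₁ (b + b′) (E γ) K ≈ 0#
      S-zero {b} {b′} γ eb eb′ e n₁ n₂ n₃ {K} m<K = trans
        (sym (S-cong (units m ℕ.≤-refl) (trans (power-≈ (squares⁻¹↦ m)) (E-≡ (solveℤ 1 (λ m → ⊝ (# 4 ⊗ m) :≡ # 1 ⊝ (# 4 ⊗ m ⊕ # 1)) ≡.refl (+ m)))) refl refl K))
        (sum-a (b + b′) (E γ) m units m<K)
        where
        units : ∀ i → i ≤ m → ∀ k → Unit (D (squares⁻¹ i) (b + b′) (E γ) (p ^ k))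
        units i i≤m k = unit-D (squares⁻¹↦ i) eb eb′ (E↦ γ) e k (n₁ i i≤m k) (n₂ i i≤m k) (n₃ i i≤m k)

      private
        β₀-≢0 : ∀ i → i ≤ m → ∀ k → ℤ.- (+ 4 ℤ.* + i) ℤ.+ + 1 ℤ.+ + 2 ℤ.+ (+ 2 ℤ.* + k ℤ.+ + 2 ℤ.* + k) ≢ 0ℤ
        β₀-≢0 i _ k = odd-≢0 (+ 1 ℤ.- + 2 ℤ.* + i ℤ.+ + 2 ℤ.* + k)
          (solveℤ 2 (λ i k → ⊝ (# 4 ⊗ i) ⊕ # 1 ⊕ # 2 ⊕ (# 2 ⊗ k ⊕ # 2 ⊗ k) :≡ # 1 ⊕ # 2 ⊗ (# 1 ⊝ # 2 ⊗ i ⊕ # 2 ⊗ k)) ≡.refl (+ i) (+ k))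

        β₁-≢0 : ∀ i → i ≤ m → ∀ k → ℤ.- (+ 4 ℤ.* + i) ℤ.+ (+ 1 ℤ.+ ν) ℤ.+ + 2 ℤ.+ (+ 2 ℤ.* + k ℤ.+ + 2 ℤ.* + k) ≢ 0ℤ
        β₁-≢0 i i≤m k = positive-≢0 4 (m ℕ.∸ i ℕ.+ k) 3 (≡.trans
          (≡.cong (λ M → ℤ.- (+ 4 ℤ.* + i) ℤ.+ (+ 1 ℤ.+ (+ 4 ℤ.* M ℤ.+ + 1)) ℤ.+ + 2 ℤ.+ (+ 2 ℤ.* + k ℤ.+ + 2 ℤ.* + k)) (split i≤m))
          (solveℤ 3 (λ i k mi → ⊝ (# 4 ⊗ i) ⊕ (# 1 ⊕ (# 4 ⊗ (i ⊕ mi) ⊕ # 1)) ⊕ # 2 ⊕ (# 2 ⊗ k ⊕ # 2 ⊗ k) :≡ # 4 ⊗ (mi ⊕ k) ⊕ # 4) ≡.refl (+ i) (+ k) (+ (m ℕ.∸ i))))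

        β₁′-≢0 : ∀ i → i ≤ m → ∀ k → ℤ.- (+ 4 ℤ.* + i) ℤ.+ (+ 1 ℤ.- ν) ℤ.+ + 2 ℤ.+ (+ 2 ℤ.* + k ℤ.+ + 2 ℤ.* + k) ≢ 0ℤ
        β₁′-≢0 i _ k = 2*odd-≢0 (+ k ℤ.- + i ℤ.- + m)
          (solveℤ 3 (λ i k m → ⊝ (# 4 ⊗ i) ⊕ (# 1 ⊝ (# 4 ⊗ m ⊕ # 1)) ⊕ # 2 ⊕ (# 2 ⊗ k ⊕ # 2 ⊗ k) :≡ # 2 ⊗ (# 1 ⊕ # 2 ⊗ (k ⊝ i ⊝ m))) ≡.refl (+ i) (+ k) (+ m))

        γ₀-≢0 : ∀ i → i ≤ m → ∀ k → ℤ.- (+ 4 ℤ.* + i) ℤ.+ -[1+ 0 ] ℤ.+ + 2 ℤ.+ + 2 ℤ.* + k ≢ 0ℤ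
        γ₀-≢0 i _ k = odd-≢0 (+ k ℤ.- + 2 ℤ.* + i)
          (≡.trans (ℤ.+-assoc (ℤ.- (+ 4 ℤ.* + i) ℤ.+ -[1+ 0 ]) (+ 2) (+ 2 ℤ.* + k)) (solveℤ 2 (λ i k → ⊝ (# 4 ⊗ i) ⊕ (⊝ # 1) ⊕ (# 2 ⊕ # 2 ⊗ k) :≡ # 1 ⊕ # 2 ⊗ (k ⊝ # 2 ⊗ i)) ≡.refl (+ i) (+ k)))

        γ₁-≢0 : ∀ i → i ≤ m → ∀ k → ℤ.- (+ 4 ℤ.* + i) ℤ.+ (ν ℤ.- + 1) ℤ.+ + 2 ℤ.+ + 2 ℤ.* + k ≢ 0ℤ
        γ₁-≢0 i i≤m k = positive-≢0 2 (2 ℕ.* (m ℕ.∸ i) ℕ.+ k) 1 (≡.trans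
          (≡.cong (λ M → ℤ.- (+ 4 ℤ.* + i) ℤ.+ (+ 4 ℤ.* M ℤ.+ + 1 ℤ.- + 1) ℤ.+ + 2 ℤ.+ + 2 ℤ.* + k) (split i≤m)) (≡.trans
          (solveℤ 3 (λ i k mi → ⊝ (# 4 ⊗ i) ⊕ (# 4 ⊗ (i ⊕ mi) ⊕ # 1 ⊝ # 1) ⊕ # 2 ⊕ # 2 ⊗ k :≡ # 2 ⊗ (# 2 ⊗ mi ⊕ k) ⊕ # 2) ≡.refl (+ i) (+ k) (+ (m ℕ.∸ i)))
          (≡.cong (λ w → + 2 ℤ.* (w ℤ.+ + k) ℤ.+ + 2) (≡.sym (ℤ.pos-* 2 (m ℕ.∸ i))))))

      module _ {K} (m<K : m ℕ.+ m < K) where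

        S-zero₀₀ : S a₁ σ₀ δ₀ K ≈ 0#
        S-zero₀₀ = S-zero -[1+ 0 ] (E↦ (+ 1)) (E↦ (+ 1)) ≡.refl β₀-≢0 β₀-≢0 γ₀-≢0 m<K

        S-zero₀₁ : S a₁ σ₀ δ₁ K ≈ 0#
        S-zero₀₁ = S-zero (ν ℤ.- + 1) (E↦ (+ 1)) (E↦ (+ 1)) ≡.refl β₀-≢0 β₀-≢0 γ₁-≢0 m<K

        S-zero₁₀ : S a₁ σ₁ δ₀ K ≈ 0#
        S-zero₁₀ = S-zero -[1+ 0 ] (E↦ (+ 1 ℤ.+ ν)) (E↦ (+ 1 ℤ.- ν)) σ₁-sum β₁-≢0 β₁′-≢0 γ₀-≢0 m<K

        S-zero₁₁ : S a₁ σ₁ δ₁ K ≈ 0#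
        S-zero₁₁ = S-zero (ν ℤ.- + 1) (E↦ (+ 1 ℤ.+ ν)) (E↦ (+ 1 ℤ.- ν)) σ₁-sum β₁-≢0 β₁′-≢0 γ₁-≢0 m<K

      R : Carrier
      R = (1# - E (+ 1)) * Π m (λ i → (1# - E (+ 3 ℤ.+ + 4 ℤ.* + i)) * (1# - E (+ 5 ℤ.+ + 4 ℤ.* + i)))

      δ₁↦ : δ₁ ↦ + 4 ℤ.* + m
      δ₁↦ = power (E-≡ (solveℤ 1 (λ m → # 4 ⊗ m ⊕ # 1 ⊝ # 1 :≡ # 4 ⊗ m) ≡.refl (+ m)))

      S-value₀ : ∀ {j K} → j < K → ∀ {δ} → δ ↦ + 4 ℤ.* + j → Π j (λ i → A i * A i) * S a₀ σ₀ δ K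
        ≈ (1# - E (+ 1)) * Π j (λ i → (1# - E (+ 3 ℤ.+ + 4 ℤ.* + i)) * (1# - E (+ 5 ℤ.+ + 4 ℤ.* + i)))
      S-value₀ {j} j<K eδ = sum-δ-E (E↦ (+ 1)) (E↦ (+ 1)) ≡.refl pos pos j eδ j<K
        where
        pos : ∀ k → + 1 ℤ.+ + 1 ℤ.+ + 2 ℤ.+ (+ 2 ℤ.* + k ℤ.+ + 2 ℤ.* + k) ≢ 0ℤ
        pos = 4+4k≢0

      s : Carrier
      s = E (ℤ.- ν) * ((1# - E ν) * (1# - E ν))

      -- With u = q^ν this is (1 - z u)(1 - z / u) = (1 - z)² - z (1 - u)² / u: passing from b = q
      -- to b = q^(1 + ν) perturbs each factor to second order in 1 - u.
      factor₁ : ∀ i → A i * A i - z i * s ≈ (1# - E (+ 3 ℤ.+ (+ 1 ℤ.+ ν) ℤ.+ + 4 ℤ.* + i)) * (1# - E (+ 3 ℤ.+ (+ 1 ℤ.- ν) ℤ.+ + 4 ℤ.* + i))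
      factor₁ i = sym (begin
        (1# - E (+ 3 ℤ.+ (+ 1 ℤ.+ ν) ℤ.+ + 4 ℤ.* + i)) * (1# - E (+ 3 ℤ.+ (+ 1 ℤ.- ν) ℤ.+ + 4 ℤ.* + i))
          ≈⟨ *-cong (trans (1-E-≡ (solveℤ 2 (λ i ν → # 3 ⊕ (# 1 ⊕ ν) ⊕ # 4 ⊗ i :≡ # 4 ⊕ # 4 ⊗ i ⊕ ν) ≡.refl (+ i) ν)) (sym (1-↦ (E-+′ (E↦ (+ 4 ℤ.+ + 4 ℤ.* + i)) (E↦ ν)))))
                    (trans (1-E-≡ (solveℤ 2 (λ i ν → # 3 ⊕ (# 1 ⊝ ν) ⊕ # 4 ⊗ i :≡ # 4 ⊕ # 4 ⊗ i ⊕ ⊝ ν) ≡.refl (+ i) ν)) (sym (1-↦ (E-+′ (E↦ (+ 4 ℤ.+ + 4 ℤ.* + i)) (E↦ (ℤ.- ν)))))) ⟩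
        (1# - z i * E ν) * (1# - z i * E (ℤ.- ν))
          ≈⟨ solve 3 (λ z u v → (I :- z :* u) :* (I :- z :* v) := I :- z :* (u :+ v) :+ z :* z :* (u :* v)) refl (z i) (E ν) (E (ℤ.- ν)) ⟩
        1# - z i * (E ν + E (ℤ.- ν)) + z i * z i * (E ν * E (ℤ.- ν))
          ≈⟨ +-congˡ (*-congˡ (E-inverse ν)) ⟩
        1# - z i * (E ν + E (ℤ.- ν)) + z i * z i * 1#
          ≈⟨ solve 3 (λ z u v → I :- z :* (u :+ v) :+ z :* z :* I := (I :- z) :* (I :- z) :- z :* (v :- (I :+ I) :* I :+ I :* u)) refl (z i) (E ν) (E (ℤ.- ν)) ⟩
        A i * A i - z i * (E (ℤ.- ν) - (1# + 1#) * 1# + 1# * E ν)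
          ≈⟨ +-congˡ (-‿cong (*-congˡ (+-cong (+-congˡ (-‿cong (*-congˡ (E-inverse ν)))) (*-congʳ (E-inverse ν))))) ⟨
        A i * A i - z i * (E (ℤ.- ν) - (1# + 1#) * (E ν * E (ℤ.- ν)) + E ν * E (ℤ.- ν) * E ν)
          ≈⟨ solve 4 (λ a z u v → a :* a :- z :* (v :- (I :+ I) :* (u :* v) :+ u :* v :* u) := a :* a :- z :* (v :* ((I :- u) :* (I :- u)))) refl (A i) (z i) (E ν) (E (ℤ.- ν)) ⟩
        A i * A i - z i * s ∎)

      S-value₁ : ∀ {K} → m < K → Π m (λ i → A i * A i - z i * s) * S a₀ σ₁ δ₁ K ≈ R
      S-value₁ {K} m<K = trans (*-congʳ (Π-cong m λ i _ → factor₁ i))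
        (sum-δ-E (E↦ (+ 1 ℤ.+ ν)) (E↦ (+ 1 ℤ.- ν)) σ₁-sum
          (λ k → positive-≢0 4 (m ℕ.+ k) 4 (solveℤ 2 (λ m k → # 1 ⊕ (# 1 ⊕ (# 4 ⊗ m ⊕ # 1)) ⊕ # 2 ⊕ (# 2 ⊗ k ⊕ # 2 ⊗ k) :≡ # 4 ⊗ (m ⊕ k) ⊕ # 5) ≡.refl (+ m) (+ k)))
          (λ k → odd-≢0 (+ 1 ℤ.- + 2 ℤ.* + m ℤ.+ + 2 ℤ.* + k) (solveℤ 2 (λ m k → # 1 ⊕ (# 1 ⊝ (# 4 ⊗ m ⊕ # 1)) ⊕ # 2 ⊕ (# 2 ⊗ k ⊕ # 2 ⊗ k) :≡ # 1 ⊕ # 2 ⊗ (# 1 ⊝ # 2 ⊗ m ⊕ # 2 ⊗ k)) ≡.refl (+ m) (+ k)))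
          m δ₁↦ m<K)
      -- At a = q, δ = 1 / q the two products of `sum-b` share a telescoping part, with `- f i` on
      -- the left and `- f (suc i)` on the right. Together with `1# - a₀`, which is `f 0`, this
      -- leaves the single factor `f m` = 1 - q^ν.
      T-value : ∀ {K} → m ℕ.+ m < K →
        Π m A * E (+ m) * S a₀ σ₁ δ₀ K ≈ Π m (λ i → 1# - E (+ 2 ℤ.+ + 4 ℤ.* + i)) * (1# - E ν)
      T-value {K} m<K = unit-cancel (Π-unit m unit-B) (begin
        Π m B * (Π m A * E (+ m) * S a₀ σ₁ δ₀ K)
          ≈⟨ *-congˡ (*-congˡ (S-cong (λ k → units-D m k) refl σ-eq refl K)) ⟨
        Π m B * (Π m A * E (+ m) * t)
          ≈⟨ solve 4 (λ b a e t → b :* (a :* e :* t) := a :* e :* b :* t) refl (Π m B) (Π m A) (E (+ m)) t ⟩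
        Π m A * E (+ m) * Π m B * t
          ≈⟨ *-congʳ (*-congʳ (*-congˡ (Π-E m))) ⟨
        Π m A * Π m (λ _ → E (+ 1)) * Π m B * t
          ≈⟨ *-congʳ (trans (*-congʳ (sym (Π-* m A _))) (sym (Π-* m _ B))) ⟩
        Π m (λ i → A i * E (+ 1) * B i) * t
          ≈⟨ *-congʳ (Π-cong m λ i _ → left i) ⟨
        Π m (λ i → (1# - a₀ * δ₀ * odd i * p) * (odd i - a₀)) * t
          ≈⟨ sum-b a₀ δ₀ units-D units-core (λ i → unit-resp (sym (1-↦ (odd↦ i))) (unit-1-E (positive-≢0 4 i 1 (ℤ.+-comm (+ 2) (+ 4 ℤ.* + i)))))
               (λ i → unit-resp (sym (1-↦ (E-+′ (odd↦ i) p↦))) (unit-1-E (positive-≢0 4 i 3 (solveℤ 1 (λ i → # 2 ⊕ # 4 ⊗ i ⊕ # 2 :≡ # 4 ⊗ i ⊕ # 4) ≡.refl (+ i))))) m m<K ⟩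
        (1# - a₀) * Π m (λ i → (odd i - a₀ * δ₀) * (1# - a₀ * odd i * p))
          ≈⟨ *-congˡ (trans (Π-cong m λ i _ → right i) (Π-* m C _)) ⟩
        (1# - a₀) * (Π m C * Π m (λ i → - 1# * f (suc i)))
          ≈⟨ solve 3 (λ a c b → a :* (c :* b) := c :* (a :* b)) refl (1# - a₀) (Π m C) _ ⟩
        Π m C * ((1# - a₀) * Π m (λ i → - 1# * f (suc i)))
          ≈⟨ *-congˡ (Π-telescope m (- 1#) f) ⟩
        Π m C * (Π m B * f m)
          ≈⟨ *-congˡ (*-congˡ (1-E-≡ (ℤ.+-comm (+ 1) (+ 4 ℤ.* + m)))) ⟩
        Π m C * (Π m B * (1# - E ν))
          ≈⟨ solve 3 (λ c b d → c :* (b :* d) := b :* (c :* d)) refl (Π m C) (Π m B) (1# - E ν) ⟩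
        Π m B * (Π m C * (1# - E ν)) ∎)
        where
        f B C : ℕ → Carrier
        f i = 1# - E (+ 1 ℤ.+ + 4 ℤ.* + i)
        B i = - 1# * f i
        C i = 1# - E (+ 2 ℤ.+ + 4 ℤ.* + i)
        t = S a₀ (σ-at m) δ₀ K
        unit-B : ∀ i → i < m → Unit (B i)
        unit-B i _ = unit-* (unit-neg unit-1) (unit-1-E (positive-≢0 4 i 0 (ℤ.+-comm (+ 1) (+ 4 ℤ.* + i))))
        σ-eq : σ-at m ≈ σ₁
        σ-eq = trans (+-comm _ _) (+-cong
          (trans (power-≈ (odd↦ m)) (E-≡ (solveℤ 1 (λ m → # 2 ⊕ # 4 ⊗ m :≡ # 1 ⊕ (# 4 ⊗ m ⊕ # 1)) ≡.refl (+ m))))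
          (trans (power-≈ (squares⁻¹↦ m)) (E-≡ (solveℤ 1 (λ m → ⊝ (# 4 ⊗ m) :≡ # 1 ⊝ (# 4 ⊗ m ⊕ # 1)) ≡.refl (+ m)))))
        2+2k≢0 : ∀ k → + 1 ℤ.+ -[1+ 0 ] ℤ.+ + 2 ℤ.+ + 2 ℤ.* + k ≢ 0ℤ
        2+2k≢0 k = positive-≢0 2 k 1 (ℤ.+-comm (+ 2) (+ 2 ℤ.* + k))
        units-D : ∀ i k → Unit (D a₀ (σ-at i) δ₀ (p ^ k))
        units-D i k = unit-D (E↦ (+ 1)) (squares⁻¹↦ i) (odd↦ i) (E↦ -[1+ 0 ]) (solveℤ 1 (λ i → ⊝ (# 4 ⊗ i) ⊕ (# 2 ⊕ # 4 ⊗ i) :≡ # 2) ≡.refl (+ i)) k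
          (odd-≢0 (+ 1 ℤ.- + 2 ℤ.* + i ℤ.+ + 2 ℤ.* + k) (solveℤ 2 (λ i k → # 1 ⊕ ⊝ (# 4 ⊗ i) ⊕ # 2 ⊕ (# 2 ⊗ k ⊕ # 2 ⊗ k) :≡ # 1 ⊕ # 2 ⊗ (# 1 ⊝ # 2 ⊗ i ⊕ # 2 ⊗ k)) ≡.refl (+ i) (+ k)))
          (odd-≢0 (+ 2 ℤ.+ + 2 ℤ.* + i ℤ.+ + 2 ℤ.* + k) (solveℤ 2 (λ i k → # 1 ⊕ (# 2 ⊕ # 4 ⊗ i) ⊕ # 2 ⊕ (# 2 ⊗ k ⊕ # 2 ⊗ k) :≡ # 1 ⊕ # 2 ⊗ (# 2 ⊕ # 2 ⊗ i ⊕ # 2 ⊗ k)) ≡.refl (+ i) (+ k)))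
          (2+2k≢0 k)
        units-core : ∀ i k → Unit (coreD a₀ δ₀ (squares⁻¹ (suc i)) (odd i) (p ^ k))
        units-core i k = unit-coreD (E↦ (+ 1)) (E↦ -[1+ 0 ]) (squares⁻¹↦ (suc i)) (odd↦ i) k
          (odd-≢0 (+ 1 ℤ.- + 2 ℤ.* + i ℤ.+ + 2 ℤ.* + k) (solveℤ 2 (λ i k → # 1 ⊕ ⊝ (# 4 ⊗ (# 1 ⊕ i)) ⊕ # 6 ⊕ (# 2 ⊗ k ⊕ # 2 ⊗ k) :≡ # 1 ⊕ # 2 ⊗ (# 1 ⊝ # 2 ⊗ i ⊕ # 2 ⊗ k)) ≡.refl (+ i) (+ k)))
          (odd-≢0 (+ 4 ℤ.+ + 2 ℤ.* + i ℤ.+ + 2 ℤ.* + k) (solveℤ 2 (λ i k → # 1 ⊕ (# 2 ⊕ # 4 ⊗ i) ⊕ # 6 ⊕ (# 2 ⊗ k ⊕ # 2 ⊗ k) :≡ # 1 ⊕ # 2 ⊗ (# 4 ⊕ # 2 ⊗ i ⊕ # 2 ⊗ k)) ≡.refl (+ i) (+ k)))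
          (2+2k≢0 k)
        left : ∀ i → (1# - a₀ * δ₀ * odd i * p) * (odd i - a₀) ≈ A i * E (+ 1) * B i
        left i = begin
          (1# - a₀ * δ₀ * odd i * p) * (odd i - a₀)
            ≈⟨ *-cong (trans (1-↦ (E-+′ (E-+′ (E-+′ (E↦ (+ 1)) (E↦ -[1+ 0 ])) (odd↦ i)) p↦)) (1-E-≡ (solveℤ 1 (λ i → # 0 ⊕ (# 2 ⊕ # 4 ⊗ i) ⊕ # 2 :≡ # 4 ⊕ # 4 ⊗ i) ≡.refl (+ i))))
                 (+-congʳ (trans (power-≈ (odd↦ i)) (trans (E-≡ (solveℤ 1 (λ i → # 2 ⊕ # 4 ⊗ i :≡ # 1 ⊕ (# 1 ⊕ # 4 ⊗ i)) ≡.refl (+ i))) (sym (E-+ (+ 1) (+ 1 ℤ.+ + 4 ℤ.* + i)))))) ⟩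
          A i * (E (+ 1) * E (+ 1 ℤ.+ + 4 ℤ.* + i) - E (+ 1))
            ≈⟨ solve 3 (λ a e x → a :* (e :* x :- e) := a :* e :* (:- I :* (I :- x))) refl (A i) (E (+ 1)) (E (+ 1 ℤ.+ + 4 ℤ.* + i)) ⟩
          A i * E (+ 1) * B i ∎
        right : ∀ i → (odd i - a₀ * δ₀) * (1# - a₀ * odd i * p) ≈ C i * (- 1# * f (suc i))
        right i = begin
          (odd i - a₀ * δ₀) * (1# - a₀ * odd i * p)
            ≈⟨ *-cong (+-cong (power-≈ (odd↦ i)) (-‿cong (E-inverse (+ 1))))
                 (trans (1-↦ (E-+′ (E-+′ (E↦ (+ 1)) (odd↦ i)) p↦)) (1-E-≡ (solveℤ 1 (λ i → # 1 ⊕ (# 2 ⊕ # 4 ⊗ i) ⊕ # 2 :≡ # 1 ⊕ # 4 ⊗ (# 1 ⊕ i)) ≡.refl (+ i)))) ⟩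
          (E (+ 2 ℤ.+ + 4 ℤ.* + i) - 1#) * f (suc i)
            ≈⟨ solve 2 (λ x y → (x :- I) :* y := (I :- x) :* (:- I :* y)) refl (E (+ 2 ℤ.+ + 4 ℤ.* + i)) (f (suc i)) ⟩
          C i * (- 1# * f (suc i)) ∎

      ζ : ℕ → Carrier
      ζ i = z i * (recip (A i) * recip (A i))

      -- `ρ` is the quotient of the two shifted factorials on the right-hand side, `Y` the sum over
      -- j divided by (1 - q)², and `V` the whole right-hand side multiplied by 1 - q.
      Y ρ V : Carrier
      Y = Σ m ζ
      ρ = hyper (λ i → 1# - E (+ 2 ℤ.+ + 4 ℤ.* + i)) A m
      V = (1# - E ν) * (E (ℤ.- + m) * ρ) * (1# - (1# - E ν) * (1# - E ν) * Y)

      unit-A : ∀ i → Unit (A i)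
      unit-A i = unit-1-E (positive-≢0 4 i 3 (ℤ.+-comm (+ 4) (+ 4 ℤ.* + i)))

      S-closed : ∀ {K} → m ℕ.+ m < K → S a₀ σ₁ δ₀ K ≈ (1# - E ν) * (E (ℤ.- + m) * ρ)
      S-closed {K} m<K = unit-cancel (unit-* (Π-unit m λ i _ → unit-A i) (unit-E (+ m))) (begin
        Π m A * E (+ m) * S a₀ σ₁ δ₀ K              ≈⟨ T-value m<K ⟩
        Π m C * (1# - E ν)                          ≈⟨ *-congʳ (hyper-Π m λ i _ → unit-A i) ⟨
        ρ * Π m A * (1# - E ν)                      ≈⟨ solve 3 (λ r a c → r :* a :* c := a :* I :* (c :* r)) refl ρ (Π m A) (1# - E ν) ⟩
        Π m A * 1# * ((1# - E ν) * ρ)               ≈⟨ *-congʳ (*-congˡ (E-inverse (+ m))) ⟨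
        Π m A * (E (+ m) * E (ℤ.- + m)) * ((1# - E ν) * ρ)
          ≈⟨ solve 5 (λ a e i c r → a :* (e :* i) :* (c :* r) := a :* e :* (c :* (i :* r))) refl (Π m A) (E (+ m)) (E (ℤ.- + m)) (1# - E ν) ρ ⟩
        Π m A * E (+ m) * ((1# - E ν) * (E (ℤ.- + m) * ρ)) ∎)
        where
        C : ℕ → Carrier
        C i = 1# - E (+ 2 ℤ.+ + 4 ℤ.* + i)

    -- Denominators modulo a cyclotomic polynomial

    module Residues (Int : Carrier → Set) (isSubring : IsSubring F Int) (int-Q : Int Q) (int-Q⁻¹ : Int Q⁻¹) where
      open Integrality F reciprocal Int isSubring

      int-E : ∀ z → Int (E z)
      int-E (+ n)    = int-^ n int-Q
      int-E -[1+ n ] = int-^ (suc n) int-Q⁻¹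

      int-1-E : ∀ z → Int (1# - E z)
      int-1-E z = int-minus int-1 (int-E z)

      int-p^ : ∀ k → Int (p ^ k)
      int-p^ k = int-^ k (int-E (+ 2))

      Nᵏ Dᵏ : ℕ → Carrier
      Nᵏ k = N a₀ σ₀ δ₀ (p ^ k)
      Dᵏ k = D a₀ σ₀ δ₀ (p ^ k)

      int-N : ∀ k → Int (Nᵏ k)
      int-N k = int-* (int-* (int-* (int-minus int-1 (int-* (int-E (+ 1)) (int-p^ k)))
        (int-+ (int-minus int-1 (int-* (int-+ (int-E (+ 1)) (int-E (+ 1))) (int-p^ k))) (int-* (int-E (+ 2)) (int-* (int-p^ k) (int-p^ k)))))
        (int-* (int-* (int-E (+ 2)) (int-E (+ 1))) (int-p^ k)))
        (int-minus (int-E -[1+ 0 ]) (int-* (int-p^ k) (int-p^ k)))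

      -- The hypothesis `odd-e` says that 2 is cancellable modulo e; so e divides neither 2 (k + 1)
      -- nor 4 (k + 1) unless it divides k + 1.
      module Modulo (e : ℕ) (odd-e : ∀ c → e ℕ.∣ 2 ℕ.* c → e ℕ.∣ c)
        (intUnit-1-E : ∀ z → ¬ e ℕ.∣ ∣ z ∣ → IntUnit (1# - E z)) where

        ∤-2 : ∀ {z} k w → ¬ e ℕ.∣ suc k → z ≡ + 2 ℤ.* (+ 1 ℤ.+ + k) ℤ.+ + e ℤ.* w → ¬ e ℕ.∣ ∣ z ∣
        ∤-2 k w e∤k eq = ∤-mod {c = 2 ℕ.* suc k} w (λ d → e∤k (odd-e (suc k) d))
          (≡.trans eq (≡.cong (ℤ._+ + e ℤ.* w) (≡.sym (ℤ.pos-* 2 (suc k)))))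

        ∤-4 : ∀ {z} k w → ¬ e ℕ.∣ suc k → z ≡ + 4 ℤ.* (+ 1 ℤ.+ + k) ℤ.+ + e ℤ.* w → ¬ e ℕ.∣ ∣ z ∣
        ∤-4 k w e∤k eq = ∤-mod {c = 4 ℕ.* suc k} w (λ d → e∤k (odd-e (suc k) (odd-e (2 ℕ.* suc k) (≡.subst (e ℕ.∣_) (ℕ.*-assoc 2 2 (suc k)) d))))
          (≡.trans eq (≡.cong (ℤ._+ + e ℤ.* w) (≡.sym (ℤ.pos-* 4 (suc k)))))

        intUnit-2 : ∀ {z} k w → ¬ e ℕ.∣ suc k → z ≡ + 2 ℤ.* (+ 1 ℤ.+ + k) ℤ.+ + e ℤ.* w → IntUnit (1# - E z)
        intUnit-2 {z} k w e∤k eq = intUnit-1-E z (∤-2 {z} k w e∤k eq)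

        intUnit-4 : ∀ {z} k w → ¬ e ℕ.∣ suc k → z ≡ + 4 ℤ.* (+ 1 ℤ.+ + k) ℤ.+ + e ℤ.* w → IntUnit (1# - E z)
        intUnit-4 {z} k w e∤k eq = intUnit-1-E z (∤-4 {z} k w e∤k eq)

        a₀-residue : a₀ ↦ + 1 ℤ.- + e ℤ.* 0ℤ
        a₀-residue = power (E-≡ (solveℤ 1 (λ e → # 1 :≡ # 1 ⊝ e ⊗ # 0) ≡.refl (+ e)))

        b₀-residue : a₀ ↦ + 1 ℤ.+ + e ℤ.* 0ℤ
        b₀-residue = power (E-≡ (solveℤ 1 (λ e → # 1 :≡ # 1 ⊕ e ⊗ # 0) ≡.refl (+ e)))

        δ₀-residue : δ₀ ↦ ℤ.- (+ 1) ℤ.+ + e ℤ.* 0ℤ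
        δ₀-residue = power (E-≡ (solveℤ 1 (λ e → ⊝ # 1 :≡ ⊝ # 1 ⊕ e ⊗ # 0) ≡.refl (+ e)))

        p^-residue : ∀ k → p ^ k ↦ + 2 ℤ.* + k ℤ.+ + e ℤ.* 0ℤ
        p^-residue k = power (trans (power-≈ (p^↦ k)) (E-≡ (solveℤ 2 (λ e k → # 2 ⊗ k :≡ # 2 ⊗ k ⊕ e ⊗ # 0) ≡.refl (+ e) (+ k))))

        -- Only residues of exponents modulo e matter: those in D are congruent to 4 (k + 1) three
        -- times and to 2 (k + 1) once. Thus one lemma covers the corners of the cube as well as the
        -- blocks shifted by multiples of e.
        intUnit-D : ∀ {a b b′ δ x} i s t l k → a ↦ + 1 ℤ.- + e ℤ.* i → b ↦ + 1 ℤ.+ + e ℤ.* s → b′ ↦ + 1 ℤ.- + e ℤ.* s →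
          δ ↦ ℤ.- (+ 1) ℤ.+ + e ℤ.* l → x ↦ + 2 ℤ.* + k ℤ.+ + e ℤ.* t → ¬ e ℕ.∣ suc k → IntUnit (D a (b + b′) δ x)
        intUnit-D i s t l k ea eb eb′ eδ ex e∤k = intUnit-resp (sym (D-E ea eb eb′ eδ ex (solveℤ 2 (λ e s → # 1 ⊕ e ⊗ s ⊕ (# 1 ⊝ e ⊗ s) :≡ # 2) ≡.refl (+ e) s)))
          (intUnit-* (intUnit-* (intUnit-4 k (+ 2 ℤ.* t) e∤k (solveℤ 3 (λ k e t → # 4 ⊕ (# 2 ⊗ k ⊕ e ⊗ t ⊕ (# 2 ⊗ k ⊕ e ⊗ t)) :≡ # 4 ⊗ (# 1 ⊕ k) ⊕ e ⊗ (# 2 ⊗ t)) ≡.refl (+ k) (+ e) t))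
            (intUnit-*
              (intUnit-4 k (s ℤ.- i ℤ.+ + 2 ℤ.* t) e∤k (solveℤ 5 (λ k e t i s → # 1 ⊝ e ⊗ i ⊕ (# 1 ⊕ e ⊗ s) ⊕ # 2 ⊕ (# 2 ⊗ k ⊕ e ⊗ t ⊕ (# 2 ⊗ k ⊕ e ⊗ t)) :≡ # 4 ⊗ (# 1 ⊕ k) ⊕ e ⊗ (s ⊝ i ⊕ # 2 ⊗ t)) ≡.refl (+ k) (+ e) t i s))
              (intUnit-4 k (ℤ.- s ℤ.- i ℤ.+ + 2 ℤ.* t) e∤k (solveℤ 5 (λ k e t i s → # 1 ⊝ e ⊗ i ⊕ (# 1 ⊝ e ⊗ s) ⊕ # 2 ⊕ (# 2 ⊗ k ⊕ e ⊗ t ⊕ (# 2 ⊗ k ⊕ e ⊗ t)) :≡ # 4 ⊗ (# 1 ⊕ k) ⊕ e ⊗ (⊝ s ⊝ i ⊕ # 2 ⊗ t)) ≡.refl (+ k) (+ e) t i s))))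
            (intUnit-2 k (l ℤ.- i ℤ.+ t) e∤k (solveℤ 5 (λ k e t i l → # 1 ⊝ e ⊗ i ⊕ (⊝ # 1 ⊕ e ⊗ l) ⊕ # 2 ⊕ (# 2 ⊗ k ⊕ e ⊗ t) :≡ # 2 ⊗ (# 1 ⊕ k) ⊕ e ⊗ (l ⊝ i ⊕ t)) ≡.refl (+ k) (+ e) t i l)))

      -- The congruence modulo (1 - qⁿ)⁴

      module Prime-power (m : ℕ) (n : ℕ) (n≡ : + n ≡ + 4 ℤ.* + m ℤ.+ + 1)
        (odd-n : ∀ c → n ℕ.∣ 2 ℕ.* c → n ℕ.∣ c)
        (intUnit-1-E : ∀ z → ¬ n ℕ.∣ ∣ z ∣ → IntUnit (1# - E z))
        (n∤ : ∀ k → k < m ℕ.+ m → ¬ n ℕ.∣ suc k) where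
        open Values m
        open Modulo n odd-n intUnit-1-E

        c : Carrier
        c = 1# - E ν

        int-c : Int c
        int-c = int-1-E ν

        K : ℕ
        K = suc (m ℕ.+ m)

        private
          bit : Bool → ℤ
          bit false = 0ℤ
          bit true  = 1ℤ

          a↦ : ∀ b → choose a₀ a₁ b ↦ + 1 ℤ.- + n ℤ.* bit b
          a↦ false = a₀-residue
          a↦ true  = power (E-≡ (≡.trans (≡.cong (λ z → + 1 ℤ.- z) (≡.sym n≡)) (solveℤ 1 (λ n → # 1 ⊝ n :≡ # 1 ⊝ n ⊗ # 1) ≡.refl (+ n))))

          b₁↦ : b₁ ↦ + 1 ℤ.+ + n ℤ.* 1ℤ
          b₁↦ = power (E-≡ (≡.trans (≡.cong (λ z → + 1 ℤ.+ z) (≡.sym n≡)) (solveℤ 1 (λ n → # 1 ⊕ n :≡ # 1 ⊕ n ⊗ # 1) ≡.refl (+ n))))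

          δ↦ : ∀ b → choose δ₀ δ₁ b ↦ ℤ.- (+ 1) ℤ.+ + n ℤ.* bit b
          δ↦ false = δ₀-residue
          δ↦ true  = power (E-≡ (≡.trans (≡.cong (ℤ._- + 1) (≡.sym n≡)) (solveℤ 1 (λ n → n ⊝ # 1 :≡ ⊝ # 1 ⊕ n ⊗ # 1) ≡.refl (+ n))))

          intUnit-corner : ∀ k → k < m ℕ.+ m → ∀ i j l → IntUnit (D (choose a₀ a₁ i) (choose σ₀ σ₁ j) (choose δ₀ δ₁ l) (p ^ k))
          intUnit-corner k k<K i false l = intUnit-D (bit i) 0ℤ 0ℤ (bit l) k (a↦ i) b₀-residue a₀-residue (δ↦ l) (p^-residue k) (n∤ k k<K)
          intUnit-corner k k<K i true  l = intUnit-D (bit i) 1ℤ 0ℤ (bit l) k (a↦ i) b₁↦ (a↦ true) (δ↦ l) (p^-residue k) (n∤ k k<K)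

          c∣a : c ∣ a₁ - a₀
          c∣a = E (+ 1 ℤ.- ν) , int-E (+ 1 ℤ.- ν) , trans
            (+-congˡ (-‿cong (sym (trans (E-+ (+ 1 ℤ.- ν) ν) (E-≡ (solveℤ 1 (λ ν → # 1 ⊝ ν ⊕ ν :≡ # 1) ≡.refl ν))))))
            (solve 2 (λ x y → x :- x :* y := (I :- y) :* x) refl (E (+ 1 ℤ.- ν)) (E ν))

          c∣δ : c ∣ δ₁ - δ₀
          c∣δ = - E -[1+ 0 ] , int-neg (int-E -[1+ 0 ]) , trans (+-congʳ (sym (E-+ ν -[1+ 0 ])))
            (solve 2 (λ x y → y :* x :- x := (I :- y) :* (:- x)) refl (E -[1+ 0 ]) (E ν))

          c²∣σ : c * c ∣ σ₁ - σ₀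
          c²∣σ = E (+ 1 ℤ.- ν) , int-E (+ 1 ℤ.- ν) , (begin
            E (+ 1 ℤ.+ ν) + x - (E (+ 1) + E (+ 1))
              ≈⟨ +-cong (+-congʳ (sym (trans (*-congʳ xy) (E-+ (+ 1) ν)))) (-‿cong (+-cong (sym xy) (sym xy))) ⟩
            x * y * y + x - (x * y + x * y)
              ≈⟨ (solve 2 (λ x y → x :* y :* y :+ x :- (x :* y :+ x :* y) := (I :- y) :* (I :- y) :* x) refl x y) ⟩
            c * c * x ∎)
            where
            x = E (+ 1 ℤ.- ν)
            y = E ν
            xy : x * y ≈ E (+ 1)
            xy = trans (E-+ (+ 1 ℤ.- ν) ν) (E-≡ (solveℤ 1 (λ ν → # 1 ⊝ ν ⊕ ν :≡ # 1) ≡.refl ν))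

          f : Vec Bool 3 → Carrier
          f v = S (choose a₀ a₁ (head v)) (choose σ₀ σ₁ (head (tail v))) (choose δ₀ δ₁ (head (tail (tail v)))) K

          good-f : Good (c ∷ c * c ∷ c ∷ []) f
          good-f = good-sum p unit-p (int-E (+ 2)) (c ∷ c * c ∷ c ∷ []) (int-c , int-* int-c int-c , int-c , tt)
            (λ v → choose a₀ a₁ (head v)) (λ v → choose σ₀ σ₁ (head (tail v))) (λ v → choose δ₀ δ₁ (head (tail (tail v)))) (λ _ k → p ^ k) (m ℕ.+ m)
            (good-head c (c * c ∷ c ∷ []) a₀ a₁ (int-E (+ 1)) c∣a)
            (good-tail c (c * c ∷ c ∷ []) {λ v → choose σ₀ σ₁ (head v)} (good-head (c * c) (c ∷ []) σ₀ σ₁ (int-+ (int-E (+ 1)) (int-E (+ 1))) c²∣σ))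
            (good-tail c (c * c ∷ c ∷ []) {λ v → choose δ₀ δ₁ (head (tail v))} (good-tail (c * c) (c ∷ []) {λ v → choose δ₀ δ₁ (head v)} (good-head c [] δ₀ δ₁ (int-E -[1+ 0 ]) c∣δ)))
            (λ k _ → good-const (c ∷ c * c ∷ c ∷ []) (int-p^ k))
            (λ { k k<K (i ∷ j ∷ l ∷ []) → intUnit-corner k k<K i j l })

        S₀₀ S₀₁ S₁₀ S₁₁ : Carrier
        S₀₀ = S a₀ σ₀ δ₀ K
        S₀₁ = S a₀ σ₀ δ₁ K
        S₁₀ = S a₀ σ₁ δ₀ K
        S₁₁ = S a₀ σ₁ δ₁ K

        c⁴ : Carrier
        c⁴ = c * c * (c * c)

        -- The mixed difference over the three edges is a multiple of c · c² · c, and the corners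
        -- with a₁ vanish. The edge in a makes the remaining values multiples of c; the edges in σ
        -- and δ, taken after that, show that S₀₁ and S₁₀ agree modulo c². The indices refer to σ
        -- and δ, in this order.
        corners : (c⁴ ∣ S₀₀ - (S₁₀ + S₀₁ - S₁₁)) × (c * c ∣ S₀₁ - S₁₀) × (c ∣ S₁₀) × (c ∣ S₀₁)
        corners = extract good-f
          where
          extract : Good (c ∷ c * c ∷ c ∷ []) f → (c⁴ ∣ S₀₀ - (S₁₀ + S₀₁ - S₁₁)) × (c * c ∣ S₀₁ - S₁₀) × (c ∣ S₁₀) × (c ∣ S₀₁)
          extract (_ , g , ((ig₀₀ , l , il , el) , h , (ih₀ , k , ik , ek) , eh) , eg) =
            (- k [] , int-neg ik , (begin
              S₀₀ - (S₁₀ + S₀₁ - S₁₁)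
                ≈⟨ +-cong (v₀₀ S-zero₀₀′) (-‿cong (+-cong (+-cong (v₁₀ S-zero₁₀′) (v₀₁ S-zero₀₁′)) (-‿cong (v₁₁ S-zero₁₁′)))) ⟩
              - (c * g₀₀) - (- (c * g₁₀) + - (c * g₀₁) - - (c * g₁₁))
                ≈⟨ +-congˡ (-‿cong (+-cong (+-congʳ (-‿cong (*-congˡ (eh (false ∷ []))))) (-‿cong (-‿cong (*-congˡ (trans (eh (true ∷ [])) (+-congˡ (*-congˡ (ek [])))))))))  ⟩
              - (c * g₀₀) - (- (c * (g₀₀ + c * c * h₀)) + - (c * g₀₁) - - (c * (g₀₁ + c * c * (h₀ + c * k []))))
                ≈⟨ solve 5 (λ c a b h k → :- (c :* a) :- (:- (c :* (a :+ c :* c :* h)) :+ :- (c :* b) :- :- (c :* (b :+ c :* c :* (h :+ c :* k)))) := c :* c :* (c :* c) :* (:- k)) refl c g₀₀ g₀₁ h₀ (k []) ⟩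
              c⁴ * - k [] ∎)) ,
            (c * h₀ - l [] , int-minus (int-* int-c ih₀) il , (begin
              S₀₁ - S₁₀
                ≈⟨ +-cong (v₀₁ S-zero₀₁′) (-‿cong (v₁₀ S-zero₁₀′)) ⟩
              - (c * g₀₁) - - (c * g₁₀)
                ≈⟨ +-cong (-‿cong (*-congˡ (el []))) (-‿cong (-‿cong (*-congˡ (eh (false ∷ []))))) ⟩
              - (c * (g₀₀ + c * l [])) - - (c * (g₀₀ + c * c * h₀))
                ≈⟨ solve 4 (λ c a l h → :- (c :* (a :+ c :* l)) :- :- (c :* (a :+ c :* c :* h)) := c :* c :* (c :* h :- l)) refl c g₀₀ (l []) h₀ ⟩
              c * c * (c * h₀ - l []) ∎)) ,
            (- g₁₀ , int-neg (int-resp (sym (eh (false ∷ []))) (int-+ ig₀₀ (int-* (int-* int-c int-c) ih₀))) ,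
              trans (v₁₀ S-zero₁₀′) (solve 2 (λ c g → :- (c :* g) := c :* (:- g)) refl c g₁₀)) ,
            (- g₀₁ , int-neg (int-resp (sym (el [])) (int-+ ig₀₀ (int-* int-c il))) ,
              trans (v₀₁ S-zero₀₁′) (solve 2 (λ c g → :- (c :* g) := c :* (:- g)) refl c g₀₁))
            where
            g₀₀ = g (false ∷ false ∷ [])
            g₀₁ = g (false ∷ true ∷ [])
            g₁₀ = g (true ∷ false ∷ [])
            g₁₁ = g (true ∷ true ∷ [])
            h₀ = h (false ∷ [])
            S-zero₀₀′ = S-zero₀₀ ℕ.≤-refl
            S-zero₀₁′ = S-zero₀₁ ℕ.≤-refl
            S-zero₁₀′ = S-zero₁₀ ℕ.≤-refl
            S-zero₁₁′ = S-zero₁₁ ℕ.≤-refl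
            value : ∀ {x y} z → y ≈ x + c * z → y ≈ 0# → x ≈ - (c * z)
            value {x} {y} z e e₀ = begin
              x                       ≈⟨ solve 2 (λ x w → x := x :+ w :- w) refl x (c * z) ⟩
              x + c * z - c * z       ≈⟨ +-congʳ (trans (sym e) e₀) ⟩
              0# - c * z              ≈⟨ +-identityˡ _ ⟩
              - (c * z)               ∎
            v₀₀ : _ → S₀₀ ≈ - (c * g₀₀)
            v₀₀ = value g₀₀ (eg (false ∷ false ∷ []))
            v₀₁ : _ → S₀₁ ≈ - (c * g₀₁)
            v₀₁ = value g₀₁ (eg (false ∷ true ∷ []))
            v₁₀ : _ → S₁₀ ≈ - (c * g₁₀)
            v₁₀ = value g₁₀ (eg (true ∷ false ∷ []))
            v₁₁ : _ → S₁₁ ≈ - (c * g₁₁)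
            v₁₁ = value g₁₁ (eg (true ∷ true ∷ []))

        intUnit-A : ∀ i → i < m → IntUnit (A i)
        intUnit-A i i<m = intUnit-4 i 0ℤ (n∤ i (ℕ.<-≤-trans i<m (ℕ.m≤m+n m m)))
          (solveℤ 2 (λ i n → # 4 ⊕ # 4 ⊗ i :≡ # 4 ⊗ (# 1 ⊕ i) ⊕ n ⊗ # 0) ≡.refl (+ i) (+ n))

        int-A : ∀ i → Int (A i)
        int-A i = int-1-E (+ 4 ℤ.+ + 4 ℤ.* + i)

        int-z : ∀ i → Int (z i)
        int-z i = int-E (+ 4 ℤ.+ + 4 ℤ.* + i)

        int-A² : ∀ i → Int (A i * A i)
        int-A² i = int-* (int-A i) (int-A i)

        int-E-ν : Int (E (ℤ.- ν))
        int-E-ν = int-E (ℤ.- ν)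

        int-y : ∀ i → i < m → Int (ζ i)
        int-y i i<m = int-* (int-z i) (int-* (int-recip (intUnit-A i i<m)) (int-recip (intUnit-A i i<m)))

        y-≈ : ∀ i → i < m → z i ≈ A i * A i * ζ i
        y-≈ i i<m = sym (begin
          A i * A i * (z i * (r * r))    ≈⟨ solve 3 (λ a z r → a :* a :* (z :* (r :* r)) := z :* (a :* r :* (a :* r))) refl (A i) (z i) r ⟩
          z i * (A i * r * (A i * r))    ≈⟨ *-congˡ (*-cong e e) ⟩
          z i * (1# * 1#)                ≈⟨ solve 1 (λ z → z :* (I :* I) := z) refl (z i) ⟩
          z i                            ∎)
          where
          r = recip (A i)
          e = recip-inverse (intUnit⇒unit (intUnit-A i i<m))

        Πa Πb : Carrier
        Πa = Π m (λ i → A i * A i)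
        Πb = Π m (λ i → A i * A i - z i * s)

        int-s : Int s
        int-s = int-* int-E-ν (int-* int-c int-c)

        int-Y : Int Y
        int-Y = int-Σ m int-y

        int-Πa : Int Πa
        int-Πa = int-Π m (λ i _ → int-A² i)

        -- Each factor is A² (1 - s ζ), and the product is expanded to first order in s. The
        -- remainder keeps an explicit integral cofactor, as s² is a multiple of c⁴.
        Πb-expansion : ∀ j → j ≤ m → ∃ λ w → Int w ×
          Π j (λ i → A i * A i - z i * s) ≈ Π j (λ i → A i * A i) * (1# - s * Σ j ζ) + s * s * w
        Πb-expansion zero    _   = 0# , int-0 , solve 1 (λ s → I := I :* (I :- s :* O) :+ s :* s :* O) refl s
        Πb-expansion (suc j) j<m with Πb-expansion j (ℕ.<⇒≤ j<m)
        ... | w , iw , e = P * (A j * A j) * Σ j ζ * ζ j + w * (A j * A j - z j * s) ,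
          int-+ (int-* (int-* (int-* (int-Π j λ i _ → int-A² i) (int-A² j))
                  (int-Σ j λ i i<j → int-y i (ℕ.<-trans i<j j<m))) (int-y j j<m))
                (int-* iw (int-minus (int-A² j) (int-* (int-z j) int-s))) , (begin
          Π j (λ i → A i * A i - z i * s) * (A j * A j - z j * s)
            ≈⟨ *-congʳ e ⟩
          (P * (1# - s * Σ j ζ) + s * s * w) * (A j * A j - z j * s)
            ≈⟨ solve 6 (λ P s S w b z → (P :* (I :- s :* S) :+ s :* s :* w) :* (b :- z :* s) := P :* (I :- s :* S) :* (b :- z :* s) :+ s :* s :* (w :* (b :- z :* s))) refl P s (Σ j ζ) w (A j * A j) (z j) ⟩
          P * (1# - s * Σ j ζ) * (A j * A j - z j * s) + s * s * (w * (A j * A j - z j * s))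
            ≈⟨ +-congʳ (*-congˡ (+-congˡ (-‿cong (*-congʳ (y-≈ j j<m))))) ⟩
          P * (1# - s * Σ j ζ) * (A j * A j - A j * A j * ζ j * s) + s * s * (w * (A j * A j - z j * s))
            ≈⟨ solve 6 (λ P s S b y v → P :* (I :- s :* S) :* (b :- b :* y :* s) :+ s :* s :* v := P :* b :* (I :- s :* (S :+ y)) :+ s :* s :* (P :* b :* S :* y :+ v)) refl P s (Σ j ζ) (A j * A j) (ζ j) (w * (A j * A j - z j * s)) ⟩
          P * (A j * A j) * (1# - s * (Σ j ζ + ζ j)) + s * s * (P * (A j * A j) * Σ j ζ * ζ j + w * (A j * A j - z j * s)) ∎)
          where P = Π j (λ i → A i * A i)

        intUnit-Πb : IntUnit Πb
        intUnit-Πb = intUnit-Π m λ i i<m → intUnit-resp (sym (factor₁ i)) (intUnit-*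
          (intUnit-4 i (+ 1) (n∤ i (ℕ.<-≤-trans i<m (ℕ.m≤m+n m m))) (≡.trans (≡.cong (λ w → + 3 ℤ.+ (+ 1 ℤ.+ w) ℤ.+ + 4 ℤ.* + i) (≡.sym n≡)) (solveℤ 2 (λ i n → # 3 ⊕ (# 1 ⊕ n) ⊕ # 4 ⊗ i :≡ # 4 ⊗ (# 1 ⊕ i) ⊕ n ⊗ # 1) ≡.refl (+ i) (+ n))))
          (intUnit-4 i (ℤ.- (+ 1)) (n∤ i (ℕ.<-≤-trans i<m (ℕ.m≤m+n m m))) (≡.trans (≡.cong (λ w → + 3 ℤ.+ (+ 1 ℤ.- w) ℤ.+ + 4 ℤ.* + i) (≡.sym n≡)) (solveℤ 2 (λ i n → # 3 ⊕ (# 1 ⊝ n) ⊕ # 4 ⊗ i :≡ # 4 ⊗ (# 1 ⊕ i) ⊕ n ⊗ (⊝ # 1)) ≡.refl (+ i) (+ n)))))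

        s-≈ : s ≈ c * c * E (ℤ.- ν)
        s-≈ = *-comm _ _

        c²∣s : c * c ∣ s
        c²∣s = E (ℤ.- ν) , int-E-ν , s-≈

        -- (S₀₁ − S₁₁) Πb = S₀₁ (Πb − Πa), and S₀₁ ≡ S₁₀ modulo c².
        difference : c⁴ ∣ S₀₁ - S₁₁ + S₁₀ * (c * c * Y)
        difference = ∣-cancel intUnit-Πb (∣-resp (sym equation)
          (∣-+ (∣-+ (∣-neg (∣-*ˡ (int-* int-Πa int-Y) first))
                    (∣-*ˡ int-1 (∣-*ʳ (∣-*ˡ (∣⇒int int-c c∣S₀₁) (∣-* c²∣s c²∣s)) iw)))
               (∣-*ʳ (∣-* c²∣c²T second) int-Y)))
          where
          w = proj₁ (Πb-expansion m ℕ.≤-refl)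
          iw = proj₁ (proj₂ (Πb-expansion m ℕ.≤-refl))
          eb = proj₂ (proj₂ (Πb-expansion m ℕ.≤-refl))
          c²∣S₀₁-S₁₀ = proj₁ (proj₂ corners)
          c∣S₁₀ = proj₁ (proj₂ (proj₂ corners))
          c∣S₀₁ = proj₂ (proj₂ (proj₂ corners))
          c²∣c²T : c * c ∣ c * c * S₁₀
          c²∣c²T = S₁₀ , ∣⇒int int-c c∣S₁₀ , refl
          second : c * c ∣ s * (s * w - Πa * Y)
          second = ∣-*ʳ c²∣s (int-minus (int-* int-s iw) (int-* int-Πa int-Y))
          E-ν-1 : E (ℤ.- ν) - 1# ≈ c * E (ℤ.- ν)
          E-ν-1 = trans (+-congˡ (-‿cong (sym (E-inverse ν)))) (solve 2 (λ u v → v :- u :* v := (I :- u) :* v) refl (E ν) (E (ℤ.- ν)))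
          -- Since s = c² q^(-ν), the quotient by c² is (S₀₁ - S₁₀) q^(-ν) + S₁₀ (q^(-ν) - 1). The
          -- first summand contains c² by `corners`; in the second, each factor contributes one c.
          first : c⁴ ∣ S₀₁ * s - S₁₀ * (c * c)
          first = ∣-resp (begin
            c * c * ((S₀₁ - S₁₀) * E (ℤ.- ν) + S₁₀ * (c * E (ℤ.- ν)))
              ≈⟨ *-congˡ (+-congˡ (*-congˡ E-ν-1)) ⟨
            c * c * ((S₀₁ - S₁₀) * E (ℤ.- ν) + S₁₀ * (E (ℤ.- ν) - 1#))
              ≈⟨ solve 4 (λ c a t v → c :* c :* ((a :- t) :* v :+ t :* (v :- I)) := a :* (c :* c :* v) :- t :* (c :* c)) refl c S₀₁ S₁₀ (E (ℤ.- ν)) ⟩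
            S₀₁ * (c * c * E (ℤ.- ν)) - S₁₀ * (c * c)
              ≈⟨ +-congʳ (*-congˡ s-≈) ⟨
            S₀₁ * s - S₁₀ * (c * c) ∎)
            (∣-* {c * c} {c * c} (1# , int-1 , sym (*-identityʳ _)) (∣-+ (∣-*ʳ c²∣S₀₁-S₁₀ (int-E-ν)) (∣-* c∣S₁₀ (E (ℤ.- ν) , int-E-ν , refl))))
          equation : Πb * (S₀₁ - S₁₁ + S₁₀ * (c * c * Y)) ≈
            - (Πa * Y * (S₀₁ * s - S₁₀ * (c * c))) + 1# * (S₀₁ * (s * s) * w) + c * c * S₁₀ * (s * (s * w - Πa * Y)) * Y
          equation = begin
            Πb * (S₀₁ - S₁₁ + S₁₀ * (c * c * Y))
              ≈⟨ solve 5 (λ b x y t k → b :* (x :- y :+ t :* k) := b :* x :- b :* y :+ t :* k :* b) refl Πb S₀₁ S₁₁ S₁₀ (c * c * Y) ⟩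
            Πb * S₀₁ - Πb * S₁₁ + S₁₀ * (c * c * Y) * Πb
              -- `Πb * S₁₁` and `Πa * S₀₁` are both equal to `R`.
              ≈⟨ +-congʳ (+-congˡ (-‿cong (trans (S-value₁ (s≤s (ℕ.m≤m+n m m))) (sym (S-value₀ (s≤s (ℕ.m≤m+n m m)) δ₁↦))))) ⟩
            Πb * S₀₁ - Πa * S₀₁ + S₁₀ * (c * c * Y) * Πb
              ≈⟨ +-cong (+-congʳ (*-congʳ eb)) (*-congˡ eb) ⟩
            (Πa * (1# - s * Y) + s * s * w) * S₀₁ - Πa * S₀₁ + S₁₀ * (c * c * Y) * (Πa * (1# - s * Y) + s * s * w)
              ≈⟨ solve 7 (λ a s Y w x t c → (a :* (I :- s :* Y) :+ s :* s :* w) :* x :- a :* x :+ t :* (c :* c :* Y) :* (a :* (I :- s :* Y) :+ s :* s :* w)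
                   := :- (a :* Y :* (x :* s :- t :* (c :* c))) :+ I :* (x :* (s :* s) :* w) :+ c :* c :* t :* (s :* (s :* w :- a :* Y)) :* Y) refl Πa s Y w S₀₁ S₁₀ c ⟩
            - (Πa * Y * (S₀₁ * s - S₁₀ * (c * c))) + 1# * (S₀₁ * (s * s) * w) + c * c * S₁₀ * (s * (s * w - Πa * Y)) * Y ∎

        main-congruence : c⁴ ∣ S₀₀ - S₁₀ * (1# - c * c * Y)
        main-congruence = ∣-resp (solve 5 (λ g t a b k → g :- (t :+ a :- b) :+ (a :- b :+ t :* k) := g :- t :* (I :- k)) refl S₀₀ S₁₀ S₀₁ S₁₁ (c * c * Y))
          (∣-+ (proj₁ corners) difference)

        module _ (n∤′ : ∀ k → k < m ℕ.+ m ℕ.+ (m ℕ.+ m) → ¬ n ℕ.∣ suc k) (m>0 : 0 < m) where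

          private
            L : ℕ
            L = m ℕ.+ m ℕ.+ (m ℕ.+ m)

            intUnit-Dᵏ : ∀ k → k < L → IntUnit (Dᵏ k)
            intUnit-Dᵏ k k<n = intUnit-D 0ℤ 0ℤ 0ℤ 0ℤ k a₀-residue b₀-residue a₀-residue δ₀-residue (p^-residue k) (n∤′ k k<n)

            keep : ∀ {d} j → d ∣ κ a₀ σ₀ δ₀ j → ∀ r → j ℕ.+ r ≤ L → d ∣ κ a₀ σ₀ δ₀ (j ℕ.+ r)
            keep j dj r h = ∣-hyper j r dj (λ i _ → int-N (j ℕ.+ i))
              (λ i i<r → intUnit-Dᵏ (j ℕ.+ i) (ℕ.<-≤-trans (ℕ.+-monoʳ-< j i<r) h))

            2m≤ : m ℕ.+ m ≤ L
            2m≤ = ℕ.m≤m+n _ _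

            m<2m : m < m ℕ.+ m
            m<2m = ℕ.<-≤-trans (ℕ.≤-reflexive (ℕ.+-comm 1 m)) (ℕ.+-monoʳ-≤ m m>0)

            c∣Nm : c ∣ Nᵏ m
            c∣Nm = ∣-*ˡ (int-* (int-* (int-minus int-1 (int-* (int-E (+ 1)) (int-p^ m)))
                (int-+ (int-minus int-1 (int-* (int-+ (int-E (+ 1)) (int-E (+ 1))) (int-p^ m))) (int-* (int-E (+ 2)) (int-* (int-p^ m) (int-p^ m)))))
                (int-* (int-* (int-E (+ 2)) (int-E (+ 1))) (int-p^ m)))
              (E -[1+ 0 ] , int-E -[1+ 0 ] , (begin
                E -[1+ 0 ] - p ^ m * p ^ m
                  ≈⟨ +-congˡ (-‿cong (trans (power-≈ (E-+′ (p^↦ m) (p^↦ m))) (trans (E-≡ (solveℤ 2 (λ m ν → # 2 ⊗ m ⊕ # 2 ⊗ m :≡ # 4 ⊗ m ⊕ # 1 ⊝ # 1) ≡.refl (+ m) ν)) (sym (E-+ ν -[1+ 0 ]))))) ⟩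
                E -[1+ 0 ] - E ν * E -[1+ 0 ]
                  ≈⟨ solve 2 (λ u v → v :- u :* v := (I :- u) :* v) refl (E ν) (E -[1+ 0 ]) ⟩
                c * E -[1+ 0 ] ∎))

            c³∣N2m : c * (c * c) ∣ Nᵏ (m ℕ.+ m)
            c³∣N2m = ∣-*ʳ (∣-*ʳ (∣-* (one , int-1 , trans e₁ (sym (*-identityʳ c)))
                (one , int-1 , trans (trans (quad-factor (p ^ (m ℕ.+ m)) (E-+ (+ 1) (+ 1))) (*-cong e₁ e₁)) (sym (*-identityʳ _))))
                (int-* (int-* (int-E (+ 2)) (int-E (+ 1))) (int-p^ (m ℕ.+ m))))
              (int-minus (int-E -[1+ 0 ]) (int-* (int-p^ (m ℕ.+ m)) (int-p^ (m ℕ.+ m))))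
              where
              one = 1#
              e₁ : 1# - E (+ 1) * p ^ (m ℕ.+ m) ≈ c
              e₁ = trans (1-↦ (E-+′ (E↦ (+ 1)) (p^↦ (m ℕ.+ m)))) (1-E-≡ (solveℤ 1 (λ m → # 1 ⊕ # 2 ⊗ (m ⊕ m) :≡ # 4 ⊗ m ⊕ # 1) ≡.refl (+ m)))

            c∣κ2m : c ∣ κ a₀ σ₀ δ₀ (m ℕ.+ m)
            c∣κ2m = ≡.subst (λ i → c ∣ κ a₀ σ₀ δ₀ i) (ℕ.m+[n∸m]≡n m<2m)
              (keep (suc m) (∣-*ˡ int-κm (∣-*ʳ c∣Nm (int-recip (intUnit-Dᵏ m (ℕ.<-≤-trans m<2m 2m≤))))) (m ℕ.+ m ℕ.∸ suc m)
                (≡.subst (_≤ L) (≡.sym (ℕ.m+[n∸m]≡n m<2m)) 2m≤))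
              where
              int-κm : Int (κ a₀ σ₀ δ₀ m)
              int-κm = int-hyper m (λ j _ → int-N j) (λ j j<m → intUnit-Dᵏ j (ℕ.<-trans j<m (ℕ.<-≤-trans m<2m 2m≤)))

            -- One factor c enters at index m, where δ₀ - x² is q⁻¹ (1 - qⁿ), and three at index 2
            -- m, where 1 - q x and both factors of `quad` equal 1 - qⁿ. The two indices are
            -- distinct as m > 0. These are the terms after (n - 1) / 2, by which the two ranges of
            -- summation differ.
            c⁴∣κ : ∀ r → K ℕ.+ r ≤ L → c⁴ ∣ κ a₀ σ₀ δ₀ (K ℕ.+ r)
            c⁴∣κ r h = keep K (∣-resp-divisor (solve 1 (λ c → c :* (c :* (c :* c)) := c :* c :* (c :* c)) refl c)
              (∣-* c∣κ2m (∣-*ʳ c³∣N2m (int-recip (intUnit-Dᵏ (m ℕ.+ m) (ℕ.≤-trans (ℕ.m≤m+n K r) h)))))) r h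

          tail-congruence : c⁴ ∣ S a₀ σ₀ δ₀ (K ℕ.+ (m ℕ.+ m)) - S₀₀
          tail-congruence = ∣-resp (sym (trans (+-congʳ (Σ-+ K (m ℕ.+ m) _)) (solve 2 (λ x y → x :+ y :- x := y) refl _ _)))
            (∣-Σ (m ℕ.+ m) λ r r<2m → ∣-*ˡ (int-minus int-1 (int-* (int-E (+ 1)) (int-* (int-* (int-p^ (K ℕ.+ r)) (int-p^ (K ℕ.+ r))) (int-p^ (K ℕ.+ r)))))
              (c⁴∣κ r (≡.subst (_≤ L) (ℕ.+-suc (m ℕ.+ m) r) (ℕ.+-monoʳ-≤ (m ℕ.+ m) r<2m))))

      -- Divisibility of both sides by Φ e for a proper divisor e of n

      module Divisor (e′ h : ℕ) (e′≡ : e′ ≡ h ℕ.+ h) (m′ : ℕ) (j : ℤ) (ej≡ : + suc e′ ℤ.* j ≡ + 4 ℤ.* + m′ ℤ.+ + 1)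
        (m′≤e′ : m′ ≤ e′) (m′>0 : 0 < m′)
        (odd-e : ∀ c → suc e′ ℕ.∣ 2 ℕ.* c → suc e′ ℕ.∣ c)
        (intUnit-1-E : ∀ z → ¬ suc e′ ℕ.∣ ∣ z ∣ → IntUnit (1# - E z))
        (multiple : ∀ k → ∃ λ u → IntUnit u × 1# - E (+ suc e′ ℤ.* + suc k) ≈ (1# - E (+ suc e′)) * u) where
        open Modulo (suc e′) odd-e intUnit-1-E

        e : ℕ
        e = suc e′

        d : Carrier
        d = 1# - E (+ e)

        int-d : Int d
        int-d = int-1-E (+ e)

        unit-d : Unit d
        unit-d = unit-1-E {+ e} λ ()

        e∤ : ∀ k → k < e′ → ¬ e ℕ.∣ suc k
        e∤ k k<e′ = ℕ.>⇒∤ (s≤s k<e′)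

        d∣1-E : ∀ w → d ∣ 1# - E (+ e ℤ.* w)
        d∣1-E (+ zero)  = ∣-resp (sym (trans (1-E-≡ (ℤ.*-zeroʳ (+ e))) (-‿inverseʳ 1#))) ∣-0
        d∣1-E (+ suc k) = proj₁ (multiple k) , proj₁ (proj₁ (proj₂ (multiple k))) , proj₂ (proj₂ (multiple k))
        d∣1-E -[1+ k ]  = ∣-resp (sym (begin
          1# - E (+ e ℤ.* -[1+ k ])                      ≈⟨ +-congʳ (E-inverse (+ e ℤ.* -[1+ k ])) ⟨
          E (+ e ℤ.* -[1+ k ]) * E (ℤ.- (+ e ℤ.* -[1+ k ])) - E (+ e ℤ.* -[1+ k ])
            ≈⟨ +-congʳ (*-congˡ (E-≡ (ℤ.neg-distribʳ-* (+ e) -[1+ k ]))) ⟩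
          E (+ e ℤ.* -[1+ k ]) * E (+ e ℤ.* + suc k) - E (+ e ℤ.* -[1+ k ])
            ≈⟨ solve 2 (λ x y → x :* y :- x := (I :- y) :* (:- x)) refl (E (+ e ℤ.* -[1+ k ])) (E (+ e ℤ.* + suc k)) ⟩
          (1# - E (+ e ℤ.* + suc k)) * - E (+ e ℤ.* -[1+ k ]) ∎))
          (∣-*ʳ (d∣1-E (+ suc k)) (int-neg (int-E (+ e ℤ.* -[1+ k ]))))

        d∣1-E′ : ∀ {z} w → z ≡ + e ℤ.* w → d ∣ 1# - E z
        d∣1-E′ w ≡.refl = d∣1-E w

        at : ∀ l r → p ^ (l ℕ.* e ℕ.+ r) ↦ + 2 ℤ.* (+ l ℤ.* + e ℤ.+ + r)
        at l r = power (trans (power-≈ (p^↦ (l ℕ.* e ℕ.+ r))) (E-≡ (≡.cong (λ w → + 2 ℤ.* (w ℤ.+ + r)) (ℤ.pos-* l e))))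

        -- By `hyper-+` this is the term of index l e + r relative to the one of index l e, so a
        -- whole block is handled apart from its leading term.
        shifted : ℕ → ℕ → Carrier
        shifted l = hyper (λ r → Nᵏ (l ℕ.* e ℕ.+ r)) (λ r → Dᵏ (l ℕ.* e ℕ.+ r))

        intUnit-Dˡ : ∀ l r → r < e′ → IntUnit (Dᵏ (l ℕ.* e ℕ.+ r))
        intUnit-Dˡ l r r<e′ = intUnit-D 0ℤ 0ℤ (+ 2 ℤ.* + l) 0ℤ r a₀-residue b₀-residue a₀-residue δ₀-residue
          (power (trans (power-≈ (at l r)) (E-≡ (solveℤ 3 (λ r l e → # 2 ⊗ (l ⊗ e ⊕ r) :≡ # 2 ⊗ r ⊕ e ⊗ (# 2 ⊗ l)) ≡.refl (+ r) (+ l) (+ e))))) (e∤ r r<e′)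

        blockTerm : ℕ → ℕ → Carrier
        blockTerm l r = cube a₀ (p ^ (l ℕ.* e ℕ.+ r)) * shifted l r

        private
          -- Since e j = 4 m′ + 1, this is q^(e j - 1), congruent to δ₀ = 1 / q modulo 1 - q^e.
          -- Being an even power of p with m′ ≤ e′, it makes the series terminate within one block.
          δ′ : Carrier
          δ′ = E (+ 4 ℤ.* + m′)

          δ-of : Vec Bool 1 → Carrier
          δ-of v = choose δ′ δ₀ (head v)

          x-of : ℕ → Vec Bool 1 → ℕ → Carrier
          x-of l v k = choose (p ^ k) (p ^ (l ℕ.* e ℕ.+ k)) (head v)

          d∣δ : d ∣ δ₀ - δ′
          d∣δ = ∣-resp (begin
            (1# - E (+ 4 ℤ.* + m′ ℤ.+ + 1)) * δ₀
              ≈⟨ solve 2 (λ x y → (I :- x) :* y := y :- x :* y) refl (E (+ 4 ℤ.* + m′ ℤ.+ + 1)) δ₀ ⟩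
            δ₀ - E (+ 4 ℤ.* + m′ ℤ.+ + 1) * δ₀
              ≈⟨ +-congˡ (-‿cong (trans (E-+ (+ 4 ℤ.* + m′ ℤ.+ + 1) -[1+ 0 ]) (E-≡ (solveℤ 1 (λ m′ → # 4 ⊗ m′ ⊕ # 1 ⊝ # 1 :≡ # 4 ⊗ m′) ≡.refl (+ m′))))) ⟩
            δ₀ - δ′ ∎) (∣-*ʳ (d∣1-E′ j (≡.sym ej≡)) (int-E -[1+ 0 ]))

          d∣x : ∀ l k → d ∣ p ^ (l ℕ.* e ℕ.+ k) - p ^ k
          d∣x l k = ∣-resp (begin
            (1# - E (+ e ℤ.* (+ 2 ℤ.* + l))) * - p ^ k
              ≈⟨ solve 2 (λ u x → (I :- u) :* (:- x) := u :* x :- x) refl (E (+ e ℤ.* (+ 2 ℤ.* + l))) (p ^ k) ⟩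
            E (+ e ℤ.* (+ 2 ℤ.* + l)) * p ^ k - p ^ k
              ≈⟨ +-congʳ (trans (power-≈ (E-+′ (E↦ (+ e ℤ.* (+ 2 ℤ.* + l))) (p^↦ k)))
                   (trans (E-≡ (solveℤ 3 (λ e l k → e ⊗ (# 2 ⊗ l) ⊕ # 2 ⊗ k :≡ # 2 ⊗ (l ⊗ e ⊕ k)) ≡.refl (+ e) (+ l) (+ k))) (sym (power-≈ (at l k))))) ⟩
            p ^ (l ℕ.* e ℕ.+ k) - p ^ k ∎) (∣-*ʳ (d∣1-E (+ 2 ℤ.* + l)) (int-neg (int-p^ k)))

          intUnit-reference : ∀ k → k < e′ → IntUnit (D a₀ σ₀ δ′ (p ^ k))
          intUnit-reference k k<e′ = intUnit-D 0ℤ 0ℤ 0ℤ j k a₀-residue b₀-residue a₀-residue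
            (power (E-≡ (≡.trans (solveℤ 1 (λ m′ → # 4 ⊗ m′ :≡ ⊝ # 1 ⊕ (# 4 ⊗ m′ ⊕ # 1)) ≡.refl (+ m′)) (≡.cong (λ w → ℤ.- (+ 1) ℤ.+ w) (≡.sym ej≡)))))
            (p^-residue k) (e∤ k k<e′)

          -- A cube with a single edge of modulus d. At `false` stands the terminating reference
          -- series with δ′, at `true` the l-th block with δ₀; δ and all the x move together along
          -- the edge.
          good-block : ∀ l → Good (d ∷ []) (λ v → Σ e (λ k → cube a₀ (x-of l v k) *
            hyper (λ i → N a₀ σ₀ (δ-of v) (x-of l v i)) (λ i → D a₀ σ₀ (δ-of v) (x-of l v i)) k))
          good-block l = good-sum p unit-p (int-E (+ 2)) (d ∷ []) (int-d , tt)
            (λ _ → a₀) (λ _ → σ₀) δ-of (x-of l) e′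
            (good-const (d ∷ []) (int-E (+ 1))) (good-const (d ∷ []) (int-+ (int-E (+ 1)) (int-E (+ 1))))
            (good-head d [] δ′ δ₀ (int-E (+ 4 ℤ.* + m′)) d∣δ)
            (λ k _ → good-head d [] (p ^ k) (p ^ (l ℕ.* e ℕ.+ k)) (int-p^ k) (d∣x l k))
            (λ { k k<e′ (false ∷ []) → intUnit-reference k k<e′ ; k k<e′ (true ∷ []) → intUnit-Dˡ l k k<e′ })

          module V′ = Values m′

          -- The reference sum terminates and its value contains the factor 1 − E (e j).
          d∣reference : d ∣ S a₀ σ₀ δ′ e
          d∣reference = ∣-cancel (intUnit-Π m′ λ i i<m′ → intUnit-* (u i i<m′) (u i i<m′))
            (∣-resp (sym (V′.S-value₀ (s≤s m′≤e′) (E↦ (+ 4 ℤ.* + m′))))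
              (∣-*ˡ (int-1-E (+ 1)) (∣-Π m′ (λ i _ → int-* (int-1-E (+ 3 ℤ.+ + 4 ℤ.* + i)) (int-1-E (+ 5 ℤ.+ + 4 ℤ.* + i)))
                (ℕ.pred m′) pred< (∣-*ˡ (int-1-E (+ 3 ℤ.+ + 4 ℤ.* + ℕ.pred m′)) (d∣1-E′ j last)))))
            where
            u : ∀ i → i < m′ → IntUnit (V′.A i)
            u i i<m′ = intUnit-4 i 0ℤ (e∤ i (ℕ.<-≤-trans i<m′ m′≤e′)) (solveℤ 2 (λ i e → # 4 ⊕ # 4 ⊗ i :≡ # 4 ⊗ (# 1 ⊕ i) ⊕ e ⊗ # 0) ≡.refl (+ i) (+ e))
            suc-pred : suc (ℕ.pred m′) ≡ m′
            suc-pred = ℕ.suc-pred m′ ⦃ ℕ.>-nonZero m′>0 ⦄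
            pred< : ℕ.pred m′ < m′
            pred< = ℕ.≤-reflexive suc-pred
            last : + 5 ℤ.+ + 4 ℤ.* + ℕ.pred m′ ≡ + e ℤ.* j
            last = ≡.trans (solveℤ 1 (λ predm′ → # 5 ⊕ # 4 ⊗ predm′ :≡ # 4 ⊗ (# 1 ⊕ predm′) ⊕ # 1) ≡.refl (+ ℕ.pred m′))
              (≡.trans (≡.cong (λ w → + 4 ℤ.* + w ℤ.+ + 1) suc-pred) (≡.sym ej≡))

        d∣block : ∀ l → d ∣ Σ e (blockTerm l)
        d∣block l = extract (good-block l)
          where
          F′ : Vec Bool 1 → Carrier
          F′ v = Σ e (λ k → cube a₀ (x-of l v k) *
            hyper (λ i → N a₀ σ₀ (δ-of v) (x-of l v i)) (λ i → D a₀ σ₀ (δ-of v) (x-of l v i)) k)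
          extract : Good (d ∷ []) F′ → d ∣ Σ e (blockTerm l)
          extract (_ , g , ig , eq) = ∣-resp (sym (eq [])) (∣-+ d∣reference (g [] , ig , refl))

        -- As e = 2 h + 1, the exponent 1 + 2 (l e + h) is e (2 l + 1).
        d∣Nh₁ : ∀ l → d ∣ 1# - a₀ * p ^ (l ℕ.* e ℕ.+ h)
        d∣Nh₁ l = ∣-resp (sym (1-↦ (E-+′ (E↦ (+ 1)) (at l h))))
          (d∣1-E′ (+ 1 ℤ.+ + 2 ℤ.* + l) (≡.trans
            (≡.cong (λ w → + 1 ℤ.+ + 2 ℤ.* (+ l ℤ.* (+ 1 ℤ.+ w) ℤ.+ + h)) (≡.cong +_ e′≡)) (≡.trans
            (solveℤ 2 (λ l h → # 1 ⊕ # 2 ⊗ (l ⊗ (# 1 ⊕ (h ⊕ h)) ⊕ h) :≡ (# 1 ⊕ (h ⊕ h)) ⊗ (# 1 ⊕ # 2 ⊗ l)) ≡.refl (+ l) (+ h))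
            (≡.cong (λ w → (+ 1 ℤ.+ w) ℤ.* (+ 1 ℤ.+ + 2 ℤ.* + l)) (≡.cong +_ (≡.sym e′≡))))))

        private
          int-1-ax : ∀ k → Int (1# - a₀ * p ^ k)
          int-1-ax k = int-minus int-1 (int-* (int-E (+ 1)) (int-p^ k))

          int-pax : ∀ k → Int (p * a₀ * p ^ k)
          int-pax k = int-* (int-* (int-E (+ 2)) (int-E (+ 1))) (int-p^ k)

          int-δ-xx : ∀ k → Int (δ₀ - p ^ k * p ^ k)
          int-δ-xx k = int-minus (int-E -[1+ 0 ]) (int-* (int-p^ k) (int-p^ k))

          quad-≈ : ∀ k → quad σ₀ (p ^ k) ≈ (1# - a₀ * p ^ k) * (1# - a₀ * p ^ k)
          quad-≈ k = quad-factor (p ^ k) (E-+ (+ 1) (+ 1))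

          h<e : h < e
          h<e = s≤s (≡.subst (h ≤_) (≡.sym e′≡) (ℕ.m≤m+n h h))

        d∣shifted : ∀ l r → suc h ℕ.+ r ≤ e′ → d ∣ shifted l (suc h ℕ.+ r)
        d∣shifted l r bound = ∣-hyper (suc h) r
          (∣-*ˡ (int-hyper h (λ i _ → int-N (l ℕ.* e ℕ.+ i)) (λ i i<h → intUnit-Dˡ l i (ℕ.<-trans i<h h<e′)))
            (∣-*ʳ (∣-*ʳ (∣-*ʳ (∣-*ʳ (d∣Nh₁ l) int-quad) (int-pax (l ℕ.* e ℕ.+ h))) (int-δ-xx (l ℕ.* e ℕ.+ h)))
              (int-recip (intUnit-Dˡ l h h<e′))))
          (λ i _ → int-N (l ℕ.* e ℕ.+ (suc h ℕ.+ i)))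
          (λ i i<r → intUnit-Dˡ l (suc h ℕ.+ i) (ℕ.<-≤-trans (ℕ.+-monoʳ-< (suc h) i<r) bound))
          where
          h<e′ : h < e′
          h<e′ = ℕ.≤-trans (ℕ.m≤m+n (suc h) r) bound
          int-quad : Int (quad σ₀ (p ^ (l ℕ.* e ℕ.+ h)))
          int-quad = int-resp (sym (quad-≈ (l ℕ.* e ℕ.+ h))) (int-* (int-1-ax (l ℕ.* e ℕ.+ h)) (int-1-ax (l ℕ.* e ℕ.+ h)))

        int-cube : ∀ k → Int (cube a₀ (p ^ k))
        int-cube k = int-minus int-1 (int-* (int-E (+ 1)) (int-* (int-* (int-p^ k) (int-p^ k)) (int-p^ k)))

        -- From index h + 1 on, the terms of a block carry the factor of `d∣Nh₁`, so stopping after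
        -- h preserves divisibility. The range up to (n - 1) / 2 ends precisely in the middle of a
        -- block.
        d∣half-block : ∀ l → d ∣ Σ (suc h) (blockTerm l)
        d∣half-block l = ∣-resp (begin
          Σ e (blockTerm l) - t                      ≈⟨ +-congʳ (trans (reflexive (≡.cong (λ k → Σ (suc k) (blockTerm l)) e′≡)) (Σ-+ (suc h) h (blockTerm l))) ⟩
          Σ (suc h) (blockTerm l) + t - t            ≈⟨ solve 2 (λ x y → x :+ y :- y := x) refl _ t ⟩
          Σ (suc h) (blockTerm l)                    ∎)
          (∣-minus (d∣block l) (∣-Σ h λ r r<h → ∣-*ˡ (int-cube (l ℕ.* e ℕ.+ (suc h ℕ.+ r)))
            (d∣shifted l r (≡.subst (suc h ℕ.+ r ≤_) (≡.sym e′≡) (≡.subst (_≤ h ℕ.+ h) (ℕ.+-suc h r) (ℕ.+-monoʳ-≤ h r<h))))))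
          where t = Σ h (λ r → blockTerm l (suc h ℕ.+ r))

        private
          last-factor : ∀ {z} k → z ≡ + e ℤ.* + suc k → ∃ λ u → IntUnit u × 1# - E z ≈ d * u
          last-factor k ≡.refl = multiple k

          -- At the end of a block all exponents in the denominator are multiples of e, namely 4 e
          -- (l + 1) three times and 2 e (l + 1) once.
          Dᵏ-last : ∀ l → ∃ λ u → IntUnit u × Dᵏ (l ℕ.* e ℕ.+ e′) ≈ d * d * d * d * u
          Dᵏ-last l = u₁ * (u₁ * u₁) * u₂ , intUnit-* (intUnit-* iu₁ (intUnit-* iu₁ iu₁)) iu₂ , (begin
            Dᵏ (l ℕ.* e ℕ.+ e′)
              ≈⟨ D-E (E↦ (+ 1)) (E↦ (+ 1)) (E↦ (+ 1)) (E↦ -[1+ 0 ]) (at l e′) ≡.refl ⟩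
            (1# - E (+ 4 ℤ.+ (ξ ℤ.+ ξ))) * ((1# - E (+ 4 ℤ.+ (ξ ℤ.+ ξ))) * (1# - E (+ 4 ℤ.+ (ξ ℤ.+ ξ)))) * (1# - E (+ 2 ℤ.+ ξ))
              ≈⟨ *-cong (*-cong e₁ (*-cong e₁ e₁)) e₂ ⟩
            d * u₁ * (d * u₁ * (d * u₁)) * (d * u₂)
              ≈⟨ solve 3 (λ d u v → d :* u :* (d :* u :* (d :* u)) :* (d :* v) := d :* d :* d :* d :* (u :* (u :* u) :* v)) refl d u₁ u₂ ⟩
            d * d * d * d * (u₁ * (u₁ * u₁) * u₂) ∎)
            where
            ξ = + 2 ℤ.* (+ l ℤ.* + e ℤ.+ + e′)
            f₁ = last-factor {+ 4 ℤ.+ (ξ ℤ.+ ξ)} (l ℕ.+ 3 ℕ.* suc l) (≡.trans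
              (solveℤ 2 (λ l e′ → # 4 ⊕ (# 2 ⊗ (l ⊗ (# 1 ⊕ e′) ⊕ e′) ⊕ # 2 ⊗ (l ⊗ (# 1 ⊕ e′) ⊕ e′)) :≡ (# 1 ⊕ e′) ⊗ (# 4 ⊗ (# 1 ⊕ l))) ≡.refl (+ l) (+ e′))
              (≡.cong (+ e ℤ.*_) (≡.sym (ℤ.pos-* 4 (suc l)))))
            f₂ = last-factor {+ 2 ℤ.+ ξ} (l ℕ.+ 1 ℕ.* suc l) (≡.trans
              (solveℤ 2 (λ l e′ → # 2 ⊕ # 2 ⊗ (l ⊗ (# 1 ⊕ e′) ⊕ e′) :≡ (# 1 ⊕ e′) ⊗ (# 2 ⊗ (# 1 ⊕ l))) ≡.refl (+ l) (+ e′))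
              (≡.cong (+ e ℤ.*_) (≡.sym (ℤ.pos-* 2 (suc l)))))
            u₁ = proj₁ f₁
            iu₁ = proj₁ (proj₂ f₁)
            e₁ = proj₂ (proj₂ f₁)
            u₂ = proj₁ f₂
            iu₂ = proj₁ (proj₂ f₂)
            e₂ = proj₂ (proj₂ f₂)

          -- Index h supplies three factors d. The fourth comes from index m′, where δ₀ - x² is q⁻¹
          -- (1 - q^(e (j + 4 l))).
          d⁴∣ΠN : ∀ l → d * d * d * d ∣ Π e (λ r → Nᵏ (l ℕ.* e ℕ.+ r))
          d⁴∣ΠN l = ∣-resp-divisor (solve 1 (λ d → d :* (d :* d) :* I :* d := d :* d :* d :* d) refl d) (∣-resp (sym (begin
            Π e (λ r → Nᵏ (k r))
              ≈⟨ Π-cong e (λ r _ → *-congʳ (*-congʳ (*-congˡ (quad-≈ (k r))))) ⟩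
            Π e (λ r → f r * (f r * f r) * g r * δx r)
              ≈⟨ trans (Π-* e _ δx) (*-congʳ (trans (Π-* e _ g) (*-congʳ (trans (Π-* e f _) (*-congˡ (Π-* e f f)))))) ⟩
            Π e f * (Π e f * Π e f) * Π e g * Π e δx ∎))
            (∣-* (∣-* (∣-* d∣Πf (∣-* d∣Πf d∣Πf)) (int⇒1∣ (int-Π e λ r _ → int-pax (k r)))) d∣Πδx))
            where
            k : ℕ → ℕ
            k r = l ℕ.* e ℕ.+ r
            f g δx : ℕ → Carrier
            f r = 1# - a₀ * p ^ k r
            g r = p * a₀ * p ^ k r
            δx r = δ₀ - p ^ k r * p ^ k r
            d∣Πf : d ∣ Π e f
            d∣Πf = ∣-Π e (λ r _ → int-1-ax (k r)) h h<e (d∣Nh₁ l)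
            d∣Πδx : d ∣ Π e δx
            d∣Πδx = ∣-Π e (λ r _ → int-δ-xx (k r)) m′ (s≤s m′≤e′) (∣-resp (begin
              (1# - E (+ e ℤ.* (j ℤ.+ + 4 ℤ.* + l))) * δ₀
                ≈⟨ solve 2 (λ x y → (I :- x) :* y := y :- x :* y) refl (E (+ e ℤ.* (j ℤ.+ + 4 ℤ.* + l))) δ₀ ⟩
              δ₀ - E (+ e ℤ.* (j ℤ.+ + 4 ℤ.* + l)) * δ₀
                ≈⟨ +-congˡ (-‿cong (trans (E-+ (+ e ℤ.* (j ℤ.+ + 4 ℤ.* + l)) -[1+ 0 ]) (trans (E-≡ exponent) (sym (power-≈ (E-+′ (at l m′) (at l m′))))))) ⟩
              δ₀ - p ^ k m′ * p ^ k m′ ∎)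
              (∣-*ʳ (d∣1-E (j ℤ.+ + 4 ℤ.* + l)) (int-E -[1+ 0 ])))
              where
              ξ = + 2 ℤ.* (+ l ℤ.* + e ℤ.+ + m′)
              exponent : + e ℤ.* (j ℤ.+ + 4 ℤ.* + l) ℤ.- + 1 ≡ ξ ℤ.+ ξ
              exponent = ≡.trans (solveℤ 3 (λ e j l → e ⊗ (j ⊕ # 4 ⊗ l) ⊝ # 1 :≡ e ⊗ j ⊕ e ⊗ (# 4 ⊗ l) ⊝ # 1) ≡.refl (+ e) j (+ l))
                (≡.trans (≡.cong (λ w → w ℤ.+ + e ℤ.* (+ 4 ℤ.* + l) ℤ.- + 1) ej≡)
                  (solveℤ 3 (λ e m′ l → # 4 ⊗ m′ ⊕ # 1 ⊕ e ⊗ (# 4 ⊗ l) ⊝ # 1 :≡ # 2 ⊗ (l ⊗ e ⊕ m′) ⊕ # 2 ⊗ (l ⊗ e ⊕ m′)) ≡.refl (+ e) (+ m′) (+ l)))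

          unit-d⁴ : Unit (d * d * d * d)
          unit-d⁴ = unit-* (unit-* (unit-* unit-d unit-d) unit-d) unit-d

        module κ-blocks = Blocks e′ Nᵏ Dᵏ (d * d * d * d) unit-d⁴ int-N intUnit-Dˡ Dᵏ-last d⁴∣ΠN

        private
          d∣scaled : ∀ l R → d ∣ Σ R (blockTerm l) → d ∣ Σ R (λ r → cube a₀ (p ^ (l ℕ.* e ℕ.+ r)) * κ a₀ σ₀ δ₀ (l ℕ.* e ℕ.+ r))
          d∣scaled l R db = ∣-resp (sym (trans (Σ-cong R λ r _ → trans (*-congˡ (hyper-+ Nᵏ Dᵏ (l ℕ.* e) r))
              (solve 3 (λ c k s → c :* (k :* s) := k :* (c :* s)) refl _ _ _)) (Σ-*ˡ R _ (blockTerm l))))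
            (∣-*ˡ (κ-blocks.int-multiple l) db)

        d∣S-multiple : ∀ l → d ∣ S a₀ σ₀ δ₀ (l ℕ.* e)
        d∣S-multiple zero    = ∣-0
        d∣S-multiple (suc l) = ∣-resp (sym (trans (reflexive (≡.cong (S a₀ σ₀ δ₀) (ℕ.+-comm e (l ℕ.* e)))) (Σ-+ (l ℕ.* e) e _)))
          (∣-+ (d∣S-multiple l) (d∣scaled l e (d∣block l)))

        d∣S-half : ∀ l → d ∣ S a₀ σ₀ δ₀ (l ℕ.* e ℕ.+ suc h)
        d∣S-half l = ∣-resp (sym (Σ-+ (l ℕ.* e) (suc h) _)) (∣-+ (d∣S-multiple l) (d∣scaled l (suc h) (d∣half-block l)))

        module _ (m : ℕ) (f : ℤ) (ef≡ : + e ℤ.* f ≡ + 4 ℤ.* + m ℤ.+ + 1) where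
          open Values m

          private
            C : ℕ → Carrier
            C i = 1# - E (+ 2 ℤ.+ + 4 ℤ.* + i)

            c : Carrier
            c = 1# - E ν

            d∣c : d ∣ c
            d∣c = d∣1-E′ f (≡.sym ef≡)

            int-c : Int c
            int-c = int-1-E ν

            intUnit-Aˡ : ∀ l r → r < e′ → IntUnit (A (l ℕ.* e ℕ.+ r))
            intUnit-Aˡ l r r<e′ = intUnit-4 r (+ 4 ℤ.* + l) (e∤ r r<e′)
              (≡.trans (≡.cong (λ w → + 4 ℤ.+ + 4 ℤ.* (w ℤ.+ + r)) (ℤ.pos-* l e))
                (solveℤ 3 (λ r l e → # 4 ⊕ # 4 ⊗ (l ⊗ e ⊕ r) :≡ # 4 ⊗ (# 1 ⊕ r) ⊕ e ⊗ (# 4 ⊗ l)) ≡.refl (+ r) (+ l) (+ e)))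

            A-last : ∀ l → ∃ λ u → IntUnit u × A (l ℕ.* e ℕ.+ e′) ≈ d * u
            A-last l = last-factor {+ 4 ℤ.+ + 4 ℤ.* + (l ℕ.* e ℕ.+ e′)} (l ℕ.+ 3 ℕ.* suc l)
              (≡.trans (≡.cong (λ w → + 4 ℤ.+ + 4 ℤ.* (w ℤ.+ + e′)) (ℤ.pos-* l e)) (≡.trans
                (solveℤ 2 (λ l e′ → # 4 ⊕ # 4 ⊗ (l ⊗ (# 1 ⊕ e′) ⊕ e′) :≡ (# 1 ⊕ e′) ⊗ (# 4 ⊗ (# 1 ⊕ l))) ≡.refl (+ l) (+ e′))
                (≡.cong (+ e ℤ.*_) (≡.sym (ℤ.pos-* 4 (suc l))))))

            -- At r = h the exponent 2 + 4 (l e + h) is 2 e (2 l + 1), which balances the one factor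
            -- d in the denominators of `ρ`.
            d∣ΠC : ∀ l → d ∣ Π e (λ r → C (l ℕ.* e ℕ.+ r))
            d∣ΠC l = ∣-Π e (λ r _ → int-1-E (+ 2 ℤ.+ + 4 ℤ.* + (l ℕ.* e ℕ.+ r))) h h<e
              (d∣1-E′ {+ 2 ℤ.+ + 4 ℤ.* + (l ℕ.* e ℕ.+ h)} (+ 2 ℤ.* (+ 1 ℤ.+ + 2 ℤ.* + l)) (≡.trans
                (≡.cong₂ (λ w w′ → + 2 ℤ.+ + 4 ℤ.* (w ℤ.+ w′)) (≡.trans (ℤ.pos-* l e) (≡.cong (λ w → + l ℤ.* (+ 1 ℤ.+ w)) (≡.cong +_ e′≡))) (≡.refl {x = + h})) (≡.trans
                (solveℤ 2 (λ l h → # 2 ⊕ # 4 ⊗ (l ⊗ (# 1 ⊕ (h ⊕ h)) ⊕ h) :≡ (# 1 ⊕ (h ⊕ h)) ⊗ (# 2 ⊗ (# 1 ⊕ # 2 ⊗ l))) ≡.refl (+ l) (+ h))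
                (≡.cong (λ w → (+ 1 ℤ.+ w) ℤ.* (+ 2 ℤ.* (+ 1 ℤ.+ + 2 ℤ.* + l))) (≡.cong +_ (≡.sym e′≡))))))

            module ρ-blocks = Blocks e′ C A d unit-d (λ k → int-1-E (+ 2 ℤ.+ + 4 ℤ.* + k)) intUnit-Aˡ A-last d∣ΠC

            decompose : ∀ k → k ≡ k ℕ./ e ℕ.* e ℕ.+ k ℕ.% e
            decompose k = ≡.trans (ℕ.m≡m%n+[m/n]*n k e) (ℕ.+-comm (k ℕ.% e) _)

            int-ρ : Int ρ
            int-ρ = ≡.subst (λ k → Int (hyper C A k)) (≡.sym (decompose m)) (ρ-blocks.int-at (m ℕ./ e) (m ℕ.% e) (ℕ.m%n<n m e))

            -- At the end of a block A i is d times a unit, and d divides c; elsewhere A i is a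
            -- unit. Hence c² Y is integral even when the summands of Y are not.
            int-c/A : ∀ i → Int (c * recip (A i))
            int-c/A i = ≡.subst (λ k → Int (c * recip (A k))) (≡.sym (decompose i)) (go (i ℕ./ e) (i ℕ.% e) (ℕ.m%n<n i e))
              where
              go : ∀ l r → r < e → Int (c * recip (A (l ℕ.* e ℕ.+ r)))
              go l r (s≤s r≤e′) = go′ (ℕ.m≤n⇒m<n∨m≡n r≤e′)
                where
                go′ : r < e′ ⊎ r ≡ e′ → Int (c * recip (A (l ℕ.* e ℕ.+ r)))
                go′ (inj₁ r<e′)   = int-* int-c (int-recip (intUnit-Aˡ l r r<e′))
                go′ (inj₂ ≡.refl) = ∣⇒int int-1 (∣-cancel (proj₁ (proj₂ (A-last l))) (∣-resp (unit-cancel unit-d (begin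
                  d * v                          ≈⟨ proj₂ (proj₂ d∣c) ⟨
                  c                              ≈⟨ *-identityʳ c ⟨
                  c * 1#                         ≈⟨ *-congˡ (recip-inverse (unit-A k)) ⟨
                  c * (A k * recip (A k))        ≈⟨ *-congˡ (*-congʳ (proj₂ (proj₂ (A-last l)))) ⟩
                  c * (d * u * recip (A k))      ≈⟨ solve 4 (λ c d u r → c :* (d :* u :* r) := d :* (u :* (c :* r))) refl c d u (recip (A k)) ⟩
                  d * (u * (c * recip (A k)))    ∎)) (int⇒1∣ (proj₁ (proj₂ d∣c)))))
                  where
                  k = l ℕ.* e ℕ.+ e′
                  u = proj₁ (A-last l)
                  v = proj₁ d∣c

          d∣V : d ∣ V
          d∣V = ∣-*ʳ (∣-*ʳ d∣c (int-* (int-E (ℤ.- + m)) int-ρ)) (int-minus int-1 (int-resp (Σ-*ˡ m (c * c) ζ)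
            (int-Σ m λ i _ → int-resp (solve 3 (λ c z r → z :* (c :* r :* (c :* r)) := c :* c :* (z :* (r :* r))) refl c (z i) (recip (A i)))
              (int-* (int-E (+ 4 ℤ.+ + 4 ℤ.* + i)) (int-* (int-c/A i) (int-c/A i))))))

-- Parity of the divisors of n

half : ∀ n → (∃ λ a → n ≡ a ℕ.+ a) ⊎ (∃ λ a → n ≡ suc (a ℕ.+ a))
half zero    = inj₁ (0 , ≡.refl)
half (suc n) with half n
... | inj₁ (a , e) = inj₂ (a , ≡.cong suc e)
... | inj₂ (a , e) = inj₁ (suc a , ≡.cong suc (≡.trans e (≡.sym (ℕ.+-suc a a))))

double-injective : ∀ a b → a ℕ.+ a ≡ b ℕ.+ b → a ≡ b
double-injective zero    zero    _ = ≡.refl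
double-injective (suc a) (suc b) e = ≡.cong suc (double-injective a b
  (ℕ.suc-injective (≡.trans (≡.sym (ℕ.+-suc a a)) (≡.trans (ℕ.suc-injective e) (ℕ.+-suc b b)))))

odd≢even : ∀ a b → suc (a ℕ.+ a) ≢ b ℕ.+ b
odd≢even zero    (suc b) e = ℕ.1+n≢0 (≡.sym (≡.trans (ℕ.suc-injective e) (ℕ.+-suc b b)))
odd≢even (suc a) (suc b) e = odd≢even a b (≡.trans (≡.sym (ℕ.+-suc a a)) (ℕ.suc-injective
  (≡.trans (ℕ.suc-injective e) (ℕ.+-suc b b))))

odd-cancel-2 : ∀ h c → suc (h ℕ.+ h) ℕ.∣ 2 ℕ.* c → suc (h ℕ.+ h) ℕ.∣ c
odd-cancel-2 h c e∣2c = ℕ.∣m+n∣m⇒∣n (≡.subst (suc (h ℕ.+ h) ℕ.∣_) (lemma h c) (ℕ.m∣m*n c)) (ℕ.∣n⇒∣m*n h e∣2c)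
  where
  lemma : ∀ h c → suc (h ℕ.+ h) ℕ.* c ≡ h ℕ.* (2 ℕ.* c) ℕ.+ c
  lemma = solve-∀

-- Both the divisor e = 2 h + 1 and its cofactor 2 l + 1 are odd because n is. Halving their product
-- places the first (n + 1) / 2 indices: l full blocks and h + 1 more indices.
record OddDivisor (m e′ : ℕ) : Set where
  field
    h l         : ℕ
    e′≡         : e′ ≡ h ℕ.+ h
    n≡          : suc (m ℕ.+ m ℕ.+ (m ℕ.+ m)) ≡ suc (l ℕ.+ l) ℕ.* suc e′
    half≡       : suc (m ℕ.+ m) ≡ l ℕ.* suc e′ ℕ.+ suc h
    m′ j        : ℕ
    ej≡         : suc e′ ℕ.* j ≡ 4 ℕ.* m′ ℕ.+ 1
    m′≤e′       : m′ ≤ e′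
    m′>0        : 0 < m′

oddDivisor : ∀ m e′ → 0 < e′ → suc e′ ℕ.∣ suc (m ℕ.+ m ℕ.+ (m ℕ.+ m)) → OddDivisor m e′
oddDivisor m e′ e′>0 (ℕ.divides f n≡fe) = go (half e′) (half f)
  where
  go : (∃ λ a → e′ ≡ a ℕ.+ a) ⊎ (∃ λ a → e′ ≡ suc (a ℕ.+ a)) → (∃ λ a → f ≡ a ℕ.+ a) ⊎ (∃ λ a → f ≡ suc (a ℕ.+ a)) → OddDivisor m e′
  go (inj₂ (a , ≡.refl)) _ = contradiction (≡.trans n≡fe (lemma f a)) (odd≢even (m ℕ.+ m) (f ℕ.* suc a))
    where
    lemma : ∀ f a → f ℕ.* suc (suc (a ℕ.+ a)) ≡ f ℕ.* suc a ℕ.+ f ℕ.* suc a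
    lemma = solve-∀
  go _ (inj₁ (a , ≡.refl)) = contradiction (≡.trans n≡fe (ℕ.*-distribʳ-+ (suc e′) a a)) (odd≢even (m ℕ.+ m) (a ℕ.* suc e′))
  go (inj₁ (h , ≡.refl)) (inj₂ (l , ≡.refl)) = witness (half h)
    where
    half-lemma : ∀ h l → suc (l ℕ.+ l) ℕ.* suc (h ℕ.+ h) ≡ suc (l ℕ.* suc (h ℕ.+ h) ℕ.+ h ℕ.+ (l ℕ.* suc (h ℕ.+ h) ℕ.+ h))
    half-lemma = solve-∀
    halves : suc (m ℕ.+ m) ≡ l ℕ.* suc (h ℕ.+ h) ℕ.+ suc h
    halves = ≡.trans (≡.cong suc (double-injective (m ℕ.+ m) _ (ℕ.suc-injective (≡.trans n≡fe (half-lemma h l)))))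
      (≡.sym (ℕ.+-suc _ h))
    witness : (∃ λ a → h ≡ a ℕ.+ a) ⊎ (∃ λ a → h ≡ suc (a ℕ.+ a)) → OddDivisor m (h ℕ.+ h)
    -- Here e = 4 a + 1 is itself congruent to 1 modulo 4.
    witness (inj₁ (a , ≡.refl)) = record
      { h = h ; l = l ; e′≡ = ≡.refl ; n≡ = n≡fe ; half≡ = halves ; m′ = a ; j = 1 ; ej≡ = lemma a
      ; m′≤e′ = ℕ.≤-trans (ℕ.m≤m+n a a) (ℕ.m≤m+n (a ℕ.+ a) (a ℕ.+ a)) ; m′>0 = positive a e′>0 }
      where
      lemma : ∀ a → suc (a ℕ.+ a ℕ.+ (a ℕ.+ a)) ℕ.* 1 ≡ 4 ℕ.* a ℕ.+ 1
      lemma = solve-∀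
      positive : ∀ a → 0 < a ℕ.+ a ℕ.+ (a ℕ.+ a) → 0 < a
      positive (suc a) _ = s≤s z≤n
    -- Here e = 4 a + 3, and the least positive multiple congruent to 1 modulo 4 is 3 e = 4 (3 a +
    -- 2) + 1.
    witness (inj₂ (a , ≡.refl)) = record
      { h = h ; l = l ; e′≡ = ≡.refl ; n≡ = n≡fe ; half≡ = halves ; m′ = 3 ℕ.* a ℕ.+ 2 ; j = 3 ; ej≡ = lemma a
      ; m′≤e′ = ≡.subst (3 ℕ.* a ℕ.+ 2 ≤_) (bound a) (ℕ.m≤n+m (3 ℕ.* a ℕ.+ 2) a)
      ; m′>0 = ℕ.≤-trans (s≤s z≤n) (ℕ.m≤n+m 2 (3 ℕ.* a)) }
      where
      lemma : ∀ a → suc (suc (a ℕ.+ a) ℕ.+ suc (a ℕ.+ a)) ℕ.* 3 ≡ 4 ℕ.* (3 ℕ.* a ℕ.+ 2) ℕ.+ 1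
      lemma = solve-∀
      bound : ∀ a → a ℕ.+ (3 ℕ.* a ℕ.+ 2) ≡ suc (a ℕ.+ a) ℕ.+ suc (a ℕ.+ a)
      bound = solve-∀

+n≡ : ∀ m → + suc (m ℕ.+ m ℕ.+ (m ℕ.+ m)) ≡ + 4 ℤ.* + m ℤ.+ + 1
+n≡ m = (solveℤ 1 (λ m → # 1 ⊕ (m ⊕ m ⊕ (m ⊕ m)) :≡ # 4 ⊗ m ⊕ # 1) ≡.refl (+ m))

-- The two sides of the congruence as elements of ℚ(q)

record Embedding (F : CommutativeRing 0ℓ 0ℓ) : Set where
  open CommutativeRing F
  open Units F
  field
    ι           : Poly → Carrier
    ι-cong      : ∀ {p r} → p ≋ r → ι p ≈ ι r
    ι-injective : ∀ {p r} → ι p ≈ ι r → p ≋ r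
    ι-+         : ∀ p r → ι (p +P r) ≈ ι p + ι r
    ι-*         : ∀ p r → ι (p *P r) ≈ ι p * ι r
    ι-neg       : ∀ p → ι (negP p) ≈ - ι p
    ι-0         : ι [] ≈ 0#
    ι-1         : ι oneP ≈ 1#
    ι-unit      : ∀ {p} → NonZeroP p → Unit (ι p)

module RationalFunctions (F : CommutativeRing 0ℓ 0ℓ) (reciprocal : Reciprocal F) (embedding : Embedding F) where
  open CommutativeRing F
  open Reciprocal reciprocal
  open Embedding embedding
  open Units F
  open Products F
  open IntegerSolver F
  open Hypergeometric F reciprocal
  open ℤ[q] using (_⟂_; ⟂-*ˡ; ⟂-*ʳ; 1⟂; ⟂-sym; ⟂-resp; geometric)
  open import Relation.Binary.Reasoning.Setoid setoid
  open import Algebra.Properties.Semiring.Exp semiring using (_^_; ^-congˡ)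
  private
    I O : ∀ {n} → Polynomial n
    I = con (+ 1)
    O = con (+ 0)

  ι-minus : ∀ p r → ι (p -P r) ≈ ι p - ι r
  ι-minus p r = trans (ι-+ p (negP r)) (+-congˡ (ι-neg r))

  ι-^ : ∀ p k → ι (p ℤ[q].^ k) ≈ ι p ^ k
  ι-^ p zero    = ι-1
  ι-^ p (suc k) = trans (ι-* p _) (*-congˡ (ι-^ p k))

  ι-^P : ∀ p k → ι (p ^P k) ≈ ι p ^ k
  ι-^P p k = trans (reflexive (≡.cong ι (^P-≡ p k))) (ι-^ p k)

  unit-ι⇒nonZero : ∀ {p} → Unit (ι p) → NonZeroP p
  unit-ι⇒nonZero {p} (u , e) with nonZeroP⊎zero p
  ... | inj₁ nz = nz
  ... | inj₂ z  = contradiction (nonZeroP-resp (ι-injective (begin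
    ι oneP    ≈⟨ ι-1 ⟩
    1#        ≈⟨ e ⟨
    ι p * u   ≈⟨ *-congʳ (trans (ι-cong z) ι-0) ⟩
    0# * u    ≈⟨ zeroˡ u ⟩
    0#        ≈⟨ ι-0 ⟨
    ι []      ∎)) (here λ ())) ¬nonZeroP-[]

  Q : Carrier
  Q = ι X

  nonZero-X : NonZeroP X
  nonZero-X = there ≡.refl (here λ ())

  Q⁻¹ : Carrier
  Q⁻¹ = recip Q

  QQ⁻¹ : Q * Q⁻¹ ≈ 1#
  QQ⁻¹ = recip-inverse (ι-unit nonZero-X)

  ι-1-X^ : ∀ k → ι (oneP -P X ℤ[q].^ k) ≈ 1# - Q ^ k
  ι-1-X^ k = trans (ι-minus oneP _) (+-cong ι-1 (-‿cong (ι-^ X k)))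

  unit-1-Q^ : ∀ j → Unit (1# - Q ^ suc j)
  unit-1-Q^ j = unit-resp (ι-1-X^ (suc j)) (ι-unit (nonZero-1-X^ j))

  open Powers F reciprocal
  open Exponentials Q Q⁻¹ QQ⁻¹ unit-1-Q^

  -- A `RatFun` is a bare pair whose operations never reduce fractions and do not exclude a zero
  -- denominator. This relation ties it to a field element, in which the computation is then carried
  -- out.
  record Value (r : RatFun) (x : Carrier) : Set where
    constructor value
    field
      den-unit : Unit (ι (den r))
      value-≈  : x * ι (den r) ≈ ι (num r)

  value-poly : ∀ p → Value (fromPoly p) (ι p)
  value-poly p = value (unit-resp (sym ι-1) unit-1) (trans (*-congˡ ι-1) (*-identityʳ _))

  value-resp : ∀ {r x y} → x ≈ y → Value r x → Value r y
  value-resp e (value u v) = value u (trans (*-congʳ (sym e)) v)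

  value-+ : ∀ {r s x y} → Value r x → Value s y → Value (r +R s) (x + y)
  value-+ {a /ᵣ b} {c /ᵣ d} {x} {y} (value u e) (value v f) = value (unit-resp (sym (ι-* b d)) (unit-* u v)) (begin
    (x + y) * ι (b *P d)                   ≈⟨ *-congˡ (ι-* b d) ⟩
    (x + y) * (ι b * ι d)                  ≈⟨ solve 4 (λ x y b d → (x :+ y) :* (b :* d) := x :* b :* d :+ y :* d :* b) refl x y (ι b) (ι d) ⟩
    x * ι b * ι d + y * ι d * ι b          ≈⟨ +-cong (*-congʳ e) (*-congʳ f) ⟩
    ι a * ι d + ι c * ι b                  ≈⟨ trans (ι-+ _ _) (+-cong (ι-* a d) (ι-* c b)) ⟨
    ι (a *P d +P c *P b)                   ∎)

  value-minus : ∀ {r s x y} → Value r x → Value s y → Value (r -R s) (x - y)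
  value-minus {a /ᵣ b} {c /ᵣ d} {x} {y} (value u e) (value v f) = value (unit-resp (sym (ι-* b d)) (unit-* u v)) (begin
    (x - y) * ι (b *P d)                   ≈⟨ *-congˡ (ι-* b d) ⟩
    (x - y) * (ι b * ι d)                  ≈⟨ solve 4 (λ x y b d → (x :- y) :* (b :* d) := x :* b :* d :- y :* d :* b) refl x y (ι b) (ι d) ⟩
    x * ι b * ι d - y * ι d * ι b          ≈⟨ +-cong (*-congʳ e) (-‿cong (*-congʳ f)) ⟩
    ι a * ι d - ι c * ι b                  ≈⟨ trans (ι-minus _ _) (+-cong (ι-* a d) (-‿cong (ι-* c b))) ⟨
    ι (a *P d -P c *P b)                   ∎)

  value-* : ∀ {r s x y} → Value r x → Value s y → Value (r *R s) (x * y)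
  value-* {a /ᵣ b} {c /ᵣ d} {x} {y} (value u e) (value v f) = value (unit-resp (sym (ι-* b d)) (unit-* u v)) (begin
    x * y * ι (b *P d)                     ≈⟨ *-congˡ (ι-* b d) ⟩
    x * y * (ι b * ι d)                    ≈⟨ solve 4 (λ x y b d → x :* y :* (b :* d) := x :* b :* (y :* d)) refl x y (ι b) (ι d) ⟩
    x * ι b * (y * ι d)                    ≈⟨ *-cong e f ⟩
    ι a * ι c                              ≈⟨ ι-* a c ⟨
    ι (a *P c)                             ∎)

  value-÷ : ∀ a b {x} → Unit (ι b) → x * ι b ≈ ι a → Value (fromPoly a ÷R fromPoly b) x
  value-÷ a b {x} u e = value (unit-resp (sym den≈) u) (begin
    x * ι (oneP *P b)     ≈⟨ *-congˡ den≈ ⟩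
    x * ι b               ≈⟨ e ⟩
    ι a                   ≈⟨ *-identityʳ _ ⟨
    ι a * 1#              ≈⟨ *-congˡ ι-1 ⟨
    ι a * ι oneP          ≈⟨ ι-* a oneP ⟨
    ι (a *P oneP)         ∎)
    where
    den≈ : ι (oneP *P b) ≈ ι b
    den≈ = trans (ι-* oneP b) (trans (*-congʳ ι-1) (*-identityˡ _))

  value-sum : ∀ n {f g} → (∀ k → Value (f k) (g k)) → Value (sumR n f) (Σ n g)
  value-sum zero    h = value-resp ι-0 (value-poly [])
  value-sum (suc n) h = value-+ (value-sum n h) (h n)

  ι-q^P : ∀ k → ι (q ^P k) ↦ + k
  ι-q^P k = power (ι-^P q k)

  ι-qpow : ∀ k → ι (qpow k) ↦ + k
  ι-qpow k = power (trans (ι-cong (qpow-≋ k)) (ι-^ X k))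

  ι-q : ι q ↦ + 1
  ι-q = ι-qpow 1

  ι-poch : ∀ {x b α β} → ι x ↦ α → ι b ↦ β → ∀ k → ι (poch x b k) ≈ Π k (λ i → 1# - E (α ℤ.+ β ℤ.* + i))
  ι-poch eα eβ zero    = ι-1
  ι-poch {x} {b} {α} {β} eα eβ (suc k) = trans (ι-* _ _) (*-cong (ι-poch eα eβ k) (trans (ι-minus oneP _)
    (+-cong ι-1 (-‿cong (trans (ι-* x (b ^P k)) (power-≈ (E-+′ eα power-b)))))))
    where
    power-b : ι (b ^P k) ↦ β ℤ.* + k
    power-b = power (trans (ι-^P b k) (trans (^-congˡ k (power-≈ eβ)) (E-^ β k)))

  ι-qint : ∀ r → (1# - Q) * ι (qint r) ≈ 1# - E (+ r)
  ι-qint r = begin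
    (1# - Q) * ι (qint r)                               ≈⟨ *-cong (sym (trans (ι-minus oneP X) (+-congʳ ι-1))) (ι-cong (qint-≋ r)) ⟩
    ι (oneP -P X) * ι (ℤ[q].Σ r (X ℤ[q].^_))            ≈⟨ ι-* _ _ ⟨
    ι ((oneP -P X) *P ℤ[q].Σ r (X ℤ[q].^_))             ≈⟨ ι-cong (geometric X r) ⟩
    ι (oneP -P X ℤ[q].^ r)                              ≈⟨ ι-1-X^ r ⟩
    1# - E (+ r)                                        ∎

  unit-1-Q : Unit (1# - Q)
  unit-1-Q = unit-resp (+-congˡ (-‿cong (*-identityʳ Q))) (unit-1-Q^ 0)

  lhsValue : ℕ → Carrier
  lhsValue k = recip (1# - Q) * (cube a₀ (p ^ k) * κ a₀ σ₀ δ₀ k)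

  private
    f₁ f₂ f₄ g₄ : ℕ → Carrier
    f₁ i = 1# - E (+ 1 ℤ.+ + 2 ℤ.* + i)
    f₂ i = 1# - E (+ 2 ℤ.+ + 2 ℤ.* + i)
    f₄ i = 1# - E (+ 4 ℤ.+ + 4 ℤ.* + i)
    g₄ i = 1# - E (+ 1 ℤ.+ + 4 ℤ.* + i)

    D-factors : ∀ i → D a₀ σ₀ δ₀ (p ^ i) ≈ f₄ i * (f₄ i * f₄ i) * f₂ i
    D-factors i = trans (D-E (E↦ (+ 1)) (E↦ (+ 1)) (E↦ (+ 1)) (E↦ -[1+ 0 ]) (p^↦ i) ≡.refl)
      (*-congʳ (*-cong four (*-cong four four)))
      where
      four : 1# - E (+ 4 ℤ.+ (+ 2 ℤ.* + i ℤ.+ + 2 ℤ.* + i)) ≈ f₄ i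
      four = 1-E-≡ (solveℤ 1 (λ i → # 4 ⊕ (# 2 ⊗ i ⊕ # 2 ⊗ i) :≡ # 4 ⊕ # 4 ⊗ i) ≡.refl (+ i))

    unit-factors : ∀ i → Unit (D a₀ σ₀ δ₀ (p ^ i))
    unit-factors i = unit-D (E↦ (+ 1)) (E↦ (+ 1)) (E↦ (+ 1)) (E↦ -[1+ 0 ]) ≡.refl i (4+4k≢0 i) (4+4k≢0 i)
      (positive-≢0 2 i 1 (ℤ.+-comm (+ 2) (+ 2 ℤ.* + i)))

    -- The factor q of `p * a₀ * x` cancels the q⁻¹ in δ₀ - x². What remains is q^(2 + 2 i), whose
    -- product over i < k is the power q^(k² + k) of the statement.
    N-factors : ∀ i → N a₀ σ₀ δ₀ (p ^ i) ≈ f₁ i * (f₁ i * f₁ i) * E (+ 2 ℤ.+ + 2 ℤ.* + i) * g₄ i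
    N-factors i = begin
      (1# - a₀ * x) * quad σ₀ x * (p * a₀ * x) * (δ₀ - x * x)
        ≈⟨ *-cong (*-cong (*-cong e₁ (trans (quad-factor x (E-+ (+ 1) (+ 1))) (*-cong e₁ e₁))) ex) eδ ⟩
      f₁ i * (f₁ i * f₁ i) * (E (+ 2 ℤ.+ + 2 ℤ.* + i) * E (+ 1)) * (E -[1+ 0 ] * g₄ i)
        ≈⟨ solve 5 (λ f e a b g → f :* (e :* a) :* (b :* g) := f :* e :* (a :* b) :* g) refl (f₁ i * (f₁ i * f₁ i)) (E (+ 2 ℤ.+ + 2 ℤ.* + i)) (E (+ 1)) (E -[1+ 0 ]) (g₄ i) ⟩
      f₁ i * (f₁ i * f₁ i) * E (+ 2 ℤ.+ + 2 ℤ.* + i) * (E (+ 1) * E -[1+ 0 ]) * g₄ i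
        ≈⟨ *-congʳ (trans (*-congˡ (E-inverse (+ 1))) (*-identityʳ _)) ⟩
      f₁ i * (f₁ i * f₁ i) * E (+ 2 ℤ.+ + 2 ℤ.* + i) * g₄ i ∎
      where
      x = p ^ i
      e₁ : 1# - a₀ * x ≈ f₁ i
      e₁ = 1-↦ (E-+′ (E↦ (+ 1)) (p^↦ i))
      ex : p * a₀ * x ≈ E (+ 2 ℤ.+ + 2 ℤ.* + i) * E (+ 1)
      ex = trans (solve 3 (λ p a x → p :* a :* x := p :* x :* a) refl p a₀ x) (*-congʳ (power-≈ (E-+′ p↦ (p^↦ i))))
      eδ : δ₀ - x * x ≈ E -[1+ 0 ] * g₄ i
      eδ = begin
        δ₀ - x * x
          ≈⟨ +-congˡ (-‿cong (trans (power-≈ (E-+′ (p^↦ i) (p^↦ i))) (trans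
               (E-≡ (solveℤ 1 (λ i → # 2 ⊗ i ⊕ # 2 ⊗ i :≡ (⊝ # 1) ⊕ (# 1 ⊕ # 4 ⊗ i)) ≡.refl (+ i)))
               (sym (E-+ -[1+ 0 ] (+ 1 ℤ.+ + 4 ℤ.* + i)))))) ⟩
        E -[1+ 0 ] - E -[1+ 0 ] * E (+ 1 ℤ.+ + 4 ℤ.* + i)
          ≈⟨ solve 2 (λ d y → d :- d :* y := d :* (I :- y)) refl (E -[1+ 0 ]) (E (+ 1 ℤ.+ + 4 ℤ.* + i)) ⟩
        E -[1+ 0 ] * g₄ i ∎

    Π-powers : ∀ k → Π k (λ i → E (+ 2 ℤ.+ + 2 ℤ.* + i)) ≈ E (+ (k ℕ.* k ℕ.+ k))
    Π-powers zero    = refl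
    Π-powers (suc k) = trans (*-congʳ (Π-powers k)) (trans (E-+ (+ (k ℕ.* k ℕ.+ k)) (+ 2 ℤ.+ + 2 ℤ.* + k)) (E-≡ (begin-≡)))
      where
      begin-≡ : + (k ℕ.* k ℕ.+ k) ℤ.+ (+ 2 ℤ.+ + 2 ℤ.* + k) ≡ + (suc k ℕ.* suc k ℕ.+ suc k)
      begin-≡ = ≡.trans (≡.cong (λ w → w ℤ.+ + k ℤ.+ (+ 2 ℤ.+ + 2 ℤ.* + k)) (ℤ.pos-* k k)) (≡.trans
        (solveℤ 1 (λ k → k ⊗ k ⊕ k ⊕ (# 2 ⊕ # 2 ⊗ k) :≡ (# 1 ⊕ k) ⊗ (# 1 ⊕ k) ⊕ (# 1 ⊕ k)) ≡.refl (+ k))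
        (≡.cong (ℤ._+ + suc k) (≡.sym (ℤ.pos-* (suc k) (suc k)))))

    triple : ∀ x → x * (x * (x * 1#)) ≈ x * (x * x)
    triple x = solve 1 (λ x → x :* (x :* (x :* I)) := x :* (x :* x)) refl x

    κ-value : ∀ k → κ a₀ σ₀ δ₀ k * (Π k f₂ * (Π k f₄ * (Π k f₄ * Π k f₄))) ≈
      Π k f₁ * (Π k f₁ * Π k f₁) * Π k g₄ * E (+ (k ℕ.* k ℕ.+ k))
    κ-value k = begin
      κ a₀ σ₀ δ₀ k * (Π k f₂ * (Π k f₄ * (Π k f₄ * Π k f₄)))
        ≈⟨ *-congˡ (trans (Π-cong k λ i _ → D-factors i) (trans (Π-* k _ f₂) (trans (*-congʳ (trans (Π-* k f₄ _) (*-congˡ (Π-* k f₄ f₄)))) (*-comm _ _)))) ⟨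
      κ a₀ σ₀ δ₀ k * Π k (λ i → D a₀ σ₀ δ₀ (p ^ i))
        ≈⟨ hyper-Π k (λ i _ → unit-factors i) ⟩
      Π k (λ i → N a₀ σ₀ δ₀ (p ^ i))
        ≈⟨ trans (Π-cong k λ i _ → N-factors i) (trans (Π-* k _ g₄) (*-congʳ (trans (Π-* k _ _) (*-cong (trans (Π-* k f₁ _) (*-congˡ (Π-* k f₁ f₁))) (Π-powers k))))) ⟩
      Π k f₁ * (Π k f₁ * Π k f₁) * E (+ (k ℕ.* k ℕ.+ k)) * Π k g₄
        ≈⟨ solve 3 (λ a b c → a :* b :* c := a :* c :* b) refl _ (E (+ (k ℕ.* k ℕ.+ k))) (Π k g₄) ⟩
      Π k f₁ * (Π k f₁ * Π k f₁) * Π k g₄ * E (+ (k ℕ.* k ℕ.+ k)) ∎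

  value-lhsTerm : ∀ k → Value (lhsTerm k) (lhsValue k)
  value-lhsTerm k = value-÷ A B unit-B (unit-cancel unit-1-Q (begin
    (1# - Q) * (lhsValue k * ι B)
      ≈⟨ solve 5 (λ u r c κ b → u :* (r :* (c :* κ) :* b) := u :* r :* (c :* (κ :* b))) refl (1# - Q) (recip (1# - Q)) (cube a₀ (p ^ k)) (κ a₀ σ₀ δ₀ k) (ι B) ⟩
    (1# - Q) * recip (1# - Q) * (cube a₀ (p ^ k) * (κ a₀ σ₀ δ₀ k * ι B))
      ≈⟨ trans (*-congʳ (recip-inverse unit-1-Q)) (*-identityˡ _) ⟩
    cube a₀ (p ^ k) * (κ a₀ σ₀ δ₀ k * ι B)
      ≈⟨ *-cong cube-≈ (trans (*-congˡ ιB) (κ-value k)) ⟩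
    (1# - E (+ (6 ℕ.* k ℕ.+ 1))) * (Π k f₁ * (Π k f₁ * Π k f₁) * Π k g₄ * E (+ (k ℕ.* k ℕ.+ k)))
      ≈⟨ *-congʳ (sym (ι-qint (6 ℕ.* k ℕ.+ 1))) ⟩
    (1# - Q) * ι (qint (6 ℕ.* k ℕ.+ 1)) * (Π k f₁ * (Π k f₁ * Π k f₁) * Π k g₄ * E (+ (k ℕ.* k ℕ.+ k)))
      ≈⟨ solve 5 (λ u n f g e → u :* n :* (f :* g :* e) := u :* (n :* f :* g :* e)) refl (1# - Q) _ (Π k f₁ * (Π k f₁ * Π k f₁)) (Π k g₄) (E (+ (k ℕ.* k ℕ.+ k))) ⟩
    (1# - Q) * (ι (qint (6 ℕ.* k ℕ.+ 1)) * (Π k f₁ * (Π k f₁ * Π k f₁)) * Π k g₄ * E (+ (k ℕ.* k ℕ.+ k)))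
      ≈⟨ *-congˡ ιA ⟨
    (1# - Q) * ι A ∎))
    where
    A B : Poly
    A = qint (6 ℕ.* k ℕ.+ 1) *P (poch q (q ^P 2) k ^P 3) *P poch q (q ^P 4) k *P qpow (k ℕ.* k ℕ.+ k)
    B = poch (q ^P 2) (q ^P 2) k *P (poch (q ^P 4) (q ^P 4) k ^P 3)
    ιA : ι A ≈ ι (qint (6 ℕ.* k ℕ.+ 1)) * (Π k f₁ * (Π k f₁ * Π k f₁)) * Π k g₄ * E (+ (k ℕ.* k ℕ.+ k))
    ιA = trans (ι-* _ _) (*-cong (trans (ι-* _ _) (*-cong (trans (ι-* _ _) (*-congˡ (trans (ι-^P (poch q (q ^P 2) k) 3)
      (trans (triple _) (*-cong e (*-cong e e)))))) (ι-poch ι-q (ι-q^P 4) k))) (power-≈ (ι-qpow (k ℕ.* k ℕ.+ k))))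
      where
      e : ι (poch q (q ^P 2) k) ≈ Π k f₁
      e = ι-poch ι-q (ι-q^P 2) k
    ιB : ι B ≈ Π k f₂ * (Π k f₄ * (Π k f₄ * Π k f₄))
    ιB = trans (ι-* _ _) (*-cong (ι-poch (ι-q^P 2) (ι-q^P 2) k) (trans (ι-^P (poch (q ^P 4) (q ^P 4) k) 3)
      (trans (triple _) (*-cong e (*-cong e e)))))
      where
      e : ι (poch (q ^P 4) (q ^P 4) k) ≈ Π k f₄
      e = ι-poch (ι-q^P 4) (ι-q^P 4) k
    unit-B : Unit (ι B)
    unit-B = unit-resp (sym ιB) (unit-* (Π-unit k λ i _ → unit-1-E (positive-≢0 2 i 1 (ℤ.+-comm (+ 2) (+ 2 ℤ.* + i))))
      (unit-* u (unit-* u u)))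
      where
      u : Unit (Π k f₄)
      u = Π-unit k λ i _ → unit-1-E (positive-≢0 4 i 3 (ℤ.+-comm (+ 4) (+ 4 ℤ.* + i)))
    cube-≈ : cube a₀ (p ^ k) ≈ 1# - E (+ (6 ℕ.* k ℕ.+ 1))
    cube-≈ = trans (1-↦ (E-+′ (E↦ (+ 1)) (E-+′ (E-+′ (p^↦ k) (p^↦ k)) (p^↦ k))))
      (1-E-≡ (≡.trans (solveℤ 1 (λ k → # 1 ⊕ (# 2 ⊗ k ⊕ # 2 ⊗ k ⊕ # 2 ⊗ k) :≡ # 6 ⊗ k ⊕ # 1) ≡.refl (+ k)) (≡.cong (ℤ._+ + 1) (≡.sym (ℤ.pos-* 6 k)))))

  lhs : ℕ → Carrier
  lhs M = Σ (suc M) lhsValue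

  value-LHS : ∀ M → Value (LHS M) (lhs M)
  value-LHS M = value-sum (suc M) value-lhsTerm

  lhs-≈ : ∀ M → (1# - Q) * lhs M ≈ S a₀ σ₀ δ₀ (suc M)
  lhs-≈ M = trans (*-congˡ (Σ-*ˡ (suc M) (recip (1# - Q)) _)) (trans (sym (*-assoc _ _ _))
    (trans (*-congʳ (recip-inverse unit-1-Q)) (*-identityˡ _)))

  module RightSide (m n : ℕ) (n≡ : + n ≡ + 4 ℤ.* + m ℤ.+ + 1) where
    open Values m

    w : ℕ → Carrier
    w i = (1# - Q) * recip (A i)

    rhs : Carrier
    rhs = ι (qint n) * E (ℤ.- + m) * ρ * (1# - ι (qint n ^P 2) * Σ m (λ i → z i * (w i * w i)))

    value-RHS : Value (RHS n m) rhs
    value-RHS = value-* (value-* (value-* (value-poly (qint n))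
        (value-÷ oneP (qpow m) (unit-resp (sym (power-≈ (ι-qpow m))) (unit-E (+ m)))
          (trans (*-congˡ (power-≈ (ι-qpow m))) (trans (*-comm _ _) (trans (E-inverse (+ m)) (sym ι-1))))))
        (value-÷ _ _ (unit-resp (sym ιP₄) (Π-unit m λ i _ → unit-A i))
          (trans (*-congˡ ιP₄) (trans (hyper-Π m λ i _ → unit-A i) (sym (ι-poch (ι-q^P 2) (ι-q^P 4) m))))))
      (value-minus (value-resp ι-1 (value-poly oneP)) (value-* (value-poly (qint n ^P 2))
        (value-sum m λ i → value-÷ (qpow (4 ℕ.* suc i)) (qint (4 ℕ.* suc i) ^P 2)
          (unit-resp (sym (square i)) (unit-* (unit-qint i) (unit-qint i)))
          (begin
            z i * (w i * w i) * ι (qint (4 ℕ.* suc i) ^P 2)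
              ≈⟨ *-congˡ (square i) ⟩
            z i * (w i * w i) * (ι (qint (4 ℕ.* suc i)) * ι (qint (4 ℕ.* suc i)))
              ≈⟨ solve 3 (λ z w x → z :* (w :* w) :* (x :* x) := z :* (w :* x :* (w :* x))) refl (z i) (w i) (ι (qint (4 ℕ.* suc i))) ⟩
            z i * (w i * ι (qint (4 ℕ.* suc i)) * (w i * ι (qint (4 ℕ.* suc i))))
              ≈⟨ *-congˡ (*-cong (inverse i) (inverse i)) ⟩
            z i * (1# * 1#)
              ≈⟨ solve 1 (λ z → z :* (I :* I) := z) refl (z i) ⟩
            z i
              ≈⟨ trans (power-≈ (ι-qpow (4 ℕ.* suc i))) (E-≡ (exponent i)) ⟨
            ι (qpow (4 ℕ.* suc i)) ∎))))
      where
      ιP₄ : ι (poch (q ^P 4) (q ^P 4) m) ≈ Π m A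
      ιP₄ = ι-poch (ι-q^P 4) (ι-q^P 4) m
      exponent : ∀ i → + (4 ℕ.* suc i) ≡ + 4 ℤ.+ + 4 ℤ.* + i
      exponent i = ≡.trans (ℤ.pos-* 4 (suc i)) (solveℤ 1 (λ i → # 4 ⊗ (# 1 ⊕ i) :≡ # 4 ⊕ # 4 ⊗ i) ≡.refl (+ i))
      square : ∀ i → ι (qint (4 ℕ.* suc i) ^P 2) ≈ ι (qint (4 ℕ.* suc i)) * ι (qint (4 ℕ.* suc i))
      square i = trans (ι-^P (qint (4 ℕ.* suc i)) 2) (*-congˡ (*-identityʳ _))
      qint-A : ∀ i → (1# - Q) * ι (qint (4 ℕ.* suc i)) ≈ A i
      qint-A i = trans (ι-qint (4 ℕ.* suc i)) (1-E-≡ (exponent i))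
      inverse : ∀ i → w i * ι (qint (4 ℕ.* suc i)) ≈ 1#
      inverse i = trans (solve 3 (λ u r x → u :* r :* x := u :* x :* r) refl (1# - Q) (recip (A i)) _)
        (trans (*-congʳ (qint-A i)) (recip-inverse (unit-A i)))
      unit-qint : ∀ i → Unit (ι (qint (4 ℕ.* suc i)))
      unit-qint i = unit-factorʳ (unit-resp (sym (qint-A i)) (unit-A i))

    rhs-≈ : (1# - Q) * rhs ≈ V
    rhs-≈ = begin
      (1# - Q) * rhs
        ≈⟨ solve 5 (λ u n e r t → u :* (n :* e :* r :* t) := u :* n :* (e :* r) :* t) refl (1# - Q) (ι (qint n)) (E (ℤ.- + m)) ρ _ ⟩
      (1# - Q) * ι (qint n) * (E (ℤ.- + m) * ρ) * (1# - ι (qint n ^P 2) * Σ m (λ i → z i * (w i * w i)))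
        ≈⟨ *-cong (*-congʳ c-≈) (+-congˡ (-‿cong sum-≈)) ⟩
      V ∎
      where
      c-≈ : (1# - Q) * ι (qint n) ≈ 1# - E ν
      c-≈ = trans (ι-qint n) (1-E-≡ n≡)
      sum-≈ : ι (qint n ^P 2) * Σ m (λ i → z i * (w i * w i)) ≈ (1# - E ν) * (1# - E ν) * Y
      sum-≈ = begin
        ι (qint n ^P 2) * Σ m (λ i → z i * (w i * w i))
          ≈⟨ *-cong (trans (ι-^P (qint n) 2) (*-congˡ (*-identityʳ _))) (trans
               (Σ-cong m λ i _ → solve 3 (λ z u r → z :* (u :* r :* (u :* r)) := u :* u :* (z :* (r :* r))) refl (z i) (1# - Q) (recip (A i)))
               (Σ-*ˡ m ((1# - Q) * (1# - Q)) ζ)) ⟩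
        ι (qint n) * ι (qint n) * ((1# - Q) * (1# - Q) * Y)
          ≈⟨ solve 3 (λ n u y → n :* n :* (u :* u :* y) := u :* n :* (u :* n) :* y) refl (ι (qint n)) (1# - Q) Y ⟩
        (1# - Q) * ι (qint n) * ((1# - Q) * ι (qint n)) * Y
          ≈⟨ *-congʳ (*-cong c-≈ c-≈) ⟩
        (1# - E ν) * (1# - E ν) * Y ∎

  -- Assembling the congruences at the divisors of n

  module Supercongruence (Φ : ℕ → Poly) (cyclotomic : IsCyclotomic Φ) where
    open ℤ[q].Family X (λ k {x} {y} → cancelP {oneP -P X ℤ[q].^ suc k} {x} {y} (nonZero-1-X^ k)) Φ (cyclotomic-≋ cyclotomic)

    -- Membership in the localisation of ℤ[q] at the nonzero polynomials coprime to P; nonzero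
    -- integers are inverted with them.
    record IntegralAt (P : Poly) (x : Carrier) : Set where
      constructor integral
      field
        numerator denominator : Poly
        nonZero               : NonZeroP denominator
        coprime               : denominator ⟂ P
        fraction              : x * ι denominator ≈ ι numerator

    integral-ι : ∀ {P} p → IntegralAt P (ι p)
    integral-ι {P} p = integral p oneP (here λ ()) (ℤ[q].1⟂ P) (trans (*-congˡ ι-1) (*-identityʳ _))

    isSubring : ∀ P → IsSubring F (IntegralAt P)
    isSubring P = record
      { int-resp = λ e (integral N D nz D⟂P f) → integral N D nz D⟂P (trans (*-congʳ (sym e)) f)
      ; int-0    = resp ι-0 (integral-ι [])
      ; int-1    = resp ι-1 (integral-ι oneP)
      ; int-+    = λ {x} {y} (integral N D nz D⟂P f) (integral N′ D′ nz′ D′⟂P f′) →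
          integral (N *P D′ +P N′ *P D) (D *P D′) (nonZeroP-* {D} {D′} nz nz′) (ℤ[q].⟂-*ˡ D⟂P D′⟂P) (begin
            (x + y) * ι (D *P D′)                   ≈⟨ *-congˡ (ι-* D D′) ⟩
            (x + y) * (ι D * ι D′)                  ≈⟨ solve 4 (λ x y d e → (x :+ y) :* (d :* e) := x :* d :* e :+ y :* e :* d) refl x y (ι D) (ι D′) ⟩
            x * ι D * ι D′ + y * ι D′ * ι D         ≈⟨ +-cong (*-congʳ f) (*-congʳ f′) ⟩
            ι N * ι D′ + ι N′ * ι D                 ≈⟨ trans (ι-+ (N *P D′) (N′ *P D)) (+-cong (ι-* N D′) (ι-* N′ D)) ⟨
            ι (N *P D′ +P N′ *P D)                  ∎)
      ; int-*    = λ {x} {y} (integral N D nz D⟂P f) (integral N′ D′ nz′ D′⟂P f′) →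
          integral (N *P N′) (D *P D′) (nonZeroP-* {D} {D′} nz nz′) (ℤ[q].⟂-*ˡ D⟂P D′⟂P) (begin
            x * y * ι (D *P D′)                     ≈⟨ *-congˡ (ι-* D D′) ⟩
            x * y * (ι D * ι D′)                    ≈⟨ solve 4 (λ x y d e → x :* y :* (d :* e) := x :* d :* (y :* e)) refl x y (ι D) (ι D′) ⟩
            x * ι D * (y * ι D′)                    ≈⟨ *-cong f f′ ⟩
            ι N * ι N′                              ≈⟨ ι-* N N′ ⟨
            ι (N *P N′)                             ∎)
      ; int-neg  = λ {x} (integral N D nz D⟂P f) → integral (negP N) D nz D⟂P
          (trans (solve 2 (λ x d → (:- x) :* d := :- (x :* d)) refl x (ι D)) (trans (-‿cong f) (sym (ι-neg N))))
      }
      where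
      resp : ∀ {x y} → x ≈ y → IntegralAt P x → IntegralAt P y
      resp e (integral N D nz D⟂P f) = integral N D nz D⟂P (trans (*-congʳ (sym e)) f)

    module At (e′ : ℕ) where
      φ : Poly
      φ = Φ (suc e′)

      open Integrality F reciprocal (IntegralAt φ) (isSubring φ) public

      int-ι : ∀ p → IntegralAt φ (ι p)
      int-ι = integral-ι

      intUnit-ι : ∀ p → NonZeroP p → p ⟂ φ → IntUnit (ι p)
      intUnit-ι p nz p⟂φ = int-ι p , recip (ι p) ,
        integral oneP p nz p⟂φ (trans (*-comm _ _) (trans (recip-inverse (ι-unit nz)) (sym ι-1))) , recip-inverse (ι-unit nz)

      X⟂φ : X ⟂ φ
      X⟂φ = X ℤ[q].^ e′ , proj₁ (Φ∣ e′) , + 1 , (λ ()) , ℤ[q].trans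
        (ℤ[q].+-cong (ℤ[q].*-comm (X ℤ[q].^ e′) X) (ℤ[q].trans (ℤ[q].*-comm (proj₁ (Φ∣ e′)) φ) (ℤ[q].sym (proj₂ (Φ∣ e′)))))
        (ℤ[q].solve 1 (λ x → x ℤ[q].:+ (ℤ[q].con (+ 1) ℤ[q].:- x) ℤ[q].:= ℤ[q].con (+ 1)) ℤ[q].refl (X ℤ[q].^ suc e′))

      int-Q : IntegralAt φ Q
      int-Q = int-ι X

      int-Q⁻¹ : IntegralAt φ Q⁻¹
      int-Q⁻¹ = int-recip (intUnit-ι X nonZero-X X⟂φ)

      open Residues (IntegralAt φ) (isSubring φ) int-Q int-Q⁻¹ public

      intUnit-1-Q^ : ∀ k → ¬ suc e′ ℕ.∣ suc k → IntUnit (1# - Q ^ suc k)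
      intUnit-1-Q^ k e∤k = intUnit-resp (ι-1-X^ (suc k)) (intUnit-ι (oneP -P X ℤ[q].^ suc k) (nonZero-1-X^ k) (1-X^-⟂ (suc k) e′ e∤k))

      intUnit-E : ∀ z → IntUnit (E z)
      intUnit-E z = int-E z , E (ℤ.- z) , int-E (ℤ.- z) , E-inverse z

      intUnit-1-E : ∀ z → ¬ suc e′ ℕ.∣ ∣ z ∣ → IntUnit (1# - E z)
      intUnit-1-E (+ zero)  e∤0 = contradiction (suc e′ ℕ.∣0) e∤0
      intUnit-1-E (+ suc k) e∤k = intUnit-1-Q^ k e∤k
      intUnit-1-E -[1+ k ]  e∤k = intUnit-resp (sym (1-E-negative k)) (intUnit-* (intUnit-neg (intUnit-E -[1+ k ])) (intUnit-1-Q^ k e∤k))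
        where
        intUnit-neg : ∀ {x} → IntUnit x → IntUnit (- x)
        intUnit-neg {x} (ix , u , iu , e) = int-neg ix , - u , int-neg iu ,
          trans (solve 2 (λ x u → (:- x) :* (:- u) := x :* u) refl x u) e

      -- The quotient of 1 - X^(e (k + 1)) by 1 - X^e is a geometric sum coprime to Φ e; so 1 - q^(e
      -- (k + 1)) contains no more of Φ e than 1 - q^e does.
      multiple : ∀ k → ∃ λ u → IntUnit u × 1# - E (+ suc e′ ℤ.* + suc k) ≈ (1# - E (+ suc e′)) * u
      multiple k = ι g , intUnit-ι g (unit-ι⇒nonZero {g} (unit-factorʳ (unit-resp (sym product) unit-product))) (geometric-⟂ e′ k) ,
        trans 1-E-≈ (trans (sym product) (*-congʳ (ι-1-X^ (suc e′))))
        where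
        Xᵉ g : Poly
        Xᵉ = X ℤ[q].^ suc e′
        g  = ℤ[q].Σ (suc k) (Xᵉ ℤ[q].^_)
        L : ℕ
        L = suc e′ ℕ.* suc k
        product : ι (oneP -P Xᵉ) * ι g ≈ ι (oneP -P X ℤ[q].^ L)
        product = trans (sym (ι-* (oneP -P Xᵉ) g)) (ι-cong (ℤ[q].trans (ℤ[q].geometric Xᵉ (suc k))
          (ℤ[q].+-congˡ {oneP} (ℤ[q].-‿cong (ℤ[q].^-assocʳ X (suc e′) (suc k))))))
        1-E-≈ : 1# - E (+ suc e′ ℤ.* + suc k) ≈ ι (oneP -P X ℤ[q].^ L)
        1-E-≈ = trans (1-E-≡ (≡.sym (ℤ.pos-* (suc e′) (suc k)))) (sym (ι-1-X^ L))
        unit-product : Unit (ι (oneP -P X ℤ[q].^ L))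
        unit-product = ι-unit (nonZero-1-X^ (k ℕ.+ e′ ℕ.* suc k))

      -- The series computes 1 - q times the two sides of the theorem. For e > 1 this factor is
      -- invertible in the subring and can be removed; at Φ 1 it would not be.
      intUnit-1-Q : 0 < e′ → IntUnit (1# - Q)
      intUnit-1-Q e′>0 = intUnit-resp (+-congˡ (-‿cong (*-identityʳ Q)))
        (intUnit-1-Q^ 0 λ d → ℕ.<⇒≱ (s≤s e′>0) (ℕ.∣⇒≤ d))

    module Difference (m M : ℕ) (M-cases : M ≡ m ℕ.+ m ⊎ M ≡ m ℕ.+ m ℕ.+ (m ℕ.+ m)) where
      n n′ : ℕ
      n′ = m ℕ.+ m ℕ.+ (m ℕ.+ m)
      n  = suc n′

      open Values m
      open RightSide m n (+n≡ m)

      Δ : Carrier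
      Δ = lhs M - rhs

      Δ-≈ : (1# - Q) * Δ ≈ S a₀ σ₀ δ₀ (suc M) - V
      Δ-≈ = trans (solve 3 (λ u x y → u :* (x :- y) := u :* x :- u :* y) refl (1# - Q) (lhs M) rhs)
        (+-cong (lhs-≈ M) (-‿cong rhs-≈))

      -- The relation `CongR` with the difference taken in ℚ(q), before the denominators of the two
      -- sides are cleared.
      CongruentModulo : Poly → Set
      CongruentModulo P = ∃ λ D → ∃ λ K → D ⟂ P × Δ * ι D ≈ ι P * ι K

      congruent-resp : ∀ {P P′} → P ≋ P′ → CongruentModulo P → CongruentModulo P′
      congruent-resp e (D , K , D⟂P , f) = D , K , ℤ[q].⟂-resp ℤ[q].refl e D⟂P , trans f (*-congʳ (ι-cong e))

      -- With U P + V P′ = c, the combination V P′ D + U P D′ is c D modulo P and c D′ modulo P′.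
      congruent-* : ∀ {P P′} → P ⟂ P′ → CongruentModulo P → CongruentModulo P′ → CongruentModulo (P *P P′)
      congruent-* {P} {P′} (U , V′ , c , c≢0 , bezout-≈) (D , K , D⟂P , f) (D′ , K′ , D′⟂P′ , f′) =
        D″ , V′ *P K +P U *P K′ , ℤ[q].⟂-*ʳ D″⟂P D″⟂P′ , (begin
          Δ * ι D″
            ≈⟨ *-congˡ (trans (ι-+ (V′ *P P′ *P D) (U *P P *P D′)) (+-cong (ι-*₃ V′ P′ D) (ι-*₃ U P D′))) ⟩
          Δ * (ι V′ * ι P′ * ι D + ι U * ι P * ι D′)
            ≈⟨ solve 7 (λ x v p′ d u p d′ → x :* (v :* p′ :* d :+ u :* p :* d′) := v :* p′ :* (x :* d) :+ u :* p :* (x :* d′)) refl Δ (ι V′) (ι P′) (ι D) (ι U) (ι P) (ι D′) ⟩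
          ι V′ * ι P′ * (Δ * ι D) + ι U * ι P * (Δ * ι D′)
            ≈⟨ +-cong (*-congˡ f) (*-congˡ f′) ⟩
          ι V′ * ι P′ * (ι P * ι K) + ι U * ι P * (ι P′ * ι K′)
            ≈⟨ solve 6 (λ v p′ p k u k′ → v :* p′ :* (p :* k) :+ u :* p :* (p′ :* k′) := p :* p′ :* (v :* k :+ u :* k′)) refl (ι V′) (ι P′) (ι P) (ι K) (ι U) (ι K′) ⟩
          ι P * ι P′ * (ι V′ * ι K + ι U * ι K′)
            ≈⟨ *-cong (ι-* P P′) (trans (ι-+ (V′ *P K) (U *P K′)) (+-cong (ι-* V′ K) (ι-* U K′))) ⟨
          ι (P *P P′) * ι (V′ *P K +P U *P K′) ∎)
        where
        module Z = ℤ[q]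
        D″ = V′ *P P′ *P D +P U *P P *P D′
        ι-*₃ : ∀ x y z → ι (x *P y *P z) ≈ ι x * ι y * ι z
        ι-*₃ x y z = trans (ι-* (x *P y) z) (*-congʳ (ι-* x y))
        constant : ∀ {P} → Z.fromℤ c ⟂ P
        constant {P} = oneP , [] , c , c≢0 , Z.solve 2 (λ c P → Z.con (+ 1) Z.:* c Z.:+ Z.con (+ 0) Z.:* P Z.:= c) Z.refl (Z.fromℤ c) P
        D″⟂P : D″ ⟂ P
        D″⟂P = Z.⟂-mod (U *P D′ -P U *P D)
          (Z.trans (Z.solve 6 (λ V P′ D U P D′ → V Z.:* P′ Z.:* D Z.:+ U Z.:* P Z.:* D′ Z.:= (U Z.:* P Z.:+ V Z.:* P′) Z.:* D Z.:+ P Z.:* (U Z.:* D′ Z.:- U Z.:* D)) Z.refl V′ P′ D U P D′)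
            (Z.+-congʳ {P *P (U *P D′ -P U *P D)} (Z.*-congʳ {D} bezout-≈)))
          (Z.⟂-*ˡ constant D⟂P)
        D″⟂P′ : D″ ⟂ P′
        D″⟂P′ = Z.⟂-mod (V′ *P D -P V′ *P D′)
          (Z.trans (Z.solve 6 (λ V P′ D U P D′ → V Z.:* P′ Z.:* D Z.:+ U Z.:* P Z.:* D′ Z.:= (U Z.:* P Z.:+ V Z.:* P′) Z.:* D′ Z.:+ P′ Z.:* (V Z.:* D Z.:- V Z.:* D′)) Z.refl V′ P′ D U P D′)
            (Z.+-congʳ {P′ *P (V′ *P D -P V′ *P D′)} (Z.*-congʳ {D′} bezout-≈)))
          (Z.⟂-*ˡ constant D′⟂P′)

      congruent-1 : CongruentModulo oneP
      congruent-1 = denominator , numerator , ℤ[q].⟂-sym (ℤ[q].1⟂ denominator) , (begin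
        Δ * ι denominator             ≈⟨ Value.value-≈ v ⟩
        ι numerator                   ≈⟨ *-identityˡ _ ⟨
        1# * ι numerator              ≈⟨ *-congʳ ι-1 ⟨
        ι oneP * ι numerator          ∎)
        where
        v = value-minus (value-LHS M) value-RHS
        denominator = den (LHS M -R RHS n m)
        numerator = num (LHS M -R RHS n m)

      congruent⇒CongR : ∀ {P} → CongruentModulo P → CongR (LHS M) (RHS n m) P
      congruent⇒CongR {P} (D , K , D⟂P , f) = P *P K , D , (K , λ _ → ≡.refl) , ⟂⇒CoprimeP D⟂P , coeff-≡ (ι-injective (begin
        ι (top *P D)                                      ≈⟨ ι-* top D ⟩
        ι top * ι D                                       ≈⟨ *-congʳ (Value.value-≈ v) ⟨
        Δ * ι bottom * ι D                                   ≈⟨ solve 3 (λ x b d → x :* b :* d := x :* d :* b) refl Δ (ι bottom) (ι D) ⟩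
        Δ * ι D * ι bottom                                   ≈⟨ *-congʳ (trans f (sym (ι-* P K))) ⟩
        ι (P *P K) * ι bottom                                ≈⟨ ι-* (P *P K) bottom ⟨
        ι (P *P K *P bottom)                                 ∎))
        where
        v = value-minus (value-LHS M) value-RHS
        top = num (LHS M -R RHS n m)
        bottom = den (LHS M -R RHS n m)

      -- Divisibility was obtained for powers of 1 - q^e, which are multiples P K of the modulus
      -- sought; the surplus K joins the quotient. The denominator is known to be coprime to φ, and
      -- `⟂-power` extends this to P.
      divisible⇒congruent : ∀ {φ x} P K → IntegralAt φ x → (∀ D → D ⟂ φ → D ⟂ P) → Δ ≈ ι (P *P K) * x → CongruentModulo P
      divisible⇒congruent {φ} {x} P K (integral N D nz D⟂φ f) ⟂-power e = D , K *P N , ⟂-power D D⟂φ , (begin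
        Δ * ι D                         ≈⟨ *-congʳ e ⟩
        ι (P *P K) * x * ι D            ≈⟨ *-assoc _ _ _ ⟩
        ι (P *P K) * (x * ι D)          ≈⟨ *-cong (ι-* P K) f ⟩
        ι P * ι K * ι N                 ≈⟨ *-assoc _ _ _ ⟩
        ι P * (ι K * ι N)               ≈⟨ *-congˡ (ι-* K N) ⟨
        ι P * ι (K *P N)                ∎)

      congruent-divisor : ∀ e′ → 0 < e′ → suc e′ ℕ.∣ n → CongruentModulo (Φ (suc e′))
      congruent-divisor e′ e′>0 e∣n = divisible⇒congruent (Φ (suc e′)) (proj₁ (Φ∣ e′)) (proj₁ (proj₂ d∣Δ)) (λ _ D⟂φ → D⟂φ)
        (trans (proj₂ (proj₂ d∣Δ)) (*-congʳ (trans (sym (ι-1-X^ (suc e′))) (ι-cong (proj₂ (Φ∣ e′))))))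
        where
        open At e′
        open OddDivisor (oddDivisor m e′ e′>0 e∣n)
        odd-e : ∀ c → suc e′ ℕ.∣ 2 ℕ.* c → suc e′ ℕ.∣ c
        odd-e = ≡.subst (λ k → ∀ c → suc k ℕ.∣ 2 ℕ.* c → suc k ℕ.∣ c) (≡.sym e′≡) (odd-cancel-2 h)
        cast : ∀ {x y} a b → x ℕ.* y ≡ 4 ℕ.* a ℕ.+ b → + x ℤ.* + y ≡ + 4 ℤ.* + a ℤ.+ + b
        cast {x} {y} a b eq = ≡.trans (≡.sym (ℤ.pos-* x y)) (≡.trans (≡.cong +_ eq) (≡.cong (ℤ._+ + b) (ℤ.pos-* 4 a)))
        module Div = Divisor e′ h e′≡ m′ (+ j) (cast {suc e′} {j} m′ 1 ej≡) m′≤e′ m′>0 odd-e intUnit-1-E multiple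
        d∣S : M ≡ m ℕ.+ m ⊎ M ≡ n′ → Div.d ∣ S a₀ σ₀ δ₀ (suc M)
        d∣S (inj₁ ≡.refl) = ≡.subst (λ k → Div.d ∣ S a₀ σ₀ δ₀ k) (≡.sym half≡) (Div.d∣S-half l)
        d∣S (inj₂ ≡.refl) = ≡.subst (λ k → Div.d ∣ S a₀ σ₀ δ₀ k) (≡.sym n≡) (Div.d∣S-multiple (suc (l ℕ.+ l)))
        ef≡ : + suc e′ ℤ.* + suc (l ℕ.+ l) ≡ + 4 ℤ.* + m ℤ.+ + 1
        ef≡ = ≡.trans (≡.sym (ℤ.pos-* (suc e′) (suc (l ℕ.+ l)))) (≡.trans (≡.cong +_ (≡.trans (ℕ.*-comm (suc e′) (suc (l ℕ.+ l))) (≡.sym n≡))) (+n≡ m))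
        d∣Δ : Div.d ∣ Δ
        d∣Δ = ∣-cancel (intUnit-1-Q e′>0) (∣-resp (sym Δ-≈) (∣-minus (d∣S M-cases) (Div.d∣V m (+ suc (l ℕ.+ l)) ef≡)))

      -- Of the four factors, three form the cube in the modulus and the remaining one is the factor
      -- of index n in the q-integer.
      congruent-top : 0 < m → CongruentModulo (Φ n *P (Φ n ^P 3))
      congruent-top m>0 = divisible⇒congruent (φ *P (φ ^P 3)) (K *P (K ^P 3)) (proj₁ (proj₂ c⁴∣Δ))
        (λ D D⟂φ → ℤ[q].⟂-*ʳ D⟂φ (ℤ[q].⟂-*ʳ D⟂φ (ℤ[q].⟂-*ʳ D⟂φ (ℤ[q].⟂-*ʳ D⟂φ (ℤ[q].⟂-sym (ℤ[q].1⟂ D))))))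
        (trans (proj₂ (proj₂ c⁴∣Δ)) (*-congʳ c⁴-≈))
        where
        open At n′
        K = proj₁ (Φ∣ n′)
        n∤ : ∀ k → k < n′ → ¬ n ℕ.∣ suc k
        n∤ k k<n′ = ℕ.>⇒∤ (s≤s k<n′)
        n∤′ : ∀ k → k < m ℕ.+ m → ¬ n ℕ.∣ suc k
        n∤′ k k<2m = n∤ k (ℕ.<-≤-trans k<2m (ℕ.m≤m+n (m ℕ.+ m) (m ℕ.+ m)))
        odd-n = odd-cancel-2 (m ℕ.+ m)
        module Top = Prime-power m n (+n≡ m) odd-n intUnit-1-E n∤′
        open Top using (c; c⁴; S₀₀; S₁₀)
        V-≈ : S₁₀ * (1# - c * c * Y) ≈ V
        V-≈ = *-congʳ (S-closed ℕ.≤-refl)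
        c⁴∣S-V : M ≡ m ℕ.+ m ⊎ M ≡ n′ → c⁴ ∣ S a₀ σ₀ δ₀ (suc M) - V
        c⁴∣S-V (inj₁ ≡.refl) = ∣-resp (+-congˡ (-‿cong V-≈)) Top.main-congruence
        c⁴∣S-V (inj₂ ≡.refl) = ∣-resp (trans (solve 3 (λ s t v → s :- t :+ (t :- v) := s :- v) refl (S a₀ σ₀ δ₀ n) S₀₀ (S₁₀ * (1# - c * c * Y))) (+-congˡ (-‿cong V-≈)))
          (∣-+ (Top.tail-congruence n∤ m>0) Top.main-congruence)
        n′>0 : 0 < n′
        n′>0 = ℕ.<-≤-trans m>0 (ℕ.≤-trans (ℕ.m≤m+n m m) (ℕ.m≤m+n (m ℕ.+ m) (m ℕ.+ m)))
        c⁴∣Δ : c⁴ ∣ Δ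
        c⁴∣Δ = ∣-cancel (intUnit-1-Q n′>0) (∣-resp (sym Δ-≈) (c⁴∣S-V M-cases))
        c-≈ : c ≈ ι φ * ι K
        c-≈ = trans (1-E-≡ (≡.sym (+n≡ m))) (trans (sym (ι-1-X^ n)) (trans (ι-cong (proj₂ (Φ∣ n′))) (ι-* φ K)))
        fourth : ∀ p → ι (p *P (p ^P 3)) ≈ ι p * (ι p * (ι p * (ι p * 1#)))
        fourth p = trans (ι-* p (p ^P 3)) (*-congˡ (ι-^P p 3))
        c⁴-≈ : c⁴ ≈ ι (φ *P (φ ^P 3) *P (K *P (K ^P 3)))
        c⁴-≈ = begin
          c * c * (c * c)                 ≈⟨ *-cong (*-cong c-≈ c-≈) (*-cong c-≈ c-≈) ⟩
          ι φ * ι K * (ι φ * ι K) * (ι φ * ι K * (ι φ * ι K))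
            ≈⟨ solve 2 (λ a b → a :* b :* (a :* b) :* (a :* b :* (a :* b)) := a :* (a :* (a :* (a :* I))) :* (b :* (b :* (b :* (b :* I))))) refl (ι φ) (ι K) ⟩
          ι φ * (ι φ * (ι φ * (ι φ * 1#))) * (ι K * (ι K * (ι K * (ι K * 1#))))
            ≈⟨ trans (ι-* (φ *P (φ ^P 3)) (K *P (K ^P 3))) (*-cong (fourth φ) (fourth K)) ⟨
          ι (φ *P (φ ^P 3) *P (K *P (K ^P 3))) ∎

      congruent-divisors : ∀ k → suc k < n → CongruentModulo (divProd₊ n k)
      congruent-divisors zero    _   = congruent-1
      congruent-divisors (suc k) k<n = extend (divProd₊-suc n k)
        where
        previous : CongruentModulo (divProd₊ n k)
        previous = congruent-divisors k (ℕ.<-trans ℕ.≤-refl k<n)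
        extend : (suc (suc k) ℕ.∣ n × divProd₊ n (suc k) ≡ divProd₊ n k *P Φ (suc (suc k))) ⊎ divProd₊ n (suc k) ≡ divProd₊ n k →
          CongruentModulo (divProd₊ n (suc k))
        extend (inj₁ (e∣n , eq)) = ≡.subst CongruentModulo (≡.sym eq)
          (congruent-* (ℤ[q].⟂-sym (divProd₊-⟂ n k ℕ.≤-refl)) previous (congruent-divisor (suc k) (s≤s z≤n) e∣n))
        extend (inj₂ eq) = ≡.subst CongruentModulo (≡.sym eq) previous

      supercongruence : CongR (LHS M) (RHS n m) (qint n *P (Φ n ^P 3))
      supercongruence = congruent⇒CongR (assemble m ≡.refl)
        where
        assemble : ∀ k → m ≡ k → CongruentModulo (qint n *P (Φ n ^P 3))
        -- For n = 1 the two sides coincide. The general argument stops here, because it divides by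
        -- 1 - q, which is not coprime to Φ 1.
        assemble zero ≡.refl = oneP , [] , ℤ[q].1⟂ (qint 1 *P (Φ 1 ^P 3)) , trans (*-congʳ Δ≈0) (trans (zeroˡ _) (sym (trans (*-congˡ ι-0) (zeroʳ _))))
          where
          M≡0 : M ≡ 0 ⊎ M ≡ 0 → S a₀ σ₀ δ₀ (suc M) ≈ S a₀ σ₀ δ₀ 1
          M≡0 (inj₁ ≡.refl) = refl
          M≡0 (inj₂ ≡.refl) = refl
          Δ≈0 : Δ ≈ 0#
          Δ≈0 = unit-cancel-0 unit-1-Q (trans Δ-≈ (trans (+-congʳ (M≡0 M-cases))
            (solve 1 (λ x → O :+ (I :- x :* (I :* I :* I)) :* I :- (I :- x) :* (I :* I) :* (I :- (I :- x) :* (I :- x) :* O) := O) refl (E (+ 1)))))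
        -- The q-integer is the product over the divisors 1 < d < n times Φ n; its last factor is
        -- regrouped with the cube to the fourth power covered by `congruent-top`.
        assemble (suc k) ≡.refl = congruent-resp (ℤ[q].trans
          (ℤ[q].solve 3 (λ a b c → a ℤ[q].:* (b ℤ[q].:* c) ℤ[q].:= a ℤ[q].:* b ℤ[q].:* c) ℤ[q].refl (divProd₊ n n″) (Φ n) (Φ n ^P 3))
          (ℤ[q].*-congʳ {Φ n ^P 3} (ℤ[q].sym (ℤ[q].trans (qint-≋ n) (divProd₊-factor n″)))))
          (congruent-* (ℤ[q].⟂-*ʳ t (ℤ[q].⟂-*ʳ t (ℤ[q].⟂-*ʳ t (ℤ[q].⟂-*ʳ t (ℤ[q].⟂-sym (ℤ[q].1⟂ (divProd₊ n n″)))))))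
            (congruent-divisors n″ ℕ.≤-refl) (congruent-top (s≤s z≤n)))
          where
          n″ = k ℕ.+ suc k ℕ.+ (suc k ℕ.+ suc k)
          t : divProd₊ n n″ ⟂ Φ n
          t = ℤ[q].⟂-sym (divProd₊-⟂ n n″ ℕ.≤-refl)

-- Specialisation to the field of rational functions

nonZeroDivisors : NonZeroDivisors polyRing
nonZeroDivisors = record
  { NZ        = NonZeroP
  ; nz-1      = here λ ()
  ; nz-*      = λ {p} {r} → nonZeroP-* {p} {r}
  ; nz-resp   = nonZeroP-resp
  ; nz-cancel = λ {p} r → nonZeroP-cancel {p} r
  ; nz⊎0      = nonZeroP⊎zero
  ; ¬nz-0     = ¬nonZeroP-[]
  }

module ℚ⟨q⟩ = Fractions polyRing nonZeroDivisors

reciprocal : Reciprocal ℚ⟨q⟩.fractionRing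
reciprocal = record { recip = ℚ⟨q⟩.recip ; recip-inverse = λ {x} → ℚ⟨q⟩.recip-inverse {x} }

embedding : Embedding ℚ⟨q⟩.fractionRing
embedding = record
  { ι           = ℚ⟨q⟩.ι
  ; ι-cong      = λ {p} {r} → ℚ⟨q⟩.ι-cong {p} {r}
  ; ι-injective = λ {p} {r} → ℚ⟨q⟩.ι-injective {p} {r}
  ; ι-+         = ℚ⟨q⟩.ι-+
  ; ι-*         = ℚ⟨q⟩.ι-*
  ; ι-neg       = ℚ⟨q⟩.ι-neg
  ; ι-0         = ℚ⟨q⟩.mk≃ ℤ[q].refl
  ; ι-1         = ℚ⟨q⟩.mk≃ ℤ[q].refl
  ; ι-unit      = λ {p} → ℚ⟨q⟩.ι-unit {p}
  }

open import Data.Nat using (_∸_; _/_; _%_; _*_)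

theorem1p2 : (Φ : ℕ → Poly) → IsCyclotomic Φ →
    (n : ℕ) → 0 < n → n % 4 ≡ 1 →
    (M : ℕ) → (M ≡ (n ∸ 1) / 2 ⊎ M ≡ n ∸ 1) →
    CongR (LHS M) (RHS n ((n ∸ 1) / 4)) (qint n *P (Φ n ^P 3))
theorem1p2 Φ cyclotomic n _ n%4≡1 = statement n (n / 4) n≡
  where
  n≡ : n ≡ suc (n / 4 ℕ.+ n / 4 ℕ.+ (n / 4 ℕ.+ n / 4))
  n≡ = ≡.trans (ℕ.m≡m%n+[m/n]*n n 4) (≡.trans (≡.cong (ℕ._+ n / 4 * 4) n%4≡1) (four (n / 4)))
    where
    four : ∀ m → 1 ℕ.+ m * 4 ≡ suc (m ℕ.+ m ℕ.+ (m ℕ.+ m))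
    four = solve-∀

  statement : ∀ n m → n ≡ suc (m ℕ.+ m ℕ.+ (m ℕ.+ m)) → ∀ M → (M ≡ (n ∸ 1) / 2 ⊎ M ≡ n ∸ 1) →
    CongR (LHS M) (RHS n ((n ∸ 1) / 4)) (qint n *P (Φ n ^P 3))
  statement _ m ≡.refl M M-cases = ≡.subst (λ k → CongR (LHS M) (RHS n′ k) (qint n′ *P (Φ n′ ^P 3))) (≡.sym quarter)
    (Difference.supercongruence m M (cases M-cases))
    where
    open RationalFunctions.Supercongruence ℚ⟨q⟩.fractionRing reciprocal embedding Φ cyclotomic using (module Difference)
    L n′ : ℕ
    L  = m ℕ.+ m ℕ.+ (m ℕ.+ m)
    n′ = suc L
    double : ∀ k → k ℕ.+ k ≡ k * 2
    double = solve-∀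
    quadruple : ∀ k → k ℕ.+ k ℕ.+ (k ℕ.+ k) ≡ k * 4
    quadruple = solve-∀
    quarter : L / 4 ≡ m
    quarter = ≡.trans (≡.cong (_/ 4) (quadruple m)) (ℕ.m*n/n≡m m 4)
    cases : (M ≡ L / 2 ⊎ M ≡ L) → (M ≡ m ℕ.+ m ⊎ M ≡ L)
    cases (inj₁ e) = inj₁ (≡.trans e (≡.trans (≡.cong (_/ 2) (double (m ℕ.+ m))) (ℕ.m*n/n≡m (m ℕ.+ m) 2)))
    cases (inj₂ e) = inj₂ e
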